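{- There exist non-empty sets $S_q\subseteq\mathbb{Z}_{>0}$, for $q\in\{2,3,4,5,7,11,13,17,19\}$, such that the $3$-dimensional Fine $\mathbb{Q}$-codegree spectrum is $$S^F(3)=\left\{\frac{q}{k\cdot\ell}\;\middle|\; q\in\{2,3,4,5,7,11,13,17,19\},\ \ell\in S_q,\ k\in\mathbb{Z}_{>0}\right\}.$$
   Context: For a $d$-dimensional rational polytope $P\subseteq\mathbb{R}^d$ and $a\in(\mathbb{Z}^d)^*$ let $h_P(a)=\min_{x\in P}\langle a,x\rangle$. For $s>0$ the Fine adjoint polytope is $P^{F(s)}=\{x\in\mathbb{R}^d : \langle a,x\rangle\ge h_P(a)+s \text{ for all } a\in(\mathbb{Z}^d)^*\setminus\{0\}\}$. The Fine $\mathbb{Q}$-codegree is $\mu^F(P)=(\sup\{s>0 : P^{F(s)}\neq\emptyset\})^{ -1}$. The Fine spectrum in dimension $d$ is $S^F(d)=\{\mu^F(P) : P \text{ a } d\text{ -dimensional lattice polytope}\}$, lattice polytopes being those with vertices in $\mathbb{Z}^d$. -}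

module Defs where

open import Algebra.Bundles using (CommutativeMonoid)
import Algebra.Properties.CommutativeSemigroup as CommutativeSemigroupProperties
open import Data.Integer as ℤ using (ℤ; +_; 0ℤ)
open import Data.List using (List; []; _∷_)
open import Data.Nat as ℕ using (ℕ; suc; NonZero; _⊔_)
import Data.Nat.Properties as ℕP
open import Data.Product using (Σ-syntax; ∃-syntax; _×_; _,_)
open import Data.Rational as ℚ using (ℚ; 0ℚ; 1ℚ)
import Data.Rational.Properties as ℚP
open import Data.Vec.Functional using (Vector; foldr)
open import Level using (0ℓ)
open import Relation.Binary.PropositionalEquality
  using (_≡_; sym; trans; cong; cong₂; subst₂)
open import Relation.Nullary using (¬_)
open import Relation.Unary using (Pred; _∈_)

-- Reals are Cauchy sequences of rationals up to _≃_.

IsCauchy : (ℕ → ℚ) → Set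
IsCauchy x = ∀ ε → 0ℚ ℚ.< ε →
  ∃[ N ] (∀ m n → N ℕ.≤ m → N ℕ.≤ n → ℚ.∣ x m ℚ.- x n ∣ ℚ.≤ ε)

record ℝ : Set where
  constructor mkℝ
  field
    seq    : ℕ → ℚ
    cauchy : IsCauchy seq

open ℝ public

infix 4 _≃_ _≤_ _<_

_≃_ : ℝ → ℝ → Set
x ≃ y = ∀ ε → 0ℚ ℚ.< ε →
  ∃[ N ] (∀ n → N ℕ.≤ n → ℚ.∣ seq x n ℚ.- seq y n ∣ ℚ.≤ ε)

_≤_ : ℝ → ℝ → Set
x ≤ y = ∀ ε → 0ℚ ℚ.< ε →
  ∃[ N ] (∀ n → N ℕ.≤ n → seq x n ℚ.≤ seq y n ℚ.+ ε)

_<_ : ℝ → ℝ → Set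
x < y = ∃[ ε ] (0ℚ ℚ.< ε ×
  ∃[ N ] (∀ n → N ℕ.≤ n → seq x n ℚ.+ ε ℚ.≤ seq y n))

fromℚ : ℚ → ℝ
fromℚ p = mkℝ (λ _ → p) λ ε ε>0 → 0 , λ _ _ _ _ →
  ℚP.≤-trans (ℚP.≤-reflexive (cong ℚ.∣_∣ (ℚP.+-inverseʳ p))) (ℚP.<⇒≤ ε>0)

fromℤ : ℤ → ℝ
fromℤ i = fromℚ (i ℚ./ 1)

0ℝ 1ℝ : ℝ
0ℝ = fromℚ 0ℚ
1ℝ = fromℚ 1ℚ

private
  -- Every ε > 0 can be written δ * M for a given M > 0.
  split : ∀ M → 0ℚ ℚ.< M → ∀ ε → 0ℚ ℚ.< ε → ∃[ δ ] (0ℚ ℚ.< δ × δ ℚ.* M ≡ ε)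
  split M M>0 ε ε>0 = δ , ℚP.positive⁻¹ δ , eq
    where
    instance
      M⁺ : ℚ.Positive M
      M⁺ = ℚ.positive M>0
      M≢0 : ℚ.NonZero M
      M≢0 = ℚP.pos⇒nonZero M
      ε⁺ : ℚ.Positive ε
      ε⁺ = ℚ.positive ε>0
      1/M⁺ : ℚ.Positive (ℚ.1/ M)
      1/M⁺ = ℚP.1/pos⇒pos M
    δ : ℚ
    δ = ε ℚ.* ℚ.1/ M
    instance
      δ⁺ : ℚ.Positive δ
      δ⁺ = ℚP.pos*pos⇒pos ε (ℚ.1/ M)
    eq : δ ℚ.* M ≡ ε
    eq = trans (ℚP.*-assoc ε (ℚ.1/ M) M)
               (trans (cong (ε ℚ.*_) (ℚP.*-inverseˡ M)) (ℚP.*-identityʳ ε))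

  recentre : ∀ p r → p ≡ (p ℚ.- r) ℚ.+ r
  recentre p r = sym (trans (ℚP.+-assoc p (ℚ.- r) r)
    (trans (cong (p ℚ.+_) (ℚP.+-inverseˡ r)) (ℚP.+-identityʳ p)))

  bounded : ∀ x → IsCauchy x →
    ∃[ N ] ∃[ B ] (0ℚ ℚ.< B × (∀ n → N ℕ.≤ n → ℚ.∣ x n ∣ ℚ.≤ B))
  bounded x cx with cx 1ℚ (ℚP.positive⁻¹ 1ℚ)
  ... | N , close = N , 1ℚ ℚ.+ ℚ.∣ x N ∣ ,
    ℚP.+-mono-<-≤ (ℚP.positive⁻¹ 1ℚ) (ℚP.0≤∣p∣ (x N)) , λ n N≤n →
    ℚP.≤-trans
      (ℚP.≤-reflexive (cong ℚ.∣_∣ (recentre (x n) (x N))))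
      (ℚP.≤-trans (ℚP.∣p+q∣≤∣p∣+∣q∣ (x n ℚ.- x N) (x N))
        (ℚP.+-monoˡ-≤ ℚ.∣ x N ∣ (close n N N≤n ℕP.≤-refl)))

  *-mono-∣∣ : ∀ a b {A B} → 0ℚ ℚ.≤ A → ℚ.∣ a ∣ ℚ.≤ A → ℚ.∣ b ∣ ℚ.≤ B →
    ℚ.∣ a ℚ.* b ∣ ℚ.≤ A ℚ.* B
  *-mono-∣∣ a b {A} {B} A≥0 a≤A b≤B =
    ℚP.≤-trans (ℚP.≤-reflexive (ℚP.∣p*q∣≡∣p∣*∣q∣ a b))
      (ℚP.≤-trans
        (ℚP.*-monoʳ-≤-nonNeg ℚ.∣ b ∣ {{ℚ.nonNegative (ℚP.0≤∣p∣ b)}} a≤A)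
        (ℚP.*-monoˡ-≤-nonNeg A {{ℚ.nonNegative A≥0}} b≤B))

  open CommutativeSemigroupProperties
    (CommutativeMonoid.commutativeSemigroup ℚP.+-0-commutativeMonoid)
    using (interchange)

  regroup-+ : ∀ a b c d → (a ℚ.+ b) ℚ.- (c ℚ.+ d) ≡ (a ℚ.- c) ℚ.+ (b ℚ.- d)
  regroup-+ a b c d = trans (cong ((a ℚ.+ b) ℚ.+_) (ℚP.neg-distrib-+ c d))
    (interchange a b (ℚ.- c) (ℚ.- d))

  double : ∀ δ → δ ℚ.* (1ℚ ℚ.+ 1ℚ) ≡ δ ℚ.+ δ
  double δ = trans (ℚP.*-distribˡ-+ δ 1ℚ 1ℚ)
    (cong₂ ℚ._+_ (ℚP.*-identityʳ δ) (ℚP.*-identityʳ δ))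

  telescope : ∀ p r t → p ℚ.- t ≡ (p ℚ.- r) ℚ.+ (r ℚ.- t)
  telescope p r t = trans (cong (ℚ._- t) (recentre p r))
    (ℚP.+-assoc (p ℚ.- r) r (ℚ.- t))

  factorʳ : ∀ p r t → p ℚ.* t ℚ.- r ℚ.* t ≡ (p ℚ.- r) ℚ.* t
  factorʳ p r t = trans (cong (p ℚ.* t ℚ.+_) (ℚP.neg-distribˡ-* r t))
    (sym (ℚP.*-distribʳ-+ t p (ℚ.- r)))

  regroup-* : ∀ a b c d →
    a ℚ.* b ℚ.- c ℚ.* d ≡ (a ℚ.- c) ℚ.* b ℚ.+ (b ℚ.- d) ℚ.* c
  regroup-* a b c d = trans (telescope (a ℚ.* b) (c ℚ.* b) (c ℚ.* d))
    (cong₂ ℚ._+_ (factorʳ a c b)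
      (trans (cong₂ ℚ._-_ (ℚP.*-comm c b) (ℚP.*-comm c d)) (factorʳ b d c)))

-- The moduli of sums and products are kept abstract: no notion below depends
-- on them, and unfolding them makes conversion checking very slow.
abstract
  +-cauchy : ∀ {x y} → IsCauchy x → IsCauchy y → IsCauchy (λ n → x n ℚ.+ y n)
  +-cauchy {x} {y} cx cy ε ε>0
    with split (1ℚ ℚ.+ 1ℚ) (ℚP.positive⁻¹ (1ℚ ℚ.+ 1ℚ)) ε ε>0
  ... | δ , δ>0 , eq with cx δ δ>0 | cy δ δ>0
  ... | M , hx | N , hy = M ⊔ N , λ m n p q →
    subst₂ ℚ._≤_ (cong ℚ.∣_∣ (sym (regroup-+ (x m) (y m) (x n) (y n))))
      (trans (sym (double δ)) eq)
      (ℚP.≤-trans (ℚP.∣p+q∣≤∣p∣+∣q∣ (x m ℚ.- x n) (y m ℚ.- y n))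
        (ℚP.+-mono-≤
          (hx m n (ℕP.m⊔n≤o⇒m≤o M N p) (ℕP.m⊔n≤o⇒m≤o M N q))
          (hy m n (ℕP.m⊔n≤o⇒n≤o M N p) (ℕP.m⊔n≤o⇒n≤o M N q))))

  *-cauchy : ∀ {x y} → IsCauchy x → IsCauchy y → IsCauchy (λ n → x n ℚ.* y n)
  *-cauchy {x} {y} cx cy ε ε>0
    with bounded x cx | bounded y cy
  ... | K , A , A>0 , xA | L , B , B>0 , yB
    with split (B ℚ.+ A) (ℚP.+-mono-< B>0 A>0) ε ε>0
  ... | δ , δ>0 , eq with cx δ δ>0 | cy δ δ>0
  ... | M , hx | N , hy = (K ⊔ L) ⊔ (M ⊔ N) , λ m n p q →
    let p₁ = ℕP.m⊔n≤o⇒m≤o (K ⊔ L) (M ⊔ N) p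
        p₂ = ℕP.m⊔n≤o⇒n≤o (K ⊔ L) (M ⊔ N) p
        q₁ = ℕP.m⊔n≤o⇒m≤o (K ⊔ L) (M ⊔ N) q
        q₂ = ℕP.m⊔n≤o⇒n≤o (K ⊔ L) (M ⊔ N) q
        δ≥0 = ℚP.<⇒≤ δ>0
    in
    subst₂ ℚ._≤_ (cong ℚ.∣_∣ (sym (regroup-* (x m) (y m) (x n) (y n))))
      (trans (sym (ℚP.*-distribˡ-+ δ B A)) eq)
      (ℚP.≤-trans
        (ℚP.∣p+q∣≤∣p∣+∣q∣ ((x m ℚ.- x n) ℚ.* y m) ((y m ℚ.- y n) ℚ.* x n))
        (ℚP.+-mono-≤
          (*-mono-∣∣ (x m ℚ.- x n) (y m) δ≥0
            (hx m n (ℕP.m⊔n≤o⇒m≤o M N p₂) (ℕP.m⊔n≤o⇒m≤o M N q₂))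
            (yB m (ℕP.m⊔n≤o⇒n≤o K L p₁)))
          (*-mono-∣∣ (y m ℚ.- y n) (x n) δ≥0
            (hy m n (ℕP.m⊔n≤o⇒n≤o M N p₂) (ℕP.m⊔n≤o⇒n≤o M N q₂))
            (xA n (ℕP.m⊔n≤o⇒m≤o K L q₁)))))

infixl 6 _+_
infixl 7 _*_

_+_ : ℝ → ℝ → ℝ
seq    (x + y) n = seq x n ℚ.+ seq y n
cauchy (x + y)   = +-cauchy {seq x} {seq y} (cauchy x) (cauchy y)

_*_ : ℝ → ℝ → ℝ
seq    (x * y) n = seq x n ℚ.* seq y n
cauchy (x * y)   = *-cauchy {seq x} {seq y} (cauchy x) (cauchy y)

sum : ∀ {n} → Vector ℝ n → ℝ
sum = foldr _+_ 0ℝ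

IsMin : Pred ℝ 0ℓ → ℝ → Set
IsMin A m = m ∈ A × (∀ t → t ∈ A → m ≤ t)

UpperBound : Pred ℝ 0ℓ → ℝ → Set
UpperBound A u = ∀ t → t ∈ A → t ≤ u

IsSup : Pred ℝ 0ℓ → ℝ → Set
IsSup A σ = UpperBound A σ × (∀ u → UpperBound A u → σ ≤ u)

Point : ℕ → Set
Point d = Vector ℝ d

-- Elements of the dual lattice (ℤᵈ)*, in coordinates.
Covector : ℕ → Set
Covector d = Vector ℤ d

⟨_,_⟩ : ∀ {d} → Covector d → Point d → ℝ
⟨ a , x ⟩ = sum (λ j → fromℤ (a j) * x j)

Nonzero : ∀ {d} → Covector d → Set
Nonzero a = ¬ (∀ j → a j ≡ 0ℤ)

conv : ∀ {d n} → Vector (Point d) n → Pred (Point d) 0ℓ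
conv {d} {n} v x = Σ[ w ∈ Vector ℝ n ]
  ((∀ i → 0ℝ ≤ w i) × sum w ≃ 1ℝ × (∀ j → x j ≃ sum (λ i → w i * v i j)))

AffinelyIndependent : ∀ {d n} → Vector (Point d) n → Set
AffinelyIndependent {d} {n} p = ∀ (c : Vector ℝ n) →
  sum c ≃ 0ℝ → (∀ j → sum (λ i → c i * p i j) ≃ 0ℝ) → ∀ i → c i ≃ 0ℝ

FullDimensional : ∀ {d} → Pred (Point d) 0ℓ → Set
FullDimensional {d} P = Σ[ p ∈ Vector (Point d) (suc d) ]
  ((∀ i → p i ∈ P) × AffinelyIndependent p)

-- A lattice polytope is given by finitely many lattice points whose convex
-- hull it is; the list may be redundant, so its entries include the vertices
-- but need not all be vertices.
record LatticePolytope (d : ℕ) : Set where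
  field
    size       : ℕ
    generators : Vector (Vector ℤ d) size

  points : Pred (Point d) 0ℓ
  points = conv (λ i j → fromℤ (generators i j))

  field
    fullDimensional : FullDimensional points

open LatticePolytope public using (points)

-- h ≃ h_P(a)
IsSupportValue : ∀ {d} → Pred (Point d) 0ℓ → Covector d → ℝ → Set
IsSupportValue P a = IsMin (λ t → ∃[ x ] (x ∈ P × t ≃ ⟨ a , x ⟩))

FineAdjoint : ∀ {d} → Pred (Point d) 0ℓ → ℝ → Pred (Point d) 0ℓ
FineAdjoint P s x = ∀ a → Nonzero a →
  ∃[ h ] (IsSupportValue P a h × h + s ≤ ⟨ a , x ⟩)

-- μ ≃ μ^F(P): μ is inverse to the supremum.
IsFineCodegree : ∀ {d} → Pred (Point d) 0ℓ → ℝ → Set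
IsFineCodegree P μ = ∃[ σ ]
  (IsSup (λ s → 0ℝ < s × ∃[ x ] (x ∈ FineAdjoint P s)) σ × μ * σ ≃ 1ℝ)

FineSpectrum : ℕ → Pred ℝ 0ℓ
FineSpectrum d μ = Σ[ P ∈ LatticePolytope d ] IsFineCodegree (points P) μ

record ℕ⁺ : Set where
  constructor mkℕ⁺
  field
    value         : ℕ
    .{{nonZero}}  : NonZero value

_/[_·_] : ℕ → ℕ⁺ → ℕ⁺ → ℝ
q /[ mkℕ⁺ k · mkℕ⁺ ℓ ] =
  fromℚ (ℚ._/_ (+ q) (k ℕ.* ℓ) {{ℕP.m*n≢0 k ℓ}})

numerators : List ℕ
numerators = 2 ∷ 3 ∷ 4 ∷ 5 ∷ 7 ∷ 11 ∷ 13 ∷ 17 ∷ 19 ∷ []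

{-# OPTIONS --safe #-}

-- Let h a be the minimum of the covector a on P, and σ the supremum of the s
-- with nonempty adjoint. By linear programming duality σ is the least value
-- - Σ wᵢ h(aᵢ) / Σ wᵢ of balanced weights (wᵢ ≥ 0, Σ wᵢ aᵢ = 0) on nonzero
-- covectors. Only finitely many covectors matter (Dickson's lemma in each normal
-- cone), and four of them suffice (Carathéodory).
--
-- Let n = Σ wᵢ. If the residues m of some multiple κ w modulo n again have total
-- n, then b = Σ mᵢ aᵢ / n is integral, and exchanging some aᵢ for b lowers the
-- total without raising the value, as h is superadditive. If no κ ≠ 1 does this,
-- then Σ ⌊κ wᵢ / n⌋ = κ - 2 for 2 ≤ κ ≤ n - 2: a finite search tree shows that
-- this fails for n ≥ 20, and the totals left below 20 are the numerators.
--
-- All of this is classical and is carried out under double negation. As σ is then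
-- not unlike a fraction with one of finitely many denominators, the fraction can
-- be read off from a sufficiently close approximation.
--
-- Dilating P by k multiplies σ by k, so S q may consist of all ℓ such that every
-- q / (k ℓ) is in the spectrum; the simplex below has σ = 1 and puts q in S q.
module Submission where

open import Defs
open import Algebra.Bundles using (module CommutativeRing)
import Algebra.Properties.CommutativeMonoid.Sum as MonoidSum
import Algebra.Properties.Semiring.Sum as SemiringSum
open import Data.Bool using (Bool; true; false; _∧_; _∨_; T)
open import Data.Bool.Properties using (T-∧; T-∨)
open import Data.Fin as Fin using (Fin; zero; suc; punchIn)
open import Data.Fin.Patterns
open import Data.Fin.Properties as FinP using (punchInᵢ≢i)
open import Data.Integer as ℤ using (ℤ; +_; 0ℤ; 1ℤ)
import Data.Integer.Properties as ℤP
open import Data.Integer.Tactic.RingSolver using () renaming (solve-∀ to solve-ℤ)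
open import Data.List as List using (List; []; _∷_; cartesianProductWith)
open import Data.List.Membership.Propositional using (find) renaming (_∈_ to _∈ₗ_)
open import Data.List.Membership.Propositional.Properties
  using (∈-++⁺ˡ; ∈-++⁺ʳ; ∈-map⁺; ∈-concat⁺′; ∈-tabulate⁺; ∈-cartesianProductWith⁺)
open import Data.List.Relation.Unary.All as All using (All; []; _∷_)
open import Data.List.Relation.Unary.Any as Any using (Any; here; there)
open import Data.List.Relation.Unary.Any.Properties using (lookup-index)
open import Data.Nat as ℕ using (ℕ; zero; suc; NonZero; z≤n; s≤s; _∸_; _⊔′_; _⊓′_; _≡ᵇ_; _≤ᵇ_)
open import Data.List.Membership.DecPropositional ℕ._≟_ using (_∈?_)
open import Data.Nat.Divisibility
  using (_∣_; divides; ∣⇒≤; _∣?_; ∣-trans; m%n≡0⇒n∣m; 0∣⇒≡0)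
open import Data.Nat.DivMod using (_/_; _%_; m≡m%n+[m/n]*n; m%n<n; m/n*n≤m; /-monoˡ-≤)
open import Data.Nat.GCD using (gcd; gcd[m,n]∣m; gcd[m,n]∣n; gcd-greatest; c*gcd[m,n]≡gcd[cm,cn])
import Data.Nat.Induction as ℕI
open import Data.Nat.ListAction using (product)
open import Data.Nat.ListAction.Properties using (∈⇒∣product)
import Data.Nat.Properties as ℕP
open import Data.Nat.Tactic.RingSolver using () renaming (solve-∀ to solve-ℕ)
open import Data.Product using (Σ-syntax; ∃-syntax; _×_; _,_; proj₁; proj₂)
open import Data.Rational as ℚ using (ℚ; 0ℚ; 1ℚ; ½)
import Data.Rational.Properties as ℚP
import Data.Rational.Unnormalised as ℚᵘ
import Data.Rational.Unnormalised.Properties as ℚᵘP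
open import Data.Sum using (_⊎_; inj₁; inj₂; [_,_]′)
open import Data.Unit using (tt)
open import Data.Vec as Vec using (Vec; []; _∷_; replicate)
open import Data.Vec.Functional using (Vector; removeAt; insertAt; updateAt; tail) renaming (_∷_ to _∷ᵛ_)
open import Data.Vec.Functional.Properties
  using (insertAt-lookup; insertAt-punchIn; updateAt-updates; updateAt-minimal)
import Data.Vec.Properties as VecP
open import Function using (_∘_; const; flip; Equivalence)
open import Induction.WellFounded using (Acc; acc)
open import Level using (0ℓ)
open import Relation.Binary.Bundles using (Preorder)
open import Relation.Binary.Definitions using (Total; Transitive; tri<; tri≈; tri>)
open import Relation.Binary.PropositionalEquality
open import Relation.Nullary using (¬_; Dec; yes; no; contradiction; ⌊_⌋; toWitness; ¬?; _×-dec_)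
open import Relation.Nullary.Decidable using (decidable-stable; dec⇒maybe)
open import Relation.Unary using (Pred; _∈_; _≐_; Satisfiable)
open import Tactic.RingSolver using (solve-∀)
import Relation.Binary.Reasoning.Preorder as PreorderReasoning
import Tactic.RingSolver.Core.AlmostCommutativeRing as ACR

-- Weights and their reductions

-- The totals of balanced weights, hence the denominators of their values, are unbounded, so it is
-- not clear beforehand that a least value exists. The proof therefore never minimizes directly. For
-- a threshold T / Q it obtains either a point of the adjoint or weights of value below T / Q (a
-- `Cert`), and the reduction keeps the value below the threshold while the total shrinks. So every
-- certificate leads to one whose total divides a fixed M and whose value is a multiple of 1 / M.
-- Among these values there is a least one, and duality at exactly this threshold identifies it with
-- σ.
--
-- The numerators have a geometric origin. They are the totals of (1,1,0,0), (1,1,1,0), (1,1,1,1),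
-- (1,1,1,2), (1,1,2,3), (1,2,3,5), (1,3,4,5), (2,3,5,7) and (3,4,5,7), none of which can be split
-- or divided; the last seven are the weights of the weighted projective 3-spaces with terminal
-- singularities.

Weights : Set
Weights = Fin 4 → ℕ

total : Weights → ℕ
total l = l 0F ℕ.+ l 1F ℕ.+ l 2F ℕ.+ l 3F

weights : ℕ → ℕ → ℕ → ℕ → Weights
weights a b c d 0F = a
weights a b c d 1F = b
weights a b c d 2F = c
weights a b c d 3F = d

∀⁴ : {P : Fin 4 → Set} → P 0F → P 1F → P 2F → P 3F → ∀ i → P i
∀⁴ p q r s 0F = p
∀⁴ p q r s 1F = q
∀⁴ p q r s 2F = r
∀⁴ p q r s 3F = s

-- In terms of a relation Σ lᵢ aᵢ = 0, the vector b = - Σ fᵢ aᵢ is then the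
-- convex combination of the aᵢ with weights mᵢ / h.
record Split (h : ℕ) (l : Weights) : Set where
  field
    κ         : ℤ
    f         : Fin 4 → ℤ
    m         : Weights
    m≡κl-fh   : ∀ i → + m i ≡ κ ℤ.* + l i ℤ.- f i ℤ.* + h
    total-m   : total m ≡ h
    m<h       : ∀ i → m i ℕ.< h
    m≢l       : ∃[ i ] m i ≢ l i
    supported : ∀ i → l i ≡ 0 → m i ≡ 0

CommonDivisor : Weights → Set
CommonDivisor l = ∃[ g ] (2 ℕ.≤ g × (∀ i → g ∣ l i))

residue : (h : ℕ) .{{_ : NonZero h}} → ℕ → Weights → Weights
residue h κ l i = (κ ℕ.* l i) % h

residue-spec : ∀ h .{{_ : NonZero h}} κ l i →
  + residue h κ l i ≡ + κ ℤ.* + l i ℤ.- + ((κ ℕ.* l i) / h) ℤ.* + h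
residue-spec h κ l i = begin
  + m ≡⟨ lemma (+ m) (+ f) (+ h) ⟩
  (+ m ℤ.+ + f ℤ.* + h) ℤ.- + f ℤ.* + h ≡⟨ cong (ℤ._- + f ℤ.* + h) (begin
    + m ℤ.+ + f ℤ.* + h ≡⟨ cong (λ z → + m ℤ.+ z) (ℤP.pos-* f h) ⟨
    + (m ℕ.+ f ℕ.* h) ≡⟨ cong +_ (m≡m%n+[m/n]*n (κ ℕ.* l i) h) ⟨
    + (κ ℕ.* l i) ≡⟨ ℤP.pos-* κ (l i) ⟩
    + κ ℤ.* + l i ∎) ⟩
  + κ ℤ.* + l i ℤ.- + f ℤ.* + h ∎
  where
  open ≡-Reasoning
  m = residue h κ l i
  f = (κ ℕ.* l i) / h
  lemma : ∀ m f h → m ≡ (m ℤ.+ f ℤ.* h) ℤ.- f ℤ.* h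
  lemma = solve-ℤ

residue-supported : ∀ h .{{_ : NonZero h}} κ l i → l i ≡ 0 → residue h κ l i ≡ 0
residue-supported (suc h) κ l i l≡0 rewrite l≡0 | ℕP.*-zeroʳ κ = refl

residue-split : ∀ h .{{_ : NonZero h}} κ l → total (residue h κ l) ≡ h →
  (∃[ i ] residue h κ l i ≢ l i) → Split h l
residue-split h κ l eq ne = record
  { κ = + κ ; f = λ i → + ((κ ℕ.* l i) / h) ; m = residue h κ l
  ; m≡κl-fh = residue-spec h κ l ; total-m = eq
  ; m<h = λ i → m%n<n (κ ℕ.* l i) h ; m≢l = ne
  ; supported = residue-supported h κ l }

resp-split : ∀ {h l l′} → l ≗ l′ → Split h l → Split h l′
resp-split {h} e s = record
  { κ = κ ; f = f ; m = m
  ; m≡κl-fh = λ i → subst (λ x → + m i ≡ κ ℤ.* + x ℤ.- f i ℤ.* + h) (e i) (m≡κl-fh i)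
  ; total-m = total-m ; m<h = m<h
  ; m≢l = proj₁ m≢l , λ q → proj₂ m≢l (trans q (sym (e _)))
  ; supported = λ i z → supported i (trans (e i) z) }
  where open Split s

resp-commonDivisor : ∀ {l l′} → l ≗ l′ → CommonDivisor l → CommonDivisor l′
resp-commonDivisor e (g , 2≤g , d) = g , 2≤g , λ i → subst (g ∣_) (e i) (d i)

-- Exhaustive search over the totals below 20

module Small where

  anyBelow allBelow : (ℕ → Bool) → ℕ → Bool
  anyBelow p zero    = false
  anyBelow p (suc n) = p n ∨ anyBelow p n
  allBelow p zero    = true
  allBelow p (suc n) = p n ∧ allBelow p n

  anyBelow-sound : ∀ p n → T (anyBelow p n) → ∃[ k ] T (p k)
  anyBelow-sound p (suc n) =
    [ (n ,_) , anyBelow-sound p n ]′ ∘ Equivalence.to T-∨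

  allBelow-sound : ∀ p n → T (allBelow p n) → ∀ k → k ℕ.< n → T (p k)
  allBelow-sound p (suc n) t k k<1+n with Equivalence.to T-∧ t | k ℕ.≟ n
  ... | pn , _ | yes refl = pn
  ... | _ , ps | no k≢n   = allBelow-sound p n ps k (ℕP.≤∧≢⇒< (ℕP.≤-pred k<1+n) k≢n)

  isNumerator : ℕ → Bool
  isNumerator h-1 = ⌊ suc h-1 ∈? 1 ∷ numerators ⌋

  divides? : Weights → ℕ → Bool
  divides? l g-2 = ⌊ FinP.all? (λ i → 2 ℕ.+ g-2 ∣? l i) ⌋

  splits? : ℕ → Weights → ℕ → Bool
  splits? h-1 l κ = (total (residue (suc h-1) κ l) ≡ᵇ suc h-1) ∧
    ⌊ FinP.any? (λ i → ¬? (residue (suc h-1) κ l i ℕ.≟ l i)) ⌋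

  -- One bound serves both searches. With n = 20 and totals of at most 19, every residue class of κ
  -- is tried, so negative multiples need no separate test.
  isReducible : ℕ → ℕ → Weights → Bool
  isReducible n h-1 l = anyBelow (splits? h-1 l) n ∨ anyBelow (divides? l) n

  isReducible-sound : ∀ n h-1 l → T (isReducible n h-1 l) → CommonDivisor l ⊎ Split (suc h-1) l
  isReducible-sound n h-1 l = [ inj₂ ∘ split ∘ anyBelow-sound (splits? h-1 l) n
                              , inj₁ ∘ multiple ∘ anyBelow-sound (divides? l) n ]′
                            ∘ Equivalence.to (T-∨ {anyBelow (splits? h-1 l) n})
    where
    multiple : ∃[ g-2 ] T (divides? l g-2) → CommonDivisor l
    multiple (g-2 , d) = 2 ℕ.+ g-2 , s≤s (s≤s z≤n) , toWitness d
    split : ∃[ κ ] T (splits? h-1 l κ) → Split (suc h-1) l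
    split (κ , d) with Equivalence.to (T-∧ {total (residue (suc h-1) κ l) ≡ᵇ suc h-1}) d
    ... | e , ne = residue-split (suc h-1) κ l (ℕP.≡ᵇ⇒≡ _ _ e) (toWitness ne)

  remainder : ℕ → ℕ → ℕ → ℕ → Weights
  remainder h a b c = weights a b c (h ∸ a ∸ b ∸ c)

  -- Three weights are enumerated and the total determines the fourth. `m` will be 2, which makes
  -- `m + h-1` one more than the total h: the number of candidates 0, ..., h.
  check₃ check₂ : ℕ → ℕ → ℕ → ℕ → ℕ → Bool
  check₃ n h-1 a b c = isReducible n h-1 (remainder (suc h-1) a b c)
  check₂ n m h-1 a b = allBelow (check₃ n h-1 a b) (m ℕ.+ h-1 ∸ a ∸ b)

  check₁ : ℕ → ℕ → ℕ → ℕ → Bool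
  check₁ n m h-1 a = allBelow (check₂ n m h-1 a) (m ℕ.+ h-1 ∸ a)

  check : ℕ → ℕ → ℕ → Bool
  check n m h-1 = isNumerator h-1 ∨ allBelow (check₁ n m h-1) (m ℕ.+ h-1)

  checked : T (allBelow (check 20 2) 19)
  checked = tt

  sum-bounds : ∀ {a b c d h} → a ℕ.+ b ℕ.+ c ℕ.+ d ≡ h →
    a ℕ.< suc h × b ℕ.< suc h ∸ a × c ℕ.< suc h ∸ a ∸ b × h ∸ a ∸ b ∸ c ≡ d
  sum-bounds {a} {b} {c} {d} refl =
      s≤s (ℕP.≤-trans (ℕP.m≤m+n a b) (ℕP.≤-trans (ℕP.m≤m+n (a ℕ.+ b) c) (ℕP.m≤m+n _ d)))
    , subst (b ℕ.<_) (sym e₁) (s≤s (ℕP.≤-trans (ℕP.m≤m+n b c) (ℕP.m≤m+n _ d)))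
    , subst (c ℕ.<_) (sym (trans (cong (_∸ b) e₁) e₂)) (s≤s (ℕP.m≤m+n c d))
    , e₃
    where
    open ≡-Reasoning
    s₁ : ∀ a b c d → suc (a ℕ.+ b ℕ.+ c ℕ.+ d) ≡ suc (b ℕ.+ c ℕ.+ d) ℕ.+ a
    s₁ = solve-ℕ
    s₂ : ∀ b c d → suc (b ℕ.+ c ℕ.+ d) ≡ suc (c ℕ.+ d) ℕ.+ b
    s₂ = solve-ℕ
    s₃ : ∀ a b c d → a ℕ.+ b ℕ.+ c ℕ.+ d ≡ d ℕ.+ c ℕ.+ b ℕ.+ a
    s₃ = solve-ℕ
    e₁ : suc (a ℕ.+ b ℕ.+ c ℕ.+ d) ∸ a ≡ suc (b ℕ.+ c ℕ.+ d)
    e₁ = trans (cong (_∸ a) (s₁ a b c d)) (ℕP.m+n∸n≡m _ a)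
    e₂ : suc (b ℕ.+ c ℕ.+ d) ∸ b ≡ suc (c ℕ.+ d)
    e₂ = trans (cong (_∸ b) (s₂ b c d)) (ℕP.m+n∸n≡m _ b)
    e₃ : (a ℕ.+ b ℕ.+ c ℕ.+ d) ∸ a ∸ b ∸ c ≡ d
    e₃ = begin
      (a ℕ.+ b ℕ.+ c ℕ.+ d) ∸ a ∸ b ∸ c ≡⟨ cong (λ x → x ∸ a ∸ b ∸ c) (s₃ a b c d) ⟩
      (d ℕ.+ c ℕ.+ b ℕ.+ a) ∸ a ∸ b ∸ c ≡⟨ cong (λ x → x ∸ b ∸ c) (ℕP.m+n∸n≡m (d ℕ.+ c ℕ.+ b) a) ⟩
      (d ℕ.+ c ℕ.+ b) ∸ b ∸ c ≡⟨ cong (_∸ c) (ℕP.m+n∸n≡m (d ℕ.+ c) b) ⟩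
      (d ℕ.+ c) ∸ c ≡⟨ ℕP.m+n∸n≡m d c ⟩
      d ∎

  check-sound : ∀ n h-1 l → T (check n 2 h-1) → total l ≡ suc h-1 →
    suc h-1 ∈ₗ 1 ∷ numerators ⊎ CommonDivisor l ⊎ Split (suc h-1) l
  check-sound n h-1 l t eq with Equivalence.to (T-∨ {isNumerator h-1}) t
  ... | inj₁ num = inj₁ (toWitness num)
  ... | inj₂ all = inj₂
    ([ inj₁ ∘ resp-commonDivisor same , inj₂ ∘ resp-split same ]′
      (isReducible-sound n h-1 _
        (allBelow-sound (check₃ n h-1 (l 0F) (l 1F)) _
        (allBelow-sound (check₂ n 2 h-1 (l 0F)) _
          (allBelow-sound (check₁ n 2 h-1) _ all (l 0F) a<) (l 1F) b<) (l 2F) c<)))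
    where
    bounds = sum-bounds {l 0F} {l 1F} {l 2F} {l 3F} eq
    a< = proj₁ bounds
    b< = proj₁ (proj₂ bounds)
    c< = proj₁ (proj₂ (proj₂ bounds))
    same : remainder (suc h-1) (l 0F) (l 1F) (l 2F) ≗ l
    same = ∀⁴ refl refl refl (proj₂ (proj₂ (proj₂ bounds)))

private
  distribʳ₄ : ∀ h a b c d → (a ℕ.+ b ℕ.+ c ℕ.+ d) ℕ.* h ≡ a ℕ.* h ℕ.+ b ℕ.* h ℕ.+ c ℕ.* h ℕ.+ d ℕ.* h
  distribʳ₄ = solve-ℕ

  distribˡ₄ : ∀ h a b c d → h ℕ.* (a ℕ.+ b ℕ.+ c ℕ.+ d) ≡ h ℕ.* a ℕ.+ h ℕ.* b ℕ.+ h ℕ.* c ℕ.+ h ℕ.* d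
  distribˡ₄ = solve-ℕ

  interchange₄ : ∀ a b c d a′ b′ c′ d′ →
    (a ℕ.+ a′) ℕ.+ (b ℕ.+ b′) ℕ.+ (c ℕ.+ c′) ℕ.+ (d ℕ.+ d′) ≡
    (a ℕ.+ b ℕ.+ c ℕ.+ d) ℕ.+ (a′ ℕ.+ b′ ℕ.+ c′ ℕ.+ d′)
  interchange₄ = solve-ℕ

  total-cong : ∀ {f g : Weights} → f ≗ g → total f ≡ total g
  total-cong e = cong₂ ℕ._+_ (cong₂ ℕ._+_ (cong₂ ℕ._+_ (e 0F) (e 1F)) (e 2F)) (e 3F)

data OneUp (f f′ : Weights) : Set where
  one-up : ∀ j → f′ j ≡ suc (f j) → (∀ i → i ≢ j → f′ i ≡ f i) → OneUp f f′

-- The increments are natural numbers of sum 1. If the floors of κ l / h sum to κ - 2 for two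
-- consecutive κ, exactly one of them rises, which is why the search tree branches fourfold.
oneUp : ∀ {f f′} → (∀ i → f i ℕ.≤ f′ i) → total f′ ≡ suc (total f) → OneUp f f′
oneUp {f} {f′} f≤f′ eq = unit (e 0F) (e 1F) (e 2F) (e 3F) refl refl refl refl sum-e
  where
  e : Weights
  e i = f′ i ∸ f i
  f+e : ∀ i → f i ℕ.+ e i ≡ f′ i
  f+e i = ℕP.m+[n∸m]≡n (f≤f′ i)
  sum-e : total e ≡ 1
  sum-e = ℕP.+-cancelˡ-≡ (total f) _ _
    (trans (sym (interchange₄ (f 0F) (f 1F) (f 2F) (f 3F) (e 0F) (e 1F) (e 2F) (e 3F)))
    (trans (cong₂ ℕ._+_ (cong₂ ℕ._+_ (cong₂ ℕ._+_ (f+e 0F) (f+e 1F)) (f+e 2F)) (f+e 3F))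
      (trans eq (sym (ℕP.+-comm (total f) 1)))))
  stays : ∀ i → e i ≡ 0 → f′ i ≡ f i
  stays i z = trans (sym (f+e i)) (trans (cong (f i ℕ.+_) z) (ℕP.+-identityʳ _))
  rises : ∀ i → e i ≡ 1 → f′ i ≡ suc (f i)
  rises i z = trans (sym (f+e i)) (trans (cong (f i ℕ.+_) z) (ℕP.+-comm _ 1))
  unit : ∀ a b c d → e 0F ≡ a → e 1F ≡ b → e 2F ≡ c → e 3F ≡ d → a ℕ.+ b ℕ.+ c ℕ.+ d ≡ 1 → OneUp f f′
  unit 1 0 0 0 p q r s _ = one-up 0F (rises 0F p)
    (∀⁴ (λ n → contradiction refl n) (λ _ → stays 1F q) (λ _ → stays 2F r) (λ _ → stays 3F s))
  unit 0 1 0 0 p q r s _ = one-up 1F (rises 1F q)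
    (∀⁴ (λ _ → stays 0F p) (λ n → contradiction refl n) (λ _ → stays 2F r) (λ _ → stays 3F s))
  unit 0 0 1 0 p q r s _ = one-up 2F (rises 2F r)
    (∀⁴ (λ _ → stays 0F p) (λ _ → stays 1F q) (λ n → contradiction refl n) (λ _ → stays 3F s))
  unit 0 0 0 1 p q r s _ = one-up 3F (rises 3F s)
    (∀⁴ (λ _ → stays 0F p) (λ _ → stays 1F q) (λ _ → stays 2F r) (λ n → contradiction refl n))
  unit 0 0 0 0 _ _ _ _ ()
  unit 0 0 0 (suc (suc _)) _ _ _ _ ()
  unit 0 0 1 (suc _) _ _ _ _ ()
  unit 0 0 (suc (suc _)) _ _ _ _ _ ()
  unit 0 1 0 (suc _) _ _ _ _ ()
  unit 0 1 (suc _) _ _ _ _ _ ()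
  unit 0 (suc (suc _)) _ _ _ _ _ _ ()
  unit 1 0 0 (suc _) _ _ _ _ ()
  unit 1 0 (suc _) _ _ _ _ _ ()
  unit 1 (suc _) _ _ _ _ _ _ ()
  unit (suc (suc _)) _ _ _ _ _ _ _ ()

-- Refutation tree for the floor sums

module Tree (L : ℕ) {{_ : NonZero L}} where

  -- quot is the current ⌊ κ x / h ⌋; x / h lies between lower / L and upper / L.
  record Slot : Set where
    constructor slot
    field quot lower upper : ℕ
  open Slot public

  -- ⌊κ x / h⌋ = m means m / κ ≤ x / h < (m + 1) / κ, and u = L / κ turns both ends into integers
  -- over L. The primed maximum and minimum compare by built-in arithmetic, whereas the plain ones
  -- recurse on unary numbers, which is hopeless for bounds in the millions.
  narrow : ℕ → ℕ → Slot → Slot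
  narrow u m (slot _ lo hi) = slot m (lo ⊔′ (m ℕ.* u)) (hi ⊓′ (suc m ℕ.* u))

  stay up : ℕ → Slot → Slot
  stay u s = narrow u (quot s) s
  up u s = narrow u (suc (quot s)) s

  -- The last two tests rest on the four x / h having sum 1: the upper ends are strict and must add
  -- up to more than L, the lower ends to at most L.
  dead : (s₀ s₁ s₂ s₃ : Slot) → Bool
  dead s₀ s₁ s₂ s₃ =
      (upper s₀ ≤ᵇ lower s₀) ∨ (upper s₁ ≤ᵇ lower s₁) ∨ (upper s₂ ≤ᵇ lower s₂) ∨ (upper s₃ ≤ᵇ lower s₃)
    ∨ (upper s₀ ℕ.+ upper s₁ ℕ.+ upper s₂ ℕ.+ upper s₃ ≤ᵇ L)
    ∨ (suc L ≤ᵇ lower s₀ ℕ.+ lower s₁ ℕ.+ lower s₂ ℕ.+ lower s₃)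

  -- The four branches are the four choices of the floor that rises from κ to κ + 1. The test on
  -- `u * suc κ` lets the evaluation itself confirm that κ + 1 divides L.
  refute : ℕ → ℕ → (s₀ s₁ s₂ s₃ : Slot) → Bool
  refute zero κ s₀ s₁ s₂ s₃ = dead s₀ s₁ s₂ s₃
  refute (suc n) κ s₀ s₁ s₂ s₃ =
    dead s₀ s₁ s₂ s₃ ∨ ((u ℕ.* suc κ ≡ᵇ L)
      ∧ refute n (suc κ) (up u s₀) (stay u s₁) (stay u s₂) (stay u s₃)
      ∧ refute n (suc κ) (stay u s₀) (up u s₁) (stay u s₂) (stay u s₃)
      ∧ refute n (suc κ) (stay u s₀) (stay u s₁) (up u s₂) (stay u s₃)
      ∧ refute n (suc κ) (stay u s₀) (stay u s₁) (stay u s₂) (up u s₃))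
    where u = L / suc κ

  -- At κ = 2 the floors sum to 0, so all of them vanish and each x / h is below 1 / 2.
  start : Slot
  start = slot 0 0 (L / 2)

  module _ (h : ℕ) .{{_ : NonZero h}} where

    record Valid (κ x : ℕ) (s : Slot) : Set where
      field
        quot≡ : quot s ≡ (κ ℕ.* x) / h
        lower≤ : lower s ℕ.* h ℕ.≤ L ℕ.* x
        <upper : L ℕ.* x ℕ.< upper s ℕ.* h
    open Valid

    /-upper : ∀ n → n ℕ.< suc (n / h) ℕ.* h
    /-upper n = begin-strict
      n ≡⟨ m≡m%n+[m/n]*n n h ⟩
      n % h ℕ.+ (n / h) ℕ.* h <⟨ ℕP.+-monoˡ-< _ (m%n<n n h) ⟩
      suc (n / h) ℕ.* h ∎
      where open ℕP.≤-Reasoning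

    narrow-valid : ∀ {κ x u m s} → u ℕ.* suc κ ≡ L → m ≡ (suc κ ℕ.* x) / h →
      Valid κ x s → Valid (suc κ) x (narrow u m s)
    narrow-valid {κ} {x} {u} {m} {slot q lo hi} u*κ≡L m≡ v = record
      { quot≡ = m≡
      ; lower≤ = subst (λ z → z ℕ.* h ℕ.≤ L ℕ.* x) (ℕP.⊔≡⊔′ lo (m ℕ.* u)) lower′
      ; <upper = subst (λ z → L ℕ.* x ℕ.< z ℕ.* h) (ℕP.⊓≡⊓′ hi (suc m ℕ.* u)) upper′ }
      where
      open ℕP.≤-Reasoning
      comm : ∀ u κ x → u ℕ.* (κ ℕ.* x) ≡ (u ℕ.* κ) ℕ.* x
      comm = solve-ℕ
      comm′ : ∀ m u h → m ℕ.* u ℕ.* h ≡ u ℕ.* (m ℕ.* h)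
      comm′ = solve-ℕ
      scaled : u ℕ.* (suc κ ℕ.* x) ≡ L ℕ.* x
      scaled = trans (comm u (suc κ) x) (cong (ℕ._* x) u*κ≡L)
      lower″ : m ℕ.* u ℕ.* h ℕ.≤ L ℕ.* x
      lower″ = begin
        m ℕ.* u ℕ.* h ≡⟨ comm′ m u h ⟩
        u ℕ.* (m ℕ.* h) ≤⟨ ℕP.*-monoʳ-≤ u (subst (λ z → z ℕ.* h ℕ.≤ suc κ ℕ.* x) (sym m≡) (m/n*n≤m (suc κ ℕ.* x) h))
          ⟩
        u ℕ.* (suc κ ℕ.* x) ≡⟨ scaled ⟩
        L ℕ.* x ∎
      lower′ : (lo ℕ.⊔ m ℕ.* u) ℕ.* h ℕ.≤ L ℕ.* x
      lower′ = subst (ℕ._≤ L ℕ.* x) (sym (ℕP.*-distribʳ-⊔ h lo (m ℕ.* u))) (ℕP.⊔-lub (lower≤ v) lower″)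
      instance
        u≢0 : NonZero u
        u≢0 = ℕ.≢-nonZero (λ { refl → ℕ.≢-nonZero⁻¹ L (sym u*κ≡L) })
      upper″ : L ℕ.* x ℕ.< suc m ℕ.* u ℕ.* h
      upper″ = begin-strict
        L ℕ.* x ≡⟨ scaled ⟨
        u ℕ.* (suc κ ℕ.* x) <⟨ ℕP.*-monoʳ-< u
          (subst (λ z → suc κ ℕ.* x ℕ.< suc z ℕ.* h) (sym m≡) (/-upper (suc κ ℕ.* x))) ⟩
        u ℕ.* (suc m ℕ.* h) ≡⟨ comm′ (suc m) u h ⟨
        suc m ℕ.* u ℕ.* h ∎
      upper′ : L ℕ.* x ℕ.< (hi ℕ.⊓ (suc m ℕ.* u)) ℕ.* h
      upper′ = subst (L ℕ.* x ℕ.<_) (sym (ℕP.*-distribʳ-⊓ h hi (suc m ℕ.* u))) (ℕP.⊓-glb (<upper v) upper″)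

    slot-alive : ∀ {κ x s} → Valid κ x s → ¬ T (upper s ≤ᵇ lower s)
    slot-alive {s = s} v t = ℕP.<-irrefl refl (ℕP.<-≤-trans (<upper v)
      (ℕP.≤-trans (ℕP.*-monoˡ-≤ h (ℕP.≤ᵇ⇒≤ (upper s) (lower s) t)) (lower≤ v)))

    alive : ∀ {κ l s₀ s₁ s₂ s₃} → total l ≡ h →
      Valid κ (l 0F) s₀ → Valid κ (l 1F) s₁ → Valid κ (l 2F) s₂ → Valid κ (l 3F) s₃ →
      ¬ T (dead s₀ s₁ s₂ s₃)
    alive {κ} {l} {s₀} {s₁} {s₂} {s₃} eq v₀ v₁ v₂ v₃ =
      neither (slot-alive v₀) (neither (slot-alive v₁) (neither (slot-alive v₂) (neither (slot-alive v₃)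
        (neither uppers lowers))))
      where
      open ℕP.≤-Reasoning
      neither : ∀ {x y} → ¬ T x → ¬ T y → ¬ T (x ∨ y)
      neither p q = [ p , q ]′ ∘ Equivalence.to T-∨
      Lh : L ℕ.* h ≡ L ℕ.* l 0F ℕ.+ L ℕ.* l 1F ℕ.+ L ℕ.* l 2F ℕ.+ L ℕ.* l 3F
      Lh = trans (cong (L ℕ.*_) (sym eq)) (distribˡ₄ L (l 0F) (l 1F) (l 2F) (l 3F))
      U = upper s₀ ℕ.+ upper s₁ ℕ.+ upper s₂ ℕ.+ upper s₃
      W = lower s₀ ℕ.+ lower s₁ ℕ.+ lower s₂ ℕ.+ lower s₃
      uppers : ¬ T (U ≤ᵇ L)
      uppers t = ℕP.<-irrefl refl (begin-strict
        L ℕ.* h ≡⟨ Lh ⟩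
        _ <⟨ ℕP.+-mono-< (ℕP.+-mono-< (ℕP.+-mono-< (<upper v₀) (<upper v₁)) (<upper v₂)) (<upper v₃) ⟩
        _ ≡⟨ distribʳ₄ h (upper s₀) (upper s₁) (upper s₂) (upper s₃) ⟨
        U ℕ.* h ≤⟨ ℕP.*-monoˡ-≤ h (ℕP.≤ᵇ⇒≤ U L t) ⟩
        L ℕ.* h ∎)
      lowers : ¬ T (suc L ≤ᵇ W)
      lowers t = ℕP.<-irrefl refl (begin-strict
        L ℕ.* h <⟨ ℕP.*-monoˡ-< h (ℕP.≤ᵇ⇒≤ (suc L) W t) ⟩
        W ℕ.* h ≡⟨ distribʳ₄ h (lower s₀) (lower s₁) (lower s₂) (lower s₃) ⟩
        _ ≤⟨ ℕP.+-mono-≤ (ℕP.+-mono-≤ (ℕP.+-mono-≤ (lower≤ v₀) (lower≤ v₁)) (lower≤ v₂)) (lower≤ v₃) ⟩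
        _ ≡⟨ Lh ⟨
        L ℕ.* h ∎)

    floors : ℕ → Weights → Weights
    floors κ l i = (κ ℕ.* l i) / h

    module _ (l : Weights) (total-l : total l ≡ h) {G : Set} where

      floors-increase : ∀ κ i → floors κ l i ℕ.≤ floors (suc κ) l i
      floors-increase κ i = /-monoˡ-≤ h (ℕP.m≤n+m (κ ℕ.* l i) (l i))

      -- The alternative `G` is the exit taken as soon as some κ splits the weights, so the floor
      -- sums are needed only where no split has turned up.
      refute-sound : ∀ n κ s₀ s₁ s₂ s₃ → T (refute n κ s₀ s₁ s₂ s₃) →
        (∀ κ′ → κ ℕ.≤ κ′ → κ′ ℕ.≤ κ ℕ.+ n → G ⊎ total (floors κ′ l) ℕ.+ 2 ≡ κ′) →
        Valid κ (l 0F) s₀ → Valid κ (l 1F) s₁ → Valid κ (l 2F) s₂ → Valid κ (l 3F) s₃ → G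
      refute-sound zero κ s₀ s₁ s₂ s₃ t _ v₀ v₁ v₂ v₃ = contradiction t (alive {l = l} total-l v₀ v₁ v₂ v₃)
      refute-sound (suc n) κ s₀ s₁ s₂ s₃ t hyp v₀ v₁ v₂ v₃
        with Equivalence.to (T-∨ {dead s₀ s₁ s₂ s₃}) t
      ... | inj₁ t′ = contradiction t′ (alive {l = l} total-l v₀ v₁ v₂ v₃)
      ... | inj₂ t′ with hyp κ ℕP.≤-refl (ℕP.m≤m+n κ (suc n))
                       | hyp (suc κ) (ℕP.n≤1+n κ) (ℕP.≤-trans (s≤s (ℕP.m≤m+n κ n))
                         (ℕP.≤-reflexive (sym (ℕP.+-suc κ n))))
      ...   | inj₁ goal | _ = goal
      ...   | inj₂ _ | inj₁ goal = goal
      ...   | inj₂ eq | inj₂ eq′ = branch (oneUp (floors-increase κ) increment)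
        where
        u = L / suc κ
        increment : total (floors (suc κ) l) ≡ suc (total (floors κ l))
        increment = ℕP.+-cancelʳ-≡ 2 _ _ (trans eq′ (cong suc (sym eq)))
        parts = Equivalence.to (T-∧ {u ℕ.* suc κ ≡ᵇ L}) t′
        u*κ≡L : u ℕ.* suc κ ≡ L
        u*κ≡L = ℕP.≡ᵇ⇒≡ _ L (proj₁ parts)
        t₀ = Equivalence.to (T-∧ {refute n (suc κ) (up u s₀) (stay u s₁) (stay u s₂) (stay u s₃)}) (proj₂ parts)
        t₁ = Equivalence.to (T-∧ {refute n (suc κ) (stay u s₀) (up u s₁) (stay u s₂) (stay u s₃)}) (proj₂ t₀)
        t₂ = Equivalence.to (T-∧ {refute n (suc κ) (stay u s₀) (stay u s₁) (up u s₂) (stay u s₃)}) (proj₂ t₁)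
        hyp′ : ∀ κ′ → suc κ ℕ.≤ κ′ → κ′ ℕ.≤ suc κ ℕ.+ n → G ⊎ total (floors κ′ l) ℕ.+ 2 ≡ κ′
        hyp′ κ′ p q = hyp κ′ (ℕP.<⇒≤ p) (ℕP.≤-trans q (ℕP.≤-reflexive (sym (ℕP.+-suc κ n))))
        stayed : ∀ {i s} → floors (suc κ) l i ≡ floors κ l i → Valid κ (l i) s → Valid (suc κ) (l i) (stay u s)
        stayed e v = narrow-valid {u = u} u*κ≡L (trans (quot≡ v) (sym e)) v
        rose : ∀ {i s} → floors (suc κ) l i ≡ suc (floors κ l i) → Valid κ (l i) s → Valid (suc κ) (l i) (up u s)
        rose e v = narrow-valid {u = u} u*κ≡L (trans (cong suc (quot≡ v)) (sym e)) v
        branch : OneUp (floors κ l) (floors (suc κ) l) → G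
        branch (one-up 0F r s) = refute-sound n (suc κ) _ _ _ _ (proj₁ t₀) hyp′
          (rose r v₀) (stayed (s 1F λ ()) v₁) (stayed (s 2F λ ()) v₂) (stayed (s 3F λ ()) v₃)
        branch (one-up 1F r s) = refute-sound n (suc κ) _ _ _ _ (proj₁ t₁) hyp′
          (stayed (s 0F λ ()) v₀) (rose r v₁) (stayed (s 2F λ ()) v₂) (stayed (s 3F λ ()) v₃)
        branch (one-up 2F r s) = refute-sound n (suc κ) _ _ _ _ (proj₁ t₂) hyp′
          (stayed (s 0F λ ()) v₀) (stayed (s 1F λ ()) v₁) (rose r v₂) (stayed (s 3F λ ()) v₃)
        branch (one-up 3F r s) = refute-sound n (suc κ) _ _ _ _ (proj₂ t₂) hyp′
          (stayed (s 0F λ ()) v₀) (stayed (s 1F λ ()) v₁) (stayed (s 2F λ ()) v₂) (rose r v₃)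

      refutation : ∀ n → T (refute n 2 start start start start) → L / 2 ℕ.* 2 ≡ L →
        (∀ κ → 2 ℕ.≤ κ → κ ℕ.≤ 2 ℕ.+ n → G ⊎ total (floors κ l) ℕ.+ 2 ≡ κ) → G
      refutation n refuted even hyp with hyp 2 ℕP.≤-refl (ℕP.m≤m+n 2 n)
      ... | inj₁ goal = goal
      ... | inj₂ eq = refute-sound n 2 start start start start refuted hyp
              (valid 0F (proj₁ zeros)) (valid 1F (proj₁ (proj₂ zeros)))
              (valid 2F (proj₁ (proj₂ (proj₂ zeros)))) (valid 3F (proj₂ (proj₂ (proj₂ zeros))))
        where
        zeros : floors 2 l 0F ≡ 0 × floors 2 l 1F ≡ 0 × floors 2 l 2F ≡ 0 × floors 2 l 3F ≡ 0
        zeros with floors 2 l 0F | floors 2 l 1F | floors 2 l 2F | floors 2 l 3F | ℕP.+-cancelʳ-≡ 2 _ 0 eq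
        ... | zero | zero | zero | zero | refl = refl , refl , refl , refl
        instance
          half≢0 : NonZero (L / 2)
          half≢0 = ℕ.≢-nonZero (λ z → ℕ.≢-nonZero⁻¹ L (trans (sym even) (cong (ℕ._* 2) z)))
        half : ∀ x → (L / 2) ℕ.* (2 ℕ.* x) ≡ L ℕ.* x
        half x = trans (sym (ℕP.*-assoc (L / 2) 2 x)) (cong (ℕ._* x) even)
        valid : ∀ i → floors 2 l i ≡ 0 → Valid 2 (l i) start
        valid i z = record
          { quot≡ = sym z ; lower≤ = z≤n
          ; <upper = begin-strict
              L ℕ.* l i ≡⟨ half (l i) ⟨
              (L / 2) ℕ.* (2 ℕ.* l i) <⟨ ℕP.*-monoʳ-< (L / 2)
                (subst (λ q → 2 ℕ.* l i ℕ.< suc q ℕ.* h) z (/-upper (2 ℕ.* l i))) ⟩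
              (L / 2) ℕ.* (1 ℕ.* h) ≡⟨ cong ((L / 2) ℕ.*_) (ℕP.*-identityˡ h) ⟩
              (L / 2) ℕ.* h ∎ }
          where open ℕP.≤-Reasoning

-- Residues of the multiples of coprime weights

module _ (h : ℕ) .{{_ : NonZero h}} (l : Weights) (total-l : total l ≡ h) where

  divisor : ℕ
  divisor = gcd (gcd (l 0F) (l 1F)) (gcd (l 2F) (l 3F))

  divisor∣ : ∀ i → divisor ∣ l i
  divisor∣ = ∀⁴
    (∣-trans (gcd[m,n]∣m (gcd (l 0F) (l 1F)) _) (gcd[m,n]∣m (l 0F) (l 1F)))
    (∣-trans (gcd[m,n]∣m (gcd (l 0F) (l 1F)) _) (gcd[m,n]∣n (l 0F) (l 1F)))
    (∣-trans (gcd[m,n]∣n (gcd (l 0F) (l 1F)) _) (gcd[m,n]∣m (l 2F) (l 3F)))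
    (∣-trans (gcd[m,n]∣n (gcd (l 0F) (l 1F)) _) (gcd[m,n]∣n (l 2F) (l 3F)))

  divisor≢0 : divisor ≢ 0
  divisor≢0 z = ℕ.≢-nonZero⁻¹ h (trans (sym total-l)
    (total-cong {l} {λ _ → 0} (λ i → 0∣⇒≡0 (subst (_∣ l i) z (divisor∣ i)))))

  -- The gcd of the c lᵢ is c times that of the lᵢ. This prevents κ l from being congruent to 0, l
  -- or - l modulo h for the κ under consideration.
  coprime-∣ : divisor ≡ 1 → ∀ c → (∀ i → h ∣ c ℕ.* l i) → h ∣ c
  coprime-∣ coprime c d = subst (h ∣_) (trans (cong (c ℕ.*_) coprime) (ℕP.*-identityʳ c))
    (∣-gcd _ _ (∣-gcd _ _ (d 0F) (d 1F)) (∣-gcd _ _ (d 2F) (d 3F)))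
    where
    ∣-gcd : ∀ m n → h ∣ c ℕ.* m → h ∣ c ℕ.* n → h ∣ c ℕ.* gcd m n
    ∣-gcd m n p q = subst (h ∣_) (sym (c*gcd[m,n]≡gcd[cm,cn] c m n)) (gcd-greatest p q)

  floors : ℕ → Weights
  floors κ i = (κ ℕ.* l i) / h

  residue+floor : ∀ κ i → residue h κ l i ℕ.+ floors κ i ℕ.* h ≡ κ ℕ.* l i
  residue+floor κ i = sym (m≡m%n+[m/n]*n (κ ℕ.* l i) h)

  total-residue : ∀ κ → total (residue h κ l) ≡ (κ ∸ total (floors κ)) ℕ.* h
  total-residue κ = begin
    R ≡⟨ ℕP.m+n∸n≡m R (F ℕ.* h) ⟨
    R ℕ.+ F ℕ.* h ∸ F ℕ.* h ≡⟨ cong (_∸ F ℕ.* h) (cong (R ℕ.+_) (distribʳ₄ h (f 0F) (f 1F) (f 2F) (f 3F))) ⟩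
    R ℕ.+ total (λ i → f i ℕ.* h) ∸ F ℕ.* h
      ≡⟨ cong (_∸ F ℕ.* h) (interchange₄ (r 0F) (r 1F) (r 2F) (r 3F) _ _ _ _) ⟨
    total (λ i → r i ℕ.+ f i ℕ.* h) ∸ F ℕ.* h ≡⟨ cong (_∸ F ℕ.* h) (total-cong (residue+floor κ)) ⟩
    total (λ i → κ ℕ.* l i) ∸ F ℕ.* h ≡⟨ cong (_∸ F ℕ.* h) (distribˡ₄ κ (l 0F) (l 1F) (l 2F) (l 3F)) ⟨
    κ ℕ.* total l ∸ F ℕ.* h ≡⟨ cong (λ x → κ ℕ.* x ∸ F ℕ.* h) total-l ⟩
    κ ℕ.* h ∸ F ℕ.* h ≡⟨ ℕP.*-distribʳ-∸ h κ F ⟨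
    (κ ∸ F) ℕ.* h ∎
    where
    open ≡-Reasoning
    r = residue h κ l
    f = floors κ
    R = total r
    F = total f

  -- As no residue of κ l vanishes, those of - κ l are their complements to h, of total 4 h - 3 h =
  -- h. So - κ is the multiplier of the split.
  complement : ∀ κ → (∀ i → l i ≢ 0) → (∀ i → residue h κ l i ≢ 0) → total (residue h κ l) ≡ 3 ℕ.* h →
    (∃[ i ] h ∸ residue h κ l i ≢ l i) → Split h l
  complement κ l≢0 r≢0 eq ne = record
    { κ = ℤ.- (+ κ) ; f = λ i → ℤ.- (+ floors κ i) ℤ.- ℤ.1ℤ ; m = m
    ; m≡κl-fh = λ i → spec i
    ; total-m = ℕP.+-cancelʳ-≡ (total r) _ _ (trans (sym (interchange₄ (m 0F) (m 1F) (m 2F) (m 3F) _ _ _ _))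
        (trans (total-cong m+r) (trans (four h) (cong (h ℕ.+_) (sym eq)))))
    ; m<h = λ i → ℕP.∸-monoʳ-< (ℕP.n≢0⇒n>0 (r≢0 i)) (ℕP.<⇒≤ (m%n<n (κ ℕ.* l i) h))
    ; m≢l = ne
    ; supported = λ i z → contradiction z (l≢0 i) }
    where
    r = residue h κ l
    m : Weights
    m i = h ∸ r i
    m+r : ∀ i → m i ℕ.+ r i ≡ h
    m+r i = ℕP.m∸n+n≡m (ℕP.<⇒≤ (m%n<n (κ ℕ.* l i) h))
    spec : ∀ i → + m i ≡ ℤ.- (+ κ) ℤ.* + l i ℤ.- (ℤ.- (+ floors κ i) ℤ.- ℤ.1ℤ) ℤ.* + h
    spec i = identity (+ m i) (+ r i) (+ κ) (+ l i) (+ floors κ i) (+ h)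
      (cong +_ (m+r i)) (residue-spec h κ l i)
      where
      open ≡-Reasoning
      expand : ∀ m r → m ≡ (m ℤ.+ r) ℤ.- r
      expand = solve-ℤ
      collect : ∀ κ l f h → h ℤ.- (κ ℤ.* l ℤ.- f ℤ.* h) ≡ ℤ.- κ ℤ.* l ℤ.- (ℤ.- f ℤ.- ℤ.1ℤ) ℤ.* h
      collect = solve-ℤ
      identity : ∀ m r κ l f h → m ℤ.+ r ≡ h → r ≡ κ ℤ.* l ℤ.- f ℤ.* h →
        m ≡ ℤ.- κ ℤ.* l ℤ.- (ℤ.- f ℤ.- ℤ.1ℤ) ℤ.* h
      identity m r κ l f h p q = begin
        m ≡⟨ expand m r ⟩
        (m ℤ.+ r) ℤ.- r ≡⟨ cong₂ ℤ._-_ p q ⟩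
        h ℤ.- (κ ℤ.* l ℤ.- f ℤ.* h) ≡⟨ collect κ l f h ⟩
        ℤ.- κ ℤ.* l ℤ.- (ℤ.- f ℤ.- ℤ.1ℤ) ℤ.* h ∎
    four : ∀ h → h ℕ.+ h ℕ.+ h ℕ.+ h ≡ h ℕ.+ 3 ℕ.* h
    four = solve-ℕ

  -- The residues sum to s h with s < 4, so that κ splits l unless s = 2.
  module _ (coprime : divisor ≡ 1) where

    private
      ∄⇒≗ : ∀ {m : Weights} → ¬ (∃[ i ] m i ≢ l i) → m ≗ l
      ∄⇒≗ {m} ∄ i with m i ℕ.≟ l i
      ... | yes e = e
      ... | no ne = contradiction (i , ne) ∄

      too-small : ∀ {c} → suc c ℕ.< h → ¬ (∀ i → h ∣ suc c ℕ.* l i)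
      too-small {c} c<h d = ℕP.<⇒≱ c<h (∣⇒≤ (coprime-∣ coprime (suc c) d))

    splits : ∀ κ → 2 ℕ.+ κ ℕ.+ 1 ℕ.< h → Split h l ⊎ total (floors (2 ℕ.+ κ)) ℕ.+ 2 ≡ 2 ℕ.+ κ
    splits κ-2 κ+1<h = go (κ ∸ F) refl
      where
      κ = 2 ℕ.+ κ-2
      r = residue h κ l
      F = total (floors κ)
      κ<h : κ ℕ.< h
      κ<h = ℕP.≤-<-trans (ℕP.m≤m+n κ 1) κ+1<h
      r<h : ∀ i → r i ℕ.< h
      r<h i = m%n<n (κ ℕ.* l i) h
      total-r : ∀ {s} → κ ∸ F ≡ s → total r ≡ s ℕ.* h
      total-r e = trans (total-residue κ) (cong (ℕ._* h) e)
      four : ∀ h → h ℕ.+ h ℕ.+ h ℕ.+ h ≡ 4 ℕ.* h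
      four = solve-ℕ
      total-r< : total r ℕ.< 4 ℕ.* h
      total-r< = subst (total r ℕ.<_) (four h)
        (ℕP.+-mono-< (ℕP.+-mono-< (ℕP.+-mono-< (r<h 0F) (r<h 1F)) (r<h 2F)) (r<h 3F))
      all-zero : total r ≡ 0 → ∀ i → r i ≡ 0
      all-zero z = ∀⁴ (ℕP.m+n≡0⇒m≡0 _ z₂) (ℕP.m+n≡0⇒n≡0 (r 0F) z₂) (ℕP.m+n≡0⇒n≡0 (r 0F ℕ.+ r 1F) z₃)
        (ℕP.m+n≡0⇒n≡0 (r 0F ℕ.+ r 1F ℕ.+ r 2F) z)
        where
        z₃ = ℕP.m+n≡0⇒m≡0 (r 0F ℕ.+ r 1F ℕ.+ r 2F) z
        z₂ = ℕP.m+n≡0⇒m≡0 (r 0F ℕ.+ r 1F) z₃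
      r≡l⇒∣ : (∀ i → r i ≡ l i) → ∀ i → h ∣ suc κ-2 ℕ.* l i
      r≡l⇒∣ e i = divides (floors κ i) (ℕP.+-cancelˡ-≡ (l i) _ _
        (trans (sym (residue+floor κ i)) (cong (ℕ._+ floors κ i ℕ.* h) (e i))))
      h-r≡l⇒∣ : (∀ i → h ∸ r i ≡ l i) → ∀ i → h ∣ suc κ ℕ.* l i
      h-r≡l⇒∣ e i = divides (suc (floors κ i)) (begin
        l i ℕ.+ κ ℕ.* l i ≡⟨ cong₂ ℕ._+_ (e i) (residue+floor κ i) ⟨
        (h ∸ r i) ℕ.+ (r i ℕ.+ floors κ i ℕ.* h) ≡⟨ ℕP.+-assoc (h ∸ r i) (r i) _ ⟨
        (h ∸ r i) ℕ.+ r i ℕ.+ floors κ i ℕ.* h ≡⟨ cong (ℕ._+ floors κ i ℕ.* h) (ℕP.m∸n+n≡m (ℕP.<⇒≤ (r<h i))) ⟩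
        h ℕ.+ floors κ i ℕ.* h ∎)
        where open ≡-Reasoning
      three : ∀ h → h ℕ.+ h ℕ.+ h ≡ 3 ℕ.* h
      three = solve-ℕ
      rot₁ : ∀ a b c d → a ℕ.+ b ℕ.+ c ℕ.+ d ≡ b ℕ.+ c ℕ.+ d ℕ.+ a
      rot₁ = solve-ℕ
      rot₂ : ∀ a b c d → a ℕ.+ b ℕ.+ c ℕ.+ d ≡ a ℕ.+ c ℕ.+ d ℕ.+ b
      rot₂ = solve-ℕ
      rot₃ : ∀ a b c d → a ℕ.+ b ℕ.+ c ℕ.+ d ≡ a ℕ.+ b ℕ.+ d ℕ.+ c
      rot₃ = solve-ℕ
      three-left : ∀ i j k m → total r ≡ r i ℕ.+ r j ℕ.+ r k ℕ.+ r m → total r ≡ 3 ℕ.* h → r m ≢ 0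
      three-left i j k m e eq z = ℕP.<-irrefl (three h) (begin-strict
        h ℕ.+ h ℕ.+ h ≡⟨ three h ⟩
        3 ℕ.* h ≡⟨ eq ⟨
        total r ≡⟨ e ⟩
        r i ℕ.+ r j ℕ.+ r k ℕ.+ r m ≡⟨ cong (r i ℕ.+ r j ℕ.+ r k ℕ.+_) z ⟩
        r i ℕ.+ r j ℕ.+ r k ℕ.+ 0 ≡⟨ ℕP.+-identityʳ _ ⟩
        r i ℕ.+ r j ℕ.+ r k <⟨ ℕP.+-mono-< (ℕP.+-mono-< (r<h i) (r<h j)) (r<h k) ⟩
        h ℕ.+ h ℕ.+ h ≡⟨ three h ⟩
        3 ℕ.* h ∎)
        where open ℕP.≤-Reasoning
      residue≢0 : total r ≡ 3 ℕ.* h → ∀ i → r i ≢ 0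
      residue≢0 eq = ∀⁴
        (three-left 1F 2F 3F 0F (rot₁ (r 0F) (r 1F) (r 2F) (r 3F)) eq)
        (three-left 0F 2F 3F 1F (rot₂ (r 0F) (r 1F) (r 2F) (r 3F)) eq)
        (three-left 0F 1F 3F 2F (rot₃ (r 0F) (r 1F) (r 2F) (r 3F)) eq)
        (three-left 0F 1F 2F 3F refl eq)
      nonzero : total r ≡ 3 ℕ.* h → ∀ i → l i ≢ 0
      nonzero eq i = residue≢0 eq i ∘ residue-supported h κ l i
      go : ∀ s → κ ∸ F ≡ s → Split h l ⊎ F ℕ.+ 2 ≡ κ
      go 0 e = contradiction (λ i → m%n≡0⇒n∣m (κ ℕ.* l i) h (all-zero (total-r e) i)) (too-small κ<h)
      go 1 e with FinP.any? (λ i → ¬? (r i ℕ.≟ l i))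
      ... | yes ne = inj₁ (residue-split h κ l (trans (total-r e) (ℕP.*-identityˡ h)) ne)
      ... | no ∄ = contradiction (r≡l⇒∣ (∄⇒≗ ∄)) (too-small (ℕP.<-trans ℕP.≤-refl κ<h))
      go 2 e = inj₂ (trans (cong (F ℕ.+_) (sym e))
        (ℕP.m+[n∸m]≡n {F} {κ} (ℕP.<⇒≤ (ℕP.m∸n≢0⇒n<m {κ} {F} (λ z → contradiction (trans (sym e) z) λ ())))))
      go 3 e with FinP.any? (λ i → ¬? (h ∸ r i ℕ.≟ l i))
      ... | yes ne = inj₁ (complement κ (nonzero (total-r e)) (residue≢0 (total-r e)) (total-r e) ne)
      -- Here - κ l would be congruent to l and h would divide κ + 1; this is the case that requires
      -- κ + 1 < h.
      ... | no ∄ = contradiction (h-r≡l⇒∣ (∄⇒≗ ∄)) (too-small (subst (ℕ._< h) (ℕP.+-comm κ 1) κ+1<h))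
      go (suc (suc (suc (suc s)))) e = contradiction total-r<
        (ℕP.≤⇒≯ (ℕP.≤-trans (ℕP.*-monoˡ-≤ h {4} {suc (suc (suc (suc s)))} (s≤s (s≤s (s≤s (s≤s z≤n)))))
          (ℕP.≤-reflexive (sym (total-r e)))))

-- The floor sums are controlled for κ ≤ h - 2. From h = 20 on this includes κ = 18, the depth at
-- which the tree is closed. The total 1 stays in the list because arithmetic alone does not exclude
-- it: that takes the vectors carrying the weights.
reduction : ∀ h .{{_ : NonZero h}} l → total l ≡ h → h ∈ₗ 1 ∷ numerators ⊎ CommonDivisor l ⊎ Split h l
reduction h l total-l with h ℕ.<? 20
reduction (suc h-1) l total-l | yes h<20 = Small.check-sound 20 h-1 l
  (Small.allBelow-sound (Small.check 20 2) 19 Small.checked h-1 (ℕP.≤-pred h<20)) total-l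
... | no h≮20 with divisor h l total-l in eq
...   | 0 = contradiction eq (divisor≢0 h l total-l)
-- 12252240 is the least common multiple of 1, …, 18.
...   | 1 = inj₂ (inj₂ (Tree.refutation 12252240 h l total-l 16 tt refl floor-sum))
  where
  floor-sum : ∀ κ → 2 ℕ.≤ κ → κ ℕ.≤ 18 → Split h l ⊎ total (floors h l total-l κ) ℕ.+ 2 ≡ κ
  floor-sum (suc (suc κ)) _ κ≤18 = splits h l total-l eq κ
    (ℕP.≤-trans (s≤s (ℕP.+-monoˡ-≤ 1 κ≤18)) (ℕP.≮⇒≥ h≮20))
  floor-sum 1 (s≤s ()) _
...   | g@(suc (suc _)) = inj₂ (inj₁ (g , s≤s (s≤s z≤n) , λ i → subst (_∣ l i) eq (divisor∣ h l total-l i)))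

-- Integer vectors

module ℤΣ = SemiringSum ℤP.+-*-semiring
module ℤΣ′ = MonoidSum ℤP.+-0-commutativeMonoid

0<* : ∀ {a b} → 0ℤ ℤ.< a → 0ℤ ℤ.< b → 0ℤ ℤ.< a ℤ.* b
0<* {a} {b} p q = subst (ℤ._< a ℤ.* b) (ℤP.*-zeroʳ a) (ℤP.*-monoˡ-<-pos a {{ℤ.positive p}} q)

0≤* : ∀ {a b} → 0ℤ ℤ.≤ a → 0ℤ ℤ.≤ b → 0ℤ ℤ.≤ a ℤ.* b
0≤* {a} {b} p q = subst (ℤ._≤ a ℤ.* b) (ℤP.*-zeroʳ a) (ℤP.*-monoˡ-≤-nonNeg a {{ℤ.nonNegative p}} q)

0<*⁻¹ : ∀ {a b} → 0ℤ ℤ.≤ a → 0ℤ ℤ.< a ℤ.* b → 0ℤ ℤ.< b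
0<*⁻¹ {a} {b} p q = ℤP.*-cancelˡ-<-nonNeg a {{ℤ.nonNegative p}} (subst (ℤ._< a ℤ.* b) (sym (ℤP.*-zeroʳ a)) q)

0≤*⁻¹ : ∀ {a b} → 0ℤ ℤ.< a → 0ℤ ℤ.≤ a ℤ.* b → 0ℤ ℤ.≤ b
0≤*⁻¹ {a} {b} p q = ℤP.*-cancelˡ-≤-pos 0ℤ b a {{ℤ.positive p}} (subst (ℤ._≤ a ℤ.* b) (sym (ℤP.*-zeroʳ a)) q)

*≡0⇒≡0 : ∀ a b → a ≢ 0ℤ → a ℤ.* b ≡ 0ℤ → b ≡ 0ℤ
*≡0⇒≡0 a b a≢0 e = [ (λ z → contradiction z a≢0) , (λ z → z) ]′ (ℤP.i*j≡0⇒i≡0∨j≡0 a e)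

<⇒≢0 : ∀ {a} → 0ℤ ℤ.< a → a ≢ 0ℤ
<⇒≢0 p refl = ℤP.<-irrefl refl p

cancel-pos : ∀ {g a b} → 0ℤ ℤ.< g → g ℤ.* a ≡ g ℤ.* b → a ≡ b
cancel-pos {g} {a} {b} p = ℤP.*-cancelˡ-≡ g a b {{ℤ.≢-nonZero (<⇒≢0 p)}}

-- Opaque, so that sums over Fin 4 are not unfolded in conversion checking.
opaque
  ∑ : ∀ {n} → Vector ℤ n → ℤ
  ∑ = ℤΣ.sum

  ∑-nil : (u : Vector ℤ 0) → ∑ u ≡ 0ℤ
  ∑-nil u = refl

  ∑-suc : ∀ {n} (u : Vector ℤ (suc n)) → ∑ u ≡ u zero ℤ.+ ∑ (tail u)
  ∑-suc u = refl

  ∑-cong : ∀ {n} {u v : Vector ℤ n} → u ≗ v → ∑ u ≡ ∑ v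
  ∑-cong = ℤΣ.sum-cong-≗

  ∑-zero : ∀ {n} {u : Vector ℤ n} → (∀ i → u i ≡ 0ℤ) → ∑ u ≡ 0ℤ
  ∑-zero {n} e = trans (∑-cong e) (ℤΣ.sum-replicate-zero n)

  ∑-* : ∀ {n} p (u : Vector ℤ n) → ∑ (λ i → p ℤ.* u i) ≡ p ℤ.* ∑ u
  ∑-* p u = sym (ℤΣ.*-distribˡ-sum p u)

  ∑-comm : ∀ {n k} (u : Fin n → Fin k → ℤ) → ∑ (λ i → ∑ (u i)) ≡ ∑ (λ j → ∑ (λ i → u i j))
  ∑-comm = ℤΣ′.∑-comm

  ∑-remove : ∀ {n} i (u : Vector ℤ (suc n)) → ∑ u ≡ u i ℤ.+ ∑ (removeAt u i)
  ∑-remove i u = ℤΣ′.sum-remove {i = i} u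

∑-lin : ∀ {n} (p q : ℤ) (u v : Vector ℤ n) → ∑ (λ i → p ℤ.* u i ℤ.- q ℤ.* v i) ≡ p ℤ.* ∑ u ℤ.- q ℤ.* ∑ v
∑-lin {zero} p q u v = trans (∑-nil _)
  (trans (base p q) (cong₂ (λ x y → p ℤ.* x ℤ.- q ℤ.* y) (sym (∑-nil u)) (sym (∑-nil v))))
  where base : ∀ p q → 0ℤ ≡ p ℤ.* 0ℤ ℤ.- q ℤ.* 0ℤ
        base = solve-ℤ
∑-lin {suc n} p q u v = begin
  ∑ (λ i → p ℤ.* u i ℤ.- q ℤ.* v i) ≡⟨ ∑-suc _ ⟩
  (p ℤ.* u zero ℤ.- q ℤ.* v zero) ℤ.+ ∑ (λ i → p ℤ.* u (suc i) ℤ.- q ℤ.* v (suc i))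
    ≡⟨ cong (ℤ._+_ (p ℤ.* u zero ℤ.- q ℤ.* v zero)) (∑-lin p q (tail u) (tail v)) ⟩
  (p ℤ.* u zero ℤ.- q ℤ.* v zero) ℤ.+ (p ℤ.* ∑ (tail u) ℤ.- q ℤ.* ∑ (tail v))
    ≡⟨ step p q (u zero) (v zero) (∑ (tail u)) (∑ (tail v)) ⟩
  p ℤ.* (u zero ℤ.+ ∑ (tail u)) ℤ.- q ℤ.* (v zero ℤ.+ ∑ (tail v))
    ≡⟨ cong₂ (λ x y → p ℤ.* x ℤ.- q ℤ.* y) (∑-suc u) (∑-suc v) ⟨
  p ℤ.* ∑ u ℤ.- q ℤ.* ∑ v ∎
  where open ≡-Reasoning
        step : ∀ p q a b s t → (p ℤ.* a ℤ.- q ℤ.* b) ℤ.+ (p ℤ.* s ℤ.- q ℤ.* t) ≡ p ℤ.* (a ℤ.+ s) ℤ.- q ℤ.* (b ℤ.+ t)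
        step = solve-ℤ

∑-mono : ∀ {n} {u v : Vector ℤ n} → (∀ i → u i ℤ.≤ v i) → ∑ u ℤ.≤ ∑ v
∑-mono {zero} {u} {v} p = ℤP.≤-reflexive (trans (∑-nil u) (sym (∑-nil v)))
∑-mono {suc n} {u} {v} p = subst₂ ℤ._≤_ (sym (∑-suc u)) (sym (∑-suc v)) (ℤP.+-mono-≤ (p zero) (∑-mono (p ∘ suc)))

∑-nonneg : ∀ {n} {u : Vector ℤ n} → (∀ i → 0ℤ ℤ.≤ u i) → 0ℤ ℤ.≤ ∑ u
∑-nonneg {n} {u} p = subst (ℤ._≤ ∑ u) (∑-zero {n} {λ _ → 0ℤ} (λ _ → refl)) (∑-mono p)

≤-∑ : ∀ {n} {u : Vector ℤ n} → (∀ i → 0ℤ ℤ.≤ u i) → ∀ i → u i ℤ.≤ ∑ u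
≤-∑ {suc n} {u} p i = subst₂ ℤ._≤_ (ℤP.+-identityʳ (u i)) (sym (∑-remove i u))
  (ℤP.+-monoʳ-≤ (u i) (∑-nonneg (p ∘ punchIn i)))

∑-change : ∀ {n} {u v : Vector ℤ n} i → (∀ j → j ≢ i → v j ≡ u j) → ∑ v ≡ (∑ u ℤ.- u i) ℤ.+ v i
∑-change {suc n} {u} {v} i e = begin
  ∑ v ≡⟨ ∑-remove i v ⟩
  v i ℤ.+ ∑ (removeAt v i) ≡⟨ cong (ℤ._+_ (v i)) (∑-cong λ j → e (punchIn i j) (punchInᵢ≢i i j)) ⟩
  v i ℤ.+ ∑ (removeAt u i) ≡⟨ regroup (v i) (u i) (∑ (removeAt u i)) ⟩
  ((u i ℤ.+ ∑ (removeAt u i)) ℤ.- u i) ℤ.+ v i ≡⟨ cong (λ s → (s ℤ.- u i) ℤ.+ v i) (∑-remove i u) ⟨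
  (∑ u ℤ.- u i) ℤ.+ v i ∎
  where
  open ≡-Reasoning
  regroup : ∀ a b s → a ℤ.+ s ≡ ((b ℤ.+ s) ℤ.- b) ℤ.+ a
  regroup = solve-ℤ

others-zero : ∀ {n} {u : Vector ℤ n} → (∀ i → 0ℤ ℤ.≤ u i) → ∀ i → u i ≡ ∑ u → ∀ k → k ≢ i → u k ≡ 0ℤ
others-zero {n} {u} u≥0 i e k k≢i = ℤP.≤-antisym
  (subst₂ ℤ._≤_ (updateAt-minimal k i u k≢i) ∑v≡0 (≤-∑ v≥0 k)) (u≥0 k)
  where
  v : Vector ℤ n
  v = updateAt u i (const 0ℤ)
  ∑v≡0 : ∑ v ≡ 0ℤ
  ∑v≡0 = trans (∑-change {u = u} i (λ j j≢i → updateAt-minimal j i u j≢i))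
    (cong₂ ℤ._+_ (ℤP.i≡j⇒i-j≡0 (sym e)) (updateAt-updates i u))
  v≥0 : ∀ j → 0ℤ ℤ.≤ v j
  v≥0 j with j Fin.≟ i
  ... | yes refl = ℤP.≤-reflexive (sym (updateAt-updates j u))
  ... | no j≢i = subst (0ℤ ℤ.≤_) (sym (updateAt-minimal j i u j≢i)) (u≥0 j)

∑-removed : ∀ {n} (u : Vector ℤ (suc n)) i → u i ≡ 0ℤ → ∑ (removeAt u i) ≡ ∑ u
∑-removed u i z = sym (trans (∑-remove i u) (trans (cong (ℤ._+ ∑ (removeAt u i)) z) (ℤP.+-identityˡ _)))

infix 7 _∙_
_∙_ : ∀ {n} → Vector ℤ n → Vector ℤ n → ℤ
u ∙ v = ∑ (λ i → u i ℤ.* v i)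

∙-lin : ∀ {n} p q (u v x : Vector ℤ n) → (λ i → p ℤ.* u i ℤ.- q ℤ.* v i) ∙ x ≡ p ℤ.* (u ∙ x) ℤ.- q ℤ.* (v ∙ x)
∙-lin p q u v x = trans (∑-cong λ i → expand p q (u i) (v i) (x i))
  (∑-lin p q (λ i → u i ℤ.* x i) (λ i → v i ℤ.* x i))
  where expand : ∀ p q a b x → (p ℤ.* a ℤ.- q ℤ.* b) ℤ.* x ≡ p ℤ.* (a ℤ.* x) ℤ.- q ℤ.* (b ℤ.* x)
        expand = solve-ℤ

∙-cong : ∀ {n} {u v : Vector ℤ n} (x : Vector ℤ n) → u ≗ v → u ∙ x ≡ v ∙ x
∙-cong x e = ∑-cong λ i → cong (ℤ._* x i) (e i)

∙-*ˡ : ∀ {n} p (u x : Vector ℤ n) → (λ i → p ℤ.* u i) ∙ x ≡ p ℤ.* (u ∙ x)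
∙-*ˡ p u x = trans (∑-cong λ i → ℤP.*-assoc p (u i) (x i)) (∑-* p (λ i → u i ℤ.* x i))

∙-1 : ∀ {n} (u : Vector ℤ n) → u ∙ const 1ℤ ≡ ∑ u
∙-1 u = ∑-cong λ i → ℤP.*-identityʳ (u i)

-- Gaussian elimination without division: a vector with nonzero first coordinate α is the pivot, and
-- the others are multiplied by α before a multiple of the pivot is subtracted. The coefficient of
-- the pivot is then chosen to balance the first coordinate.
dependence : ∀ d k (V : Fin (suc (d ℕ.+ k)) → Vector ℤ d) →
  ∃[ c ] ((∃[ i ] c i ≢ 0ℤ) × (∀ j → c ∙ (λ i → V i j) ≡ 0ℤ))
dependence zero k V = (λ _ → 1ℤ) , (zero , λ ()) , λ ()
dependence (suc d) k V with FinP.any? (λ i → ¬? (V i zero ℤ.≟ 0ℤ))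
... | no none = (0ℤ ∷ᵛ c) , (suc (proj₁ c≢0) , proj₂ c≢0) , balanced
  where
  vanish : ∀ i → V i zero ≡ 0ℤ
  vanish i with V i zero ℤ.≟ 0ℤ
  ... | yes z = z
  ... | no ne = contradiction (i , ne) none
  ih = dependence d k (λ i j → V (suc i) (suc j))
  c = proj₁ ih
  c≢0 = proj₁ (proj₂ ih)
  balanced : ∀ j → (0ℤ ∷ᵛ c) ∙ (λ i → V i j) ≡ 0ℤ
  balanced zero = ∑-zero λ i → trans (cong ((0ℤ ∷ᵛ c) i ℤ.*_) (vanish i)) (ℤP.*-zeroʳ ((0ℤ ∷ᵛ c) i))
  balanced (suc j) = trans (∑-suc (λ i → (0ℤ ∷ᵛ c) i ℤ.* V i (suc j)))
    (trans (ℤP.+-identityˡ _) (proj₂ (proj₂ ih) j))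
... | yes (p , α≢0) = c′ , (punchIn p (proj₁ c≢0) , nonzero) , balanced
  where
  open ≡-Reasoning
  α = V p zero
  U : Fin (suc (d ℕ.+ k)) → Vector ℤ (suc d)
  U i = V (punchIn p i)
  ih = dependence d k (λ i j → α ℤ.* U i (suc j) ℤ.- V p (suc j) ℤ.* U i zero)
  c = proj₁ ih
  c≢0 = proj₁ (proj₂ ih)
  β = ℤ.- (c ∙ (λ i → U i zero))
  c′ : Vector ℤ (suc (suc (d ℕ.+ k)))
  c′ = insertAt (λ i → α ℤ.* c i) p β
  nonzero : c′ (punchIn p (proj₁ c≢0)) ≢ 0ℤ
  nonzero e = proj₂ c≢0 (*≡0⇒≡0 α (c (proj₁ c≢0)) α≢0
    (trans (sym (insertAt-punchIn (λ i → α ℤ.* c i) p β (proj₁ c≢0))) e))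
  expand : ∀ x → c′ ∙ x ≡ β ℤ.* x p ℤ.+ α ℤ.* (c ∙ removeAt x p)
  expand x = trans (∑-remove p (λ i → c′ i ℤ.* x i)) (cong₂ ℤ._+_
    (cong (ℤ._* x p) (insertAt-lookup (λ i → α ℤ.* c i) p β))
    (trans (∙-cong (removeAt x p) (insertAt-punchIn (λ i → α ℤ.* c i) p β)) (∙-*ˡ α c (removeAt x p))))
  cancel : ∀ s a → ℤ.- s ℤ.* a ℤ.+ a ℤ.* s ≡ 0ℤ
  cancel = solve-ℤ
  distrib : ∀ c a u v w → c ℤ.* (a ℤ.* u ℤ.- v ℤ.* w) ≡ a ℤ.* (c ℤ.* u) ℤ.- v ℤ.* (c ℤ.* w)
  distrib = solve-ℤ
  swap : ∀ s v t → ℤ.- s ℤ.* v ℤ.+ t ≡ t ℤ.- v ℤ.* s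
  swap = solve-ℤ
  balanced : ∀ j → c′ ∙ (λ i → V i j) ≡ 0ℤ
  balanced zero = trans (expand (λ i → V i zero)) (cancel (c ∙ (λ i → U i zero)) α)
  balanced (suc j) = begin
    c′ ∙ (λ i → V i (suc j)) ≡⟨ expand (λ i → V i (suc j)) ⟩
    β ℤ.* v ℤ.+ α ℤ.* (c ∙ (λ i → U i (suc j))) ≡⟨ swap (c ∙ (λ i → U i zero)) v (α ℤ.* (c ∙ (λ i → U i (suc j)))) ⟩
    α ℤ.* (c ∙ (λ i → U i (suc j))) ℤ.- v ℤ.* (c ∙ (λ i → U i zero))
      ≡⟨ ∑-lin α v (λ i → c i ℤ.* U i (suc j)) (λ i → c i ℤ.* U i zero) ⟨
    ∑ (λ i → α ℤ.* (c i ℤ.* U i (suc j)) ℤ.- v ℤ.* (c i ℤ.* U i zero))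
      ≡⟨ ∑-cong (λ i → distrib (c i) α (U i (suc j)) v (U i zero)) ⟨
    c ∙ (λ i → α ℤ.* U i (suc j) ℤ.- v ℤ.* U i zero) ≡⟨ proj₂ (proj₂ ih) j ⟩
    0ℤ ∎
    where v = V p (suc j)

-- The ratio test of the simplex method: i maximizes cᵢ / wᵢ among the positive weights. The sign
-- condition on c makes the cross-multiplied inequality hold at indices of weight 0 as well.
maxRatio : ∀ {n} (w c : Vector ℤ n) → (∀ i → 0ℤ ℤ.≤ w i) → (∀ i → w i ≡ 0ℤ → c i ℤ.≤ 0ℤ) →
  (∃[ i ] (0ℤ ℤ.< w i × (∀ j → w i ℤ.* c j ℤ.≤ c i ℤ.* w j))) ⊎ (∀ i → w i ≡ 0ℤ)
maxRatio {zero} w c w≥0 supp = inj₂ λ ()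
maxRatio {suc n} w c w≥0 supp with w zero ℤ.≟ 0ℤ | maxRatio (tail w) (tail c) (w≥0 ∘ suc) (supp ∘ suc)
... | yes z | inj₂ zs = inj₂ λ { zero → z ; (suc i) → zs i }
... | yes z | inj₁ (i , p , max) = inj₁ (suc i , p , λ { zero → below ; (suc j) → max j })
  where
  below : w (suc i) ℤ.* c zero ℤ.≤ c (suc i) ℤ.* w zero
  below = subst₂ ℤ._≤_ refl (trans (ℤP.*-zeroʳ (w (suc i)))
    (sym (trans (cong (c (suc i) ℤ.*_) z) (ℤP.*-zeroʳ (c (suc i))))))
    (ℤP.*-monoˡ-≤-nonNeg (w (suc i)) {{ℤ.nonNegative (w≥0 (suc i))}} (supp zero z))
... | no nz | inj₂ zs = inj₁ (zero , ℤP.≤∧≢⇒< (w≥0 zero) (nz ∘ sym) , λ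
  { zero → ℤP.≤-reflexive (ℤP.*-comm (w zero) (c zero)) ; (suc j) → below j })
  where
  below : ∀ j → w zero ℤ.* c (suc j) ℤ.≤ c zero ℤ.* w (suc j)
  below j = subst₂ ℤ._≤_ refl (trans (ℤP.*-zeroʳ (w zero))
    (sym (trans (cong (c zero ℤ.*_) (zs j)) (ℤP.*-zeroʳ (c zero)))))
    (ℤP.*-monoˡ-≤-nonNeg (w zero) {{ℤ.nonNegative (w≥0 zero)}} (supp (suc j) (zs j)))
... | no nz | inj₁ (i , p , max) with w (suc i) ℤ.* c zero ℤ.≤? c (suc i) ℤ.* w zero
...   | yes le = inj₁ (suc i , p , λ { zero → le ; (suc j) → max j })
...   | no gt = inj₁ (zero , w₀>0 , λ { zero → ℤP.≤-reflexive (ℤP.*-comm (w zero) (c zero)) ; (suc j) → below j })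
  where
  open ℤP.≤-Reasoning
  w₀>0 = ℤP.≤∧≢⇒< (w≥0 zero) (nz ∘ sym)
  wᵢ = w (suc i)
  cᵢ = c (suc i)
  a-comm : ∀ a b c → a ℤ.* (b ℤ.* c) ≡ b ℤ.* (a ℤ.* c)
  a-comm = solve-ℤ
  b-comm : ∀ a b c → a ℤ.* (b ℤ.* c) ≡ (b ℤ.* a) ℤ.* c
  b-comm = solve-ℤ
  below : ∀ j → w zero ℤ.* c (suc j) ℤ.≤ c zero ℤ.* w (suc j)
  below j = ℤP.*-cancelˡ-≤-pos _ _ wᵢ {{ℤ.positive p}} (begin
    wᵢ ℤ.* (w zero ℤ.* c (suc j)) ≡⟨ a-comm wᵢ (w zero) _ ⟩
    w zero ℤ.* (wᵢ ℤ.* c (suc j)) ≤⟨ ℤP.*-monoˡ-≤-nonNeg (w zero) {{ℤ.nonNegative (w≥0 zero)}} (max j) ⟩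
    w zero ℤ.* (cᵢ ℤ.* w (suc j)) ≡⟨ b-comm (w zero) cᵢ _ ⟩
    (cᵢ ℤ.* w zero) ℤ.* w (suc j)
      ≤⟨ ℤP.*-monoʳ-≤-nonNeg (w (suc j)) {{ℤ.nonNegative (w≥0 (suc j))}} (ℤP.<⇒≤ (ℤP.≰⇒> gt)) ⟩
    (wᵢ ℤ.* c zero) ℤ.* w (suc j) ≡⟨ ℤP.*-assoc wᵢ _ _ ⟩
    wᵢ ℤ.* (c zero ℤ.* w (suc j)) ∎)

-- If c ≡ κ w modulo g, then cᵢ w - wᵢ c is divisible by g; for i maximizing
-- cᵢ / wᵢ the quotient is a nonnegative vector vanishing at i.
record Exchange {n} (w c f : Vector ℤ n) (g : ℤ) : Set where
  field
    pivot : Fin n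
  quotient : Vector ℤ n
  quotient i = w pivot ℤ.* f i ℤ.- f pivot ℤ.* w i
  field
    w>0 : 0ℤ ℤ.< w pivot
    c>0 : 0ℤ ℤ.< c pivot
    quotient≥0 : ∀ i → 0ℤ ℤ.≤ quotient i
    g*quotient : ∀ i → g ℤ.* quotient i ≡ c pivot ℤ.* w i ℤ.- w pivot ℤ.* c i

  quotient-pivot : quotient pivot ≡ 0ℤ
  quotient-pivot = zeroes (w pivot) (f pivot)
    where zeroes : ∀ a b → a ℤ.* b ℤ.- b ℤ.* a ≡ 0ℤ
          zeroes = solve-ℤ

  g*quotient∙ : ∀ x → g ℤ.* (quotient ∙ x) ≡ c pivot ℤ.* (w ∙ x) ℤ.- w pivot ℤ.* (c ∙ x)
  g*quotient∙ x = begin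
    g ℤ.* (quotient ∙ x) ≡⟨ ∙-*ˡ g quotient x ⟨
    (λ i → g ℤ.* quotient i) ∙ x ≡⟨ ∙-cong x g*quotient ⟩
    (λ i → c pivot ℤ.* w i ℤ.- w pivot ℤ.* c i) ∙ x ≡⟨ ∙-lin (c pivot) (w pivot) w c x ⟩
    c pivot ℤ.* (w ∙ x) ℤ.- w pivot ℤ.* (c ∙ x) ∎
    where open ≡-Reasoning

exchange : ∀ {n} {w c f : Vector ℤ n} {g} κ → 0ℤ ℤ.< g → (∀ i → c i ≡ κ ℤ.* w i ℤ.- f i ℤ.* g) →
  (∀ i → 0ℤ ℤ.≤ w i) → (∀ i → w i ≡ 0ℤ → c i ℤ.≤ 0ℤ) → (∃[ i ] 0ℤ ℤ.< c i) → Exchange w c f g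
exchange {w = w} {c} {f} {g} κ g>0 c≡ w≥0 supp (k , ck>0) with maxRatio w c w≥0 supp
... | inj₂ zs = contradiction ck>0 (ℤP.≤⇒≯ (supp k (zs k)))
... | inj₁ (p , wp>0 , max) = record
  { pivot = p ; w>0 = wp>0
  ; c>0 = 0<*⁻¹ (w≥0 k) (subst (0ℤ ℤ.<_) (ℤP.*-comm (c p) (w k)) (ℤP.<-≤-trans (0<* wp>0 ck>0) (max k)))
  ; quotient≥0 = λ i → 0≤*⁻¹ g>0 (subst (0ℤ ℤ.≤_) (sym (g*q i)) (ℤP.i≤j⇒0≤j-i (max i)))
  ; g*quotient = g*q }
  where
  identity : ∀ κ g u f v e → g ℤ.* (u ℤ.* f ℤ.- e ℤ.* v) ≡
    (κ ℤ.* u ℤ.- e ℤ.* g) ℤ.* v ℤ.- u ℤ.* (κ ℤ.* v ℤ.- f ℤ.* g)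
  identity = solve-ℤ
  g*q : ∀ i → g ℤ.* (w p ℤ.* f i ℤ.- f p ℤ.* w i) ≡ c p ℤ.* w i ℤ.- w p ℤ.* c i
  g*q i = trans (identity κ g (w p) (f i) (w i) (f p))
    (sym (cong₂ (λ x y → x ℤ.* w i ℤ.- w p ℤ.* y) (c≡ p) (c≡ i)))

positive-entry : ∀ {n} {c : Vector ℤ n} → ∑ c ≡ 0ℤ → (∃[ i ] c i ≢ 0ℤ) → ∃[ i ] 0ℤ ℤ.< c i
positive-entry {n} {c} Σ≡0 (k , ck≢0) with FinP.any? (λ i → 0ℤ ℤ.<? c i)
... | yes p = p
... | no ∄ = contradiction (ℤP.≤-antisym (c≤0 k) 0≤ck) ck≢0
  where
  c≤0 : ∀ i → c i ℤ.≤ 0ℤ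
  c≤0 i = ℤP.≮⇒≥ (λ p → ∄ (i , p))
  Σ-neg : ∑ (λ i → 0ℤ ℤ.* c i ℤ.- 1ℤ ℤ.* c i) ≡ 0ℤ
  Σ-neg = trans (∑-lin 0ℤ 1ℤ c c) (cong (λ s → 0ℤ ℤ.* s ℤ.- 1ℤ ℤ.* s) Σ≡0)
  neg : ∀ x → 0ℤ ℤ.* x ℤ.- 1ℤ ℤ.* x ≡ ℤ.- x
  neg = solve-ℤ
  0≤ck : 0ℤ ℤ.≤ c k
  0≤ck = ℤP.neg-cancel-≤ (subst (ℤ._≤ 0ℤ) (neg (c k)) (subst (_ ℤ.≤_) Σ-neg
    (≤-∑ (λ i → subst (0ℤ ℤ.≤_) (sym (neg (c i))) (ℤP.neg-mono-≤ (c≤0 i))) k)))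

-- Balanced weights on covectors

-- Jensen's inequality at those barycentres b that are lattice points, with denominators cleared.
Concave : (Covector 3 → ℤ) → Set
Concave φ = ∀ {n} (m : Vector ℤ n) (A : Fin n → Covector 3) b → (∀ i → 0ℤ ℤ.≤ m i) → 0ℤ ℤ.< ∑ m →
  (∀ j → ∑ m ℤ.* b j ≡ m ∙ (λ i → A i j)) → m ∙ (φ ∘ A) ℤ.≤ ∑ m ℤ.* φ b

-- An infeasibility certificate in the sense of Farkas: if φ a ≤ ⟨ a , x ⟩ held for all nonzero a,
-- the weighted sum of these inequalities would have a positive left side and the right side 0.
record Cert (φ : Covector 3 → ℤ) (n : ℕ) : Set where
  field
    vectors  : Fin n → Covector 3
    weight   : Vector ℤ n
    nonzero  : ∀ i → Nonzero (vectors i)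
    weight≥0 : ∀ i → 0ℤ ℤ.≤ weight i
    balanced : ∀ j → weight ∙ (λ i → vectors i j) ≡ 0ℤ
    positive : 0ℤ ℤ.< weight ∙ (φ ∘ vectors)

module _ {φ : Covector 3 → ℤ} where

  open Cert

  drop : ∀ {n} (C : Cert φ (suc n)) i → weight C i ≡ 0ℤ → Cert φ n
  drop C i z = record
    { vectors = removeAt (vectors C) i ; weight = removeAt (weight C) i
    ; nonzero = λ k → nonzero C (punchIn i k) ; weight≥0 = λ k → weight≥0 C (punchIn i k)
    ; balanced = λ j → trans (removed (λ k → vectors C k j)) (balanced C j)
    ; positive = subst (0ℤ ℤ.<_) (sym (removed (φ ∘ vectors C))) (positive C) }
    where
    removed : ∀ x → removeAt (weight C) i ∙ removeAt x i ≡ weight C ∙ x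
    removed x = ∑-removed (λ k → weight C k ℤ.* x k) i (cong (ℤ._* x i) z)

  module _ {n} (C : Cert φ n) {c : Vector ℤ n} (f : Vector ℤ n) {g} (κ : ℤ) (g>0 : 0ℤ ℤ.< g)
    (c≡ : ∀ i → c i ≡ κ ℤ.* weight C i ℤ.- f i ℤ.* g)
    (supp : ∀ i → weight C i ≡ 0ℤ → c i ℤ.≤ 0ℤ) (c>0 : ∃[ i ] 0ℤ ℤ.< c i)
    (c-balanced : ∀ j → c ∙ (λ i → vectors C i j) ≡ 0ℤ)
    (c-φ : c ∙ (φ ∘ vectors C) ℤ.≤ 0ℤ) where

    exch : Exchange (weight C) c f g
    exch = exchange κ g>0 c≡ (weight≥0 C) supp c>0

    open Exchange exch using (pivot; quotient; quotient≥0; g*quotient∙) renaming (c>0 to cp>0; w>0 to wp>0)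

    -- Subtracting a positive multiple of a relation c with c ∙ φ ≤ 0 does not decrease the sum of
    -- the φ-values. The multiple w_p / c_p at the pivot p is the largest one that leaves all
    -- weights nonnegative; scaling by c_p / g makes the result integral.
    exchangeCert : Cert φ n
    exchangeCert = record
      { vectors = vectors C ; weight = quotient ; nonzero = nonzero C ; weight≥0 = quotient≥0
      ; balanced = λ j → cancel-pos g>0 (begin
          g ℤ.* (quotient ∙ (λ i → vectors C i j)) ≡⟨ g*quotient∙ (λ i → vectors C i j) ⟩
          c pivot ℤ.* (weight C ∙ (λ i → vectors C i j)) ℤ.- weight C pivot ℤ.* (c ∙ (λ i → vectors C i j))
            ≡⟨ cong₂ (λ x y → c pivot ℤ.* x ℤ.- weight C pivot ℤ.* y) (balanced C j) (c-balanced j) ⟩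
          c pivot ℤ.* 0ℤ ℤ.- weight C pivot ℤ.* 0ℤ ≡⟨ zeroes (c pivot) (weight C pivot) g ⟩
          g ℤ.* 0ℤ ∎)
      ; positive = 0<*⁻¹ (ℤP.<⇒≤ g>0) (subst (0ℤ ℤ.<_) (sym (g*quotient∙ (φ ∘ vectors C)))
          (ℤP.<-≤-trans (0<* cp>0 (positive C))
            (drop-nonpos _ (weight C pivot) (c ∙ (φ ∘ vectors C)) (0≤* (ℤP.<⇒≤ wp>0) (ℤP.neg-mono-≤ c-φ))))) }
      where
      open ≡-Reasoning
      zeroes : ∀ a b g → a ℤ.* 0ℤ ℤ.- b ℤ.* 0ℤ ≡ g ℤ.* 0ℤ
      zeroes = solve-ℤ
      rearrange : ∀ x a b → x ℤ.+ a ℤ.* (ℤ.- b) ≡ x ℤ.- a ℤ.* b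
      rearrange = solve-ℤ
      drop-nonpos : ∀ x a b → 0ℤ ℤ.≤ a ℤ.* (ℤ.- b) → x ℤ.≤ x ℤ.- a ℤ.* b
      drop-nonpos x a b p = subst₂ ℤ._≤_ (ℤP.+-identityʳ x) (rearrange x a b) (ℤP.+-monoʳ-≤ x p)

    total-exchangeCert : g ℤ.* ∑ quotient ≡ c pivot ℤ.* ∑ (weight C) ℤ.- weight C pivot ℤ.* ∑ c
    total-exchangeCert = begin
      g ℤ.* ∑ quotient ≡⟨ cong (g ℤ.*_) (∙-1 quotient) ⟨
      g ℤ.* (quotient ∙ const 1ℤ) ≡⟨ g*quotient∙ (const 1ℤ) ⟩
      c pivot ℤ.* (weight C ∙ const 1ℤ) ℤ.- weight C pivot ℤ.* (c ∙ const 1ℤ)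
        ≡⟨ cong₂ (λ x y → c pivot ℤ.* x ℤ.- weight C pivot ℤ.* y) (∙-1 (weight C)) (∙-1 c) ⟩
      c pivot ℤ.* ∑ (weight C) ℤ.- weight C pivot ℤ.* ∑ c ∎
      where open ≡-Reasoning

  -- Carathéodory: an affine relation among five or more vectors lets one of them be dropped.
  caratheodory-step : ∀ {k} → Cert φ (5 ℕ.+ k) → Cert φ (4 ℕ.+ k)
  caratheodory-step {k} C with FinP.any? (λ i → weight C i ℤ.≟ 0ℤ)
  ... | yes (i , z) = drop C i z
  ... | no none = eliminate (c ∙ (φ ∘ vectors C) ℤ.≤? 0ℤ)
    where
    -- The prepended 1 forces the coefficients to sum to 0. So c is not proportional to the weights,
    -- and both c and - c have a positive entry, which leaves the sign free to be chosen by the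
    -- value on φ.
    dep = dependence 4 k (λ i → 1ℤ ∷ᵛ vectors C i)
    c = proj₁ dep
    Σc≡0 : ∑ c ≡ 0ℤ
    Σc≡0 = trans (sym (∙-1 c)) (proj₂ (proj₂ dep) 0F)
    c-balanced : ∀ j → c ∙ (λ i → vectors C i j) ≡ 0ℤ
    c-balanced j = proj₂ (proj₂ dep) (suc j)
    c′ : Vector ℤ (5 ℕ.+ k)
    c′ i = ℤ.- 1ℤ ℤ.* c i
    Σc′≡0 : ∑ c′ ≡ 0ℤ
    Σc′≡0 = trans (∑-* (ℤ.- 1ℤ) c) (cong (ℤ.- 1ℤ ℤ.*_) Σc≡0)
    trivially : ∀ w c → c ≡ 0ℤ ℤ.* w ℤ.- (ℤ.- c) ℤ.* 1ℤ
    trivially = solve-ℤ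
    1>0 : 0ℤ ℤ.< 1ℤ
    1>0 = ℤ.+<+ (ℕ.s≤s ℕ.z≤n)
    by : (c : Vector ℤ (5 ℕ.+ k)) → ∑ c ≡ 0ℤ → (∃[ i ] c i ≢ 0ℤ) →
      (∀ j → c ∙ (λ i → vectors C i j) ≡ 0ℤ) → c ∙ (φ ∘ vectors C) ℤ.≤ 0ℤ → Cert φ (4 ℕ.+ k)
    by c Σ≡0 c≢0 bal neg = drop (exchangeCert C (λ i → ℤ.- c i) 0ℤ 1>0 c≡ supp pos bal neg) pivot quotient-pivot
      where
      c≡ : ∀ i → c i ≡ 0ℤ ℤ.* weight C i ℤ.- (ℤ.- c i) ℤ.* 1ℤ
      c≡ i = trivially (weight C i) (c i)
      supp : ∀ i → weight C i ≡ 0ℤ → c i ℤ.≤ 0ℤ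
      supp i z = contradiction (i , z) none
      pos = positive-entry Σ≡0 c≢0
      open Exchange (exch C (λ i → ℤ.- c i) 0ℤ 1>0 c≡ supp pos bal neg)
    eliminate : Dec (c ∙ (φ ∘ vectors C) ℤ.≤ 0ℤ) → Cert φ (4 ℕ.+ k)
    eliminate (yes p) = by c Σc≡0 (proj₁ (proj₂ dep)) c-balanced p
    eliminate (no ¬p) = by c′ Σc′≡0
      (proj₁ (proj₁ (proj₂ dep)) , λ z → proj₂ (proj₁ (proj₂ dep))
        (*≡0⇒≡0 (ℤ.- 1ℤ) (c (proj₁ (proj₁ (proj₂ dep)))) (λ ()) z))
      (λ j → trans (∙-*ˡ (ℤ.- 1ℤ) c (λ i → vectors C i j)) (cong (ℤ.- 1ℤ ℤ.*_) (c-balanced j)))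
      (subst (ℤ._≤ 0ℤ) (sym (trans (∙-*ˡ (ℤ.- 1ℤ) c (φ ∘ vectors C)) (ℤP.-1*i≡-i _)))
        (ℤP.neg-mono-≤ (ℤP.<⇒≤ (ℤP.≰⇒> ¬p))))

  caratheodory : ∀ k → Cert φ (4 ℕ.+ k) → Cert φ 4
  caratheodory zero C = C
  caratheodory (suc k) C = caratheodory k (caratheodory-step C)

  add-vector : ∀ {n} → Cert φ n → ∀ {a} → Nonzero a → Cert φ (suc n)
  add-vector C {a} a≢0 = record
    { vectors = a ∷ᵛ vectors C ; weight = 0ℤ ∷ᵛ weight C
    ; nonzero = λ { zero → a≢0 ; (suc i) → nonzero C i }
    ; weight≥0 = λ { zero → ℤP.≤-refl ; (suc i) → weight≥0 C i }
    ; balanced = λ j → trans (extended (λ i → (a ∷ᵛ vectors C) i j)) (balanced C j)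
    ; positive = subst (0ℤ ℤ.<_) (sym (extended (φ ∘ (a ∷ᵛ vectors C)))) (positive C) }
    where
    extended : ∀ x → (0ℤ ∷ᵛ weight C) ∙ x ≡ weight C ∙ tail x
    extended x = trans (∑-suc (λ i → (0ℤ ∷ᵛ weight C) i ℤ.* x i)) (ℤP.+-identityˡ _)

  total≥0 : ∀ {n} (C : Cert φ n) → 0ℤ ℤ.≤ ∑ (weight C)
  total≥0 C = ∑-nonneg (weight≥0 C)

  total≢0 : ∀ {n} (C : Cert φ n) → ∑ (weight C) ≢ 0ℤ
  total≢0 C Σ≡0 = <⇒≢0 (positive C) (∑-zero λ i → cong (ℤ._* φ (vectors C i))
    (ℤP.≤-antisym (ℤP.≤-trans (≤-∑ (weight≥0 C) i) (ℤP.≤-reflexive Σ≡0)) (weight≥0 C i)))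

  module _ (C : Cert φ 4) (l : Weights) (w≡l : ∀ i → weight C i ≡ + l i) where

    ∑-total : ∀ (l : Weights) → ∑ (λ i → + l i) ≡ + total l
    ∑-total l = trans (trans (∑-suc _) (cong (ℤ._+_ (+ l 0F)) (trans (∑-suc _) (cong (ℤ._+_ (+ l 1F))
      (trans (∑-suc _) (cong (ℤ._+_ (+ l 2F))
        (trans (∑-suc _) (trans (cong (ℤ._+_ (+ l 3F)) (∑-nil _)) (ℤP.+-identityʳ (+ l 3F))))))))))
      (cong +_ (assoc (l 0F) (l 1F) (l 2F) (l 3F)))
      where
      assoc : ∀ a b c d → a ℕ.+ (b ℕ.+ (c ℕ.+ d)) ≡ a ℕ.+ b ℕ.+ c ℕ.+ d
      assoc a b c d = trans (sym (ℕP.+-assoc a b (c ℕ.+ d))) (sym (ℕP.+-assoc (a ℕ.+ b) c d))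

    ∑-weight : ∑ (weight C) ≡ + total l
    ∑-weight = trans (∑-cong w≡l) (∑-total l)

    -- A balanced relation with a single nonzero weight would force its vector to vanish.
    ¬concentrated : ∀ i → l i ≢ 0 → ¬ (∀ k → k ≢ i → l k ≡ 0)
    ¬concentrated i l≢0 others = nonzero C i (λ j → *≡0⇒≡0 (weight C i) (vectors C i j) w≢0 (begin
      weight C i ℤ.* vectors C i j ≡⟨ shift (weight C i ℤ.* vectors C i j) ⟩
      (0ℤ ℤ.- 0ℤ) ℤ.+ weight C i ℤ.* vectors C i j
        ≡⟨ cong (λ x → (x ℤ.- 0ℤ) ℤ.+ weight C i ℤ.* vectors C i j) (∑-zero {4} {λ _ → 0ℤ} (λ _ → refl)) ⟨
      (∑ {4} (λ _ → 0ℤ) ℤ.- 0ℤ) ℤ.+ weight C i ℤ.* vectors C i j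
        ≡⟨ ∑-change {u = λ _ → 0ℤ} i (λ k k≢i → cong (ℤ._* vectors C k j) (trans (w≡l k) (cong +_ (others k k≢i))))
        ⟨
      weight C ∙ (λ k → vectors C k j) ≡⟨ balanced C j ⟩
      0ℤ ∎))
      where
      open ≡-Reasoning
      w≢0 : weight C i ≢ 0ℤ
      w≢0 e = l≢0 (ℤP.+-injective (trans (sym (w≡l i)) e))
      shift : ∀ x → x ≡ (0ℤ ℤ.- 0ℤ) ℤ.+ x
      shift = solve-ℤ

    total≢1 : total l ≢ 1
    total≢1 e with oneUp {λ _ → 0} {l} (λ _ → ℕ.z≤n) e
    ... | one-up i l≡1 others = ¬concentrated i (λ z → contradiction (trans (sym l≡1) z) λ ()) others

    divide : ((g , _) : CommonDivisor l) → Σ[ C′ ∈ Cert φ 4 ] (+ g ℤ.* ∑ (weight C′) ≡ ∑ (weight C))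
    divide (g , 2≤g , g∣l) = record
      { vectors = vectors C ; weight = v ; nonzero = nonzero C
      ; weight≥0 = λ i → ℤ.+≤+ ℕ.z≤n
      ; balanced = λ j → cancel-pos g>0
        (trans (g*v∙ (λ i → vectors C i j)) (trans (balanced C j) (sym (ℤP.*-zeroʳ (+ g)))))
      ; positive = 0<*⁻¹ (ℤP.<⇒≤ g>0) (subst (0ℤ ℤ.<_) (sym (g*v∙ (φ ∘ vectors C))) (positive C)) }
      , trans (sym (∑-* (+ g) v)) (∑-cong g*v)
      where
      g>0 : 0ℤ ℤ.< + g
      g>0 = ℤ.+<+ (ℕP.≤-trans (ℕ.s≤s ℕ.z≤n) 2≤g)
      v : Vector ℤ 4
      v i = + _∣_.quotient (g∣l i)
      g*v : ∀ i → + g ℤ.* v i ≡ weight C i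
      g*v i = trans (sym (ℤP.pos-* g (_∣_.quotient (g∣l i))))
        (trans (cong +_ (trans (ℕP.*-comm g _) (sym (_∣_.equality (g∣l i))))) (sym (w≡l i)))
      g*v∙ : ∀ x → + g ℤ.* (v ∙ x) ≡ weight C ∙ x
      g*v∙ x = trans (sym (∙-*ˡ (+ g) v x)) (∙-cong x g*v)

    module _ (concave : Concave φ) (l≢0 : total l ≢ 0) (split : Split (total l) l) where
      open Split split using (κ; f; total-m; m<h; m≢l; supported) renaming (m to mℕ; m≡κl-fh to spec)

      private
        h : ℤ
        h = + total l
        w m : Vector ℤ 4
        w = weight C
        m i = + mℕ i
        vs : Fin 3 → Vector ℤ 4
        vs j i = vectors C i j

        h>0 : 0ℤ ℤ.< h
        h>0 = ℤ.+<+ (ℕP.n≢0⇒n>0 l≢0)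

        m≡ : ∀ i → m i ≡ κ ℤ.* w i ℤ.- f i ℤ.* h
        m≡ i = trans (spec i) (cong (λ x → κ ℤ.* x ℤ.- f i ℤ.* h) (sym (w≡l i)))

        Σm : ∑ m ≡ h
        Σm = trans (∑-total mℕ) (cong +_ total-m)

        w≡0⇒m≡0 : ∀ i → w i ≡ 0ℤ → m i ≡ 0ℤ
        w≡0⇒m≡0 i z = cong +_ (supported i (ℤP.+-injective (trans (sym (w≡l i)) z)))

        b : Covector 3
        b j = ℤ.- (f ∙ vs j)

        h*b : ∀ j → h ℤ.* b j ≡ m ∙ vs j
        h*b j = begin
          h ℤ.* b j ≡⟨ identity κ h (f ∙ vs j) ⟩
          κ ℤ.* 0ℤ ℤ.- h ℤ.* (f ∙ vs j) ≡⟨ cong (λ x → κ ℤ.* x ℤ.- h ℤ.* (f ∙ vs j)) (balanced C j) ⟨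
          κ ℤ.* (w ∙ vs j) ℤ.- h ℤ.* (f ∙ vs j) ≡⟨ ∙-lin κ h w f (vs j) ⟨
          (λ i → κ ℤ.* w i ℤ.- h ℤ.* f i) ∙ vs j
            ≡⟨ ∙-cong (vs j) (λ i → trans (cong (λ x → κ ℤ.* w i ℤ.- x) (ℤP.*-comm h (f i))) (sym (m≡ i))) ⟩
          m ∙ vs j ∎
          where
          open ≡-Reasoning
          identity : ∀ κ h f → h ℤ.* (ℤ.- f) ≡ κ ℤ.* 0ℤ ℤ.- h ℤ.* f
          identity = solve-ℤ

        m-positive : ∃[ i ] 0ℤ ℤ.< m i
        m-positive with FinP.any? (λ i → 0ℤ ℤ.<? m i)
        ... | yes p = p
        ... | no ∄ = contradiction (trans (sym Σm)
          (∑-zero λ i → ℤP.≤-antisym (ℤP.≮⇒≥ (λ p → ∄ (i , p))) (ℤ.+≤+ ℕ.z≤n))) (<⇒≢0 h>0)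

        -- For the quotient q at the pivot p, Σ qᵢ aᵢ = - w_p b, so b with weight w_p in the place
        -- of a_p restores balance. The new total is (m_p - w_p) + w_p = m_p < h. Concavity bounds Σ
        -- mᵢ φ(aᵢ) by h φ(b), hence h times the new sum of φ-values is at least m_p times the old
        -- one, and positivity survives.
        replace : Nonzero b → Exchange w m f h → Σ[ C′ ∈ Cert φ 4 ] ∑ (weight C′) ℤ.< h
        replace b≢0 e = record
          { vectors = A ; weight = v
          ; nonzero = λ i → nonzero′ i (i Fin.≟ pivot)
          ; weight≥0 = λ i → v≥0 i (i Fin.≟ pivot)
          ; balanced = λ j → cancel-pos h>0 (begin
              h ℤ.* (v ∙ (λ i → A i j)) ≡⟨ h*v∙ (λ a → a j) ⟩
              (m p ℤ.* (w ∙ vs j) ℤ.- w p ℤ.* (m ∙ vs j)) ℤ.+ w p ℤ.* (h ℤ.* b j)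
                ≡⟨ cong₂ (λ x y → (m p ℤ.* x ℤ.- w p ℤ.* (m ∙ vs j)) ℤ.+ w p ℤ.* y) (balanced C j) (h*b j) ⟩
              (m p ℤ.* 0ℤ ℤ.- w p ℤ.* (m ∙ vs j)) ℤ.+ w p ℤ.* (m ∙ vs j) ≡⟨ vanish (m p) (w p) (m ∙ vs j) h ⟩
              h ℤ.* 0ℤ ∎)
          ; positive = 0<*⁻¹ (ℤP.<⇒≤ h>0) (subst (0ℤ ℤ.<_) (sym (h*v∙ φ))
              (ℤP.<-≤-trans (0<* c>0 (positive C)) (subst (m p ℤ.* (w ∙ (φ ∘ vectors C)) ℤ.≤_)
                (regroup (m p ℤ.* (w ∙ (φ ∘ vectors C))) (w p) (h ℤ.* φ b) (m ∙ (φ ∘ vectors C)))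
                (below (0≤* (ℤP.<⇒≤ w>0) (ℤP.i≤j⇒0≤j-i φ-concave))))))
          } , subst (ℤ._< h) (sym Σv≡mp) (ℤ.+<+ (m<h p))
          where
          open ≡-Reasoning
          open Exchange e
          p = pivot
          A : Fin 4 → Covector 3
          A = updateAt (vectors C) p (const b)
          v : Vector ℤ 4
          v = updateAt quotient p (const (w p))
          v-p : v p ≡ w p
          v-p = updateAt-updates p quotient
          A-p : A p ≡ b
          A-p = updateAt-updates p (vectors C)
          nonzero′ : ∀ i → Dec (i ≡ p) → Nonzero (A i)
          nonzero′ i (yes refl) = subst Nonzero (sym A-p) b≢0
          nonzero′ i (no i≢p) = subst Nonzero (sym (updateAt-minimal i p (vectors C) i≢p)) (nonzero C i)
          v≥0 : ∀ i → Dec (i ≡ p) → 0ℤ ℤ.≤ v i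
          v≥0 i (yes refl) = subst (0ℤ ℤ.≤_) (sym v-p) (ℤP.<⇒≤ w>0)
          v≥0 i (no i≢p) = subst (0ℤ ℤ.≤_) (sym (updateAt-minimal i p quotient i≢p)) (quotient≥0 i)
          drop0 : ∀ s y x → (s ℤ.- 0ℤ ℤ.* y) ℤ.+ x ≡ s ℤ.+ x
          drop0 = solve-ℤ
          v∙ : (F : Covector 3 → ℤ) → v ∙ (F ∘ A) ≡ quotient ∙ (F ∘ vectors C) ℤ.+ w p ℤ.* F b
          v∙ F = begin
            v ∙ (F ∘ A) ≡⟨ ∑-change {u = λ i → quotient i ℤ.* F (vectors C i)} p
              (λ i i≢p → cong₂ ℤ._*_ (updateAt-minimal i p quotient i≢p)
              (cong F (updateAt-minimal i p (vectors C) i≢p))) ⟩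
            (quotient ∙ (F ∘ vectors C) ℤ.- quotient p ℤ.* F (vectors C p)) ℤ.+ v p ℤ.* F (A p)
              ≡⟨ cong₂ (λ x y → (quotient ∙ (F ∘ vectors C) ℤ.- x ℤ.* F (vectors C p)) ℤ.+ y) quotient-pivot
                (cong₂ (λ x a → x ℤ.* F a) v-p A-p) ⟩
            (quotient ∙ (F ∘ vectors C) ℤ.- 0ℤ ℤ.* F (vectors C p)) ℤ.+ w p ℤ.* F b
              ≡⟨ drop0 (quotient ∙ (F ∘ vectors C)) (F (vectors C p)) (w p ℤ.* F b) ⟩
            quotient ∙ (F ∘ vectors C) ℤ.+ w p ℤ.* F b ∎
          distrib : ∀ h q w x → h ℤ.* (q ℤ.+ w ℤ.* x) ≡ h ℤ.* q ℤ.+ w ℤ.* (h ℤ.* x)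
          distrib = solve-ℤ
          h*v∙ : (F : Covector 3 → ℤ) → h ℤ.* (v ∙ (F ∘ A)) ≡
            (m p ℤ.* (w ∙ (F ∘ vectors C)) ℤ.- w p ℤ.* (m ∙ (F ∘ vectors C))) ℤ.+ w p ℤ.* (h ℤ.* F b)
          h*v∙ F = trans (cong (h ℤ.*_) (v∙ F)) (trans (distrib h (quotient ∙ (F ∘ vectors C)) (w p) (F b))
            (cong (ℤ._+ w p ℤ.* (h ℤ.* F b)) (g*quotient∙ (F ∘ vectors C))))
          vanish : ∀ a w x h → (a ℤ.* 0ℤ ℤ.- w ℤ.* x) ℤ.+ w ℤ.* x ≡ h ℤ.* 0ℤ
          vanish = solve-ℤ
          regroup : ∀ x a s t → x ℤ.+ a ℤ.* (s ℤ.- t) ≡ (x ℤ.- a ℤ.* t) ℤ.+ a ℤ.* s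
          regroup = solve-ℤ
          below : ∀ {x y} → 0ℤ ℤ.≤ y → x ℤ.≤ x ℤ.+ y
          below {x} {y} q = subst (ℤ._≤ x ℤ.+ y) (ℤP.+-identityʳ x) (ℤP.+-monoʳ-≤ x q)
          φ-concave : m ∙ (φ ∘ vectors C) ℤ.≤ h ℤ.* φ b
          φ-concave = subst (λ t → m ∙ (φ ∘ vectors C) ℤ.≤ t ℤ.* φ b) Σm
            (concave m (vectors C) b (λ _ → ℤ.+≤+ ℕ.z≤n) (subst (0ℤ ℤ.<_) (sym Σm) h>0)
              (λ j → trans (cong (ℤ._* b j) Σm) (h*b j)))
          Σv≡mp : ∑ v ≡ m p
          Σv≡mp = cancel-pos h>0 (begin
            h ℤ.* ∑ v ≡⟨ cong (h ℤ.*_) (∙-1 v) ⟨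
            h ℤ.* (v ∙ const 1ℤ) ≡⟨ h*v∙ (const 1ℤ) ⟩
            (m p ℤ.* (w ∙ const 1ℤ) ℤ.- w p ℤ.* (m ∙ const 1ℤ)) ℤ.+ w p ℤ.* (h ℤ.* 1ℤ)
              ≡⟨ cong₂ (λ x y → (m p ℤ.* x ℤ.- w p ℤ.* y) ℤ.+ w p ℤ.* (h ℤ.* 1ℤ)) (trans (∙-1 w) ∑-weight)
                (trans (∙-1 m) Σm) ⟩
            (m p ℤ.* h ℤ.- w p ℤ.* h) ℤ.+ w p ℤ.* (h ℤ.* 1ℤ) ≡⟨ finish (m p) (w p) h ⟩
            h ℤ.* m p ∎)
            where
            finish : ∀ m w h → (m ℤ.* h ℤ.- w ℤ.* h) ℤ.+ w ℤ.* (h ℤ.* 1ℤ) ≡ h ℤ.* m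
            finish = solve-ℤ

        -- If b = 0, then m is a relation as well and so is m - w, of total 0.
        shrink : (c f : Vector ℤ 4) (κ : ℤ) → (∀ i → c i ≡ κ ℤ.* w i ℤ.- f i ℤ.* h) → (∀ i → w i ≡ 0ℤ → c i ≡ 0ℤ) →
          ∑ c ≡ 0ℤ → (∃[ i ] c i ≢ 0ℤ) → (∀ i → c i ℤ.< h) → (∀ j → c ∙ vs j ≡ 0ℤ) →
          c ∙ (φ ∘ vectors C) ℤ.≤ 0ℤ → Σ[ C′ ∈ Cert φ 4 ] ∑ (weight C′) ℤ.< h
        shrink c f κ c≡ supp Σc c≢0 c<h bal neg =
          exchangeCert C f κ h>0 c≡ supp′ pos bal neg , subst (ℤ._< h) (sym Σ≡) (c<h pivot)
          where
          open ≡-Reasoning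
          supp′ : ∀ i → w i ≡ 0ℤ → c i ℤ.≤ 0ℤ
          supp′ i z = ℤP.≤-reflexive (supp i z)
          pos = positive-entry Σc c≢0
          open Exchange (exch C f κ h>0 c≡ supp′ pos bal neg) using (pivot; quotient)
          finish : ∀ c w h → c ℤ.* h ℤ.- w ℤ.* 0ℤ ≡ h ℤ.* c
          finish = solve-ℤ
          Σ≡ : ∑ quotient ≡ c pivot
          Σ≡ = cancel-pos h>0 (begin
            h ℤ.* ∑ quotient ≡⟨ total-exchangeCert C f κ h>0 c≡ supp′ pos bal neg ⟩
            c pivot ℤ.* ∑ w ℤ.- w pivot ℤ.* ∑ c ≡⟨ cong₂ (λ x y → c pivot ℤ.* x ℤ.- w pivot ℤ.* y) ∑-weight Σc ⟩
            c pivot ℤ.* h ℤ.- w pivot ℤ.* 0ℤ ≡⟨ finish (c pivot) (w pivot) h ⟩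
            h ℤ.* c pivot ∎)

        w<h : ∀ i → w i ℤ.< h
        w<h i = ℤP.≤∧≢⇒< (subst (w i ℤ.≤_) ∑-weight (≤-∑ (weight≥0 C) i)) λ w≡h → ¬concentrated i
          (λ z → l≢0 (ℤP.+-injective (trans (sym w≡h) (trans (w≡l i) (cong +_ z)))))
          (λ k k≢i → ℤP.+-injective (trans (sym (w≡l k))
            (others-zero (weight≥0 C) i (trans w≡h (sym ∑-weight)) k k≢i)))

      improve : Σ[ C′ ∈ Cert φ 4 ] ∑ (weight C′) ℤ.< h
      improve with FinP.all? (λ j → b j ℤ.≟ 0ℤ)
      ... | no b≢0 = replace b≢0 (exchange κ h>0 m≡ (weight≥0 C) (λ i z → ℤP.≤-reflexive (w≡0⇒m≡0 i z)) m-positive)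
      -- One of m - w and w - m has a nonpositive value on φ. The new total is one of its entries,
      -- which is below h because the entries of m and of w are.
      ... | yes b≡0 = [ down , up ]′ (ℤP.≤-total (m ∙ (φ ∘ vectors C)) (w ∙ (φ ∘ vectors C)))
        where
        m∙vs≡0 : ∀ j → m ∙ vs j ≡ 0ℤ
        m∙vs≡0 j = trans (sym (h*b j)) (trans (cong (h ℤ.*_) (b≡0 j)) (ℤP.*-zeroʳ h))
        diff∙ : ∀ (u v x : Vector ℤ 4) → (λ i → 1ℤ ℤ.* u i ℤ.- 1ℤ ℤ.* v i) ∙ x ≡ u ∙ x ℤ.- v ∙ x
        diff∙ u v x = trans (∙-lin 1ℤ 1ℤ u v x) (cong₂ ℤ._-_ (ℤP.*-identityˡ (u ∙ x)) (ℤP.*-identityˡ (v ∙ x)))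
        diff : Vector ℤ 4 → Vector ℤ 4 → Vector ℤ 4
        diff u v i = 1ℤ ℤ.* u i ℤ.- 1ℤ ℤ.* v i
        ∑-diff : ∀ u v → ∑ u ≡ ∑ v → ∑ (diff u v) ≡ 0ℤ
        ∑-diff u v e = trans (∑-lin 1ℤ 1ℤ u v)
          (trans (cong (λ x → 1ℤ ℤ.* x ℤ.- 1ℤ ℤ.* ∑ v) e) (ℤP.i≡j⇒i-j≡0 {1ℤ ℤ.* ∑ v} refl))
        balanced-diff : ∀ u v → (∀ j → u ∙ vs j ≡ 0ℤ) → (∀ j → v ∙ vs j ≡ 0ℤ) → ∀ j → diff u v ∙ vs j ≡ 0ℤ
        balanced-diff u v p q j = trans (diff∙ u v (vs j)) (cong₂ ℤ._-_ (p j) (q j))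
        diff≢0 : ∀ u v → (∃[ i ] u i ≢ v i) → ∃[ i ] diff u v i ≢ 0ℤ
        diff≢0 u v (i , ne) = i , λ z → ne (ℤP.i-j≡0⇒i≡j (u i) (v i)
          (trans (sym (cong₂ ℤ._-_ (ℤP.*-identityˡ (u i)) (ℤP.*-identityˡ (v i)))) z))
        diff< : ∀ u v → (∀ i → u i ℤ.< h) → (∀ i → 0ℤ ℤ.≤ v i) → ∀ i → diff u v i ℤ.< h
        diff< u v p q i = ℤP.≤-<-trans
          (subst (ℤ._≤ u i) (sym (cong₂ ℤ._-_ (ℤP.*-identityˡ (u i)) (ℤP.*-identityˡ (v i))))
            (ℤP.i-j≤i (u i) (v i) {{ℤ.nonNegative (q i)}})) (p i)
        Σm≡Σw : ∑ m ≡ ∑ w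
        Σm≡Σw = trans Σm (sym ∑-weight)
        m≢w : ∃[ i ] m i ≢ w i
        m≢w = proj₁ m≢l , λ e → proj₂ m≢l (ℤP.+-injective (trans e (w≡l _)))
        down : m ∙ (φ ∘ vectors C) ℤ.≤ w ∙ (φ ∘ vectors C) → Σ[ C′ ∈ Cert φ 4 ] ∑ (weight C′) ℤ.< h
        down le = shrink (diff m w) f (κ ℤ.- 1ℤ)
          (λ i → trans (cong (λ x → 1ℤ ℤ.* x ℤ.- 1ℤ ℤ.* w i) (m≡ i)) (shape κ (w i) (f i) h))
          (λ i z → cong₂ (λ x y → 1ℤ ℤ.* x ℤ.- 1ℤ ℤ.* y) (w≡0⇒m≡0 i z) z)
          (∑-diff m w Σm≡Σw) (diff≢0 m w m≢w) (diff< m w (λ i → ℤ.+<+ (m<h i)) (weight≥0 C))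
          (balanced-diff m w m∙vs≡0 (balanced C))
          (subst (ℤ._≤ 0ℤ) (sym (diff∙ m w (φ ∘ vectors C))) (ℤP.i≤j⇒i-j≤0 le))
          where
          shape : ∀ κ w f h → 1ℤ ℤ.* (κ ℤ.* w ℤ.- f ℤ.* h) ℤ.- 1ℤ ℤ.* w ≡ (κ ℤ.- 1ℤ) ℤ.* w ℤ.- f ℤ.* h
          shape = solve-ℤ
        up : w ∙ (φ ∘ vectors C) ℤ.≤ m ∙ (φ ∘ vectors C) → Σ[ C′ ∈ Cert φ 4 ] ∑ (weight C′) ℤ.< h
        up le = shrink (diff w m) (λ i → ℤ.- f i) (1ℤ ℤ.- κ)
          (λ i → trans (cong (λ x → 1ℤ ℤ.* w i ℤ.- 1ℤ ℤ.* x) (m≡ i)) (shape κ (w i) (f i) h))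
          (λ i z → cong₂ (λ x y → 1ℤ ℤ.* x ℤ.- 1ℤ ℤ.* y) z (w≡0⇒m≡0 i z))
          (∑-diff w m (sym Σm≡Σw)) (diff≢0 w m (proj₁ m≢w , proj₂ m≢w ∘ sym)) (diff< w m w<h (λ i → ℤ.+≤+ ℕ.z≤n))
          (balanced-diff w m (balanced C) m∙vs≡0)
          (subst (ℤ._≤ 0ℤ) (sym (diff∙ w m (φ ∘ vectors C))) (ℤP.i≤j⇒i-j≤0 le))
          where
          shape : ∀ κ w f h → 1ℤ ℤ.* w ℤ.- 1ℤ ℤ.* (κ ℤ.* w ℤ.- f ℤ.* h) ≡ (1ℤ ℤ.- κ) ℤ.* w ℤ.- (ℤ.- f) ℤ.* h
          shape = solve-ℤ

  -- Descent on the total: dividing by a common divisor and splitting both lower it strictly, and a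
  -- total of 1 would put all weight on one vector.
  terminal : Concave φ → Cert φ 4 → Σ[ C ∈ Cert φ 4 ] ∃[ q ] (q ∈ₗ numerators × ∑ (weight C) ≡ + q)
  terminal concave C = go C (ℕI.<-wellFounded ℤ.∣ ∑ (weight C) ∣)
    where
    smaller : ∀ {x y} → 0ℤ ℤ.≤ x → x ℤ.< y → ℤ.∣ x ∣ ℕ.< ℤ.∣ y ∣
    smaller (ℤ.+≤+ _) (ℤ.+<+ p) = p
    go : (C : Cert φ 4) → Acc ℕ._<_ ℤ.∣ ∑ (weight C) ∣ → Σ[ C ∈ Cert φ 4 ] ∃[ q ]
      (q ∈ₗ numerators × ∑ (weight C) ≡ + q)
    go C (acc rec) = step (reduction h {{ℕ.≢-nonZero h≢0}} l refl)
      where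
      l : Weights
      l i = ℤ.∣ weight C i ∣
      h = total l
      w≡l : ∀ i → weight C i ≡ + l i
      w≡l i = sym (ℤP.0≤i⇒+∣i∣≡i (weight≥0 C i))
      Σ≡h : ∑ (weight C) ≡ + h
      Σ≡h = ∑-weight C l w≡l
      h≢0 : h ≢ 0
      h≢0 z = total≢0 C (trans Σ≡h (cong +_ z))
      recurse : Σ[ C′ ∈ Cert φ 4 ] ∑ (weight C′) ℤ.< ∑ (weight C) → _
      recurse (C′ , lt) = go C′ (rec (smaller (total≥0 C′) lt))
      step : h ∈ₗ 1 ∷ numerators ⊎ CommonDivisor l ⊎ Split h l → _
      step (inj₁ (here h≡1)) = contradiction h≡1 (total≢1 C l w≡l)
      step (inj₁ (there q∈)) = C , h , q∈ , Σ≡h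
      step (inj₂ (inj₁ common@(g , 2≤g , _))) with divide C l w≡l common
      ... | C′ , eq = recurse (C′ , subst (∑ (weight C′) ℤ.<_) eq
        (subst (ℤ._< + g ℤ.* ∑ (weight C′)) (ℤP.*-identityˡ _)
              (ℤP.*-monoʳ-<-pos (∑ (weight C′)) {{ℤ.positive (ℤP.≤∧≢⇒< (total≥0 C′) (total≢0 C′ ∘ sym))}}
                (ℤ.+<+ 2≤g))))
      step (inj₂ (inj₂ split)) with improve C l w≡l concave h≢0 split
      ... | C′ , lt = recurse (C′ , subst (∑ (weight C′) ℤ.<_) (sym Σ≡h) lt)

-- Fourier–Motzkin elimination

record Fraction : Set where
  field
    num den : ℤ
    den>0 : 0ℤ ℤ.< den
open Fraction

infix 4 _≤ᶠ_
record _≤ᶠ_ (x y : Fraction) : Set where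
  constructor mk≤ᶠ
  field cross : num x ℤ.* den y ℤ.≤ num y ℤ.* den x
open _≤ᶠ_

≤ᶠ-total : Total _≤ᶠ_
≤ᶠ-total x y = [ inj₁ ∘ mk≤ᶠ , inj₂ ∘ mk≤ᶠ ]′ (ℤP.≤-total (num x ℤ.* den y) (num y ℤ.* den x))

≤ᶠ-trans : Transitive _≤ᶠ_
≤ᶠ-trans {x} {y} {z} (mk≤ᶠ p) (mk≤ᶠ q) = mk≤ᶠ (ℤP.*-cancelˡ-≤-pos _ _ (den y) {{ℤ.positive (den>0 y)}} (begin
  den y ℤ.* (num x ℤ.* den z) ≡⟨ shuffle (den y) (num x) (den z) ⟩
  (num x ℤ.* den y) ℤ.* den z ≤⟨ ℤP.*-monoʳ-≤-nonNeg (den z) {{ℤ.nonNegative (ℤP.<⇒≤ (den>0 z))}} p ⟩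
  (num y ℤ.* den x) ℤ.* den z ≡⟨ shuffle′ (num y) (den x) (den z) ⟩
  (num y ℤ.* den z) ℤ.* den x ≤⟨ ℤP.*-monoʳ-≤-nonNeg (den x) {{ℤ.nonNegative (ℤP.<⇒≤ (den>0 x))}} q ⟩
  (num z ℤ.* den y) ℤ.* den x ≡⟨ shuffle″ (num z) (den y) (den x) ⟩
  den y ℤ.* (num z ℤ.* den x) ∎))
  where
  open ℤP.≤-Reasoning
  shuffle : ∀ a b c → a ℤ.* (b ℤ.* c) ≡ (b ℤ.* a) ℤ.* c
  shuffle = solve-ℤ
  shuffle′ : ∀ a b c → (a ℤ.* b) ℤ.* c ≡ (a ℤ.* c) ℤ.* b
  shuffle′ = solve-ℤ
  shuffle″ : ∀ a b c → (a ℤ.* b) ℤ.* c ≡ b ℤ.* (a ℤ.* c)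
  shuffle″ = solve-ℤ

greatest : ∀ {A : Set} {_≼_ : A → A → Set} → Total _≼_ → Transitive _≼_ →
  ∀ {X : Set} (f : X → A) x xs → Σ[ m ∈ X ] (m ∈ₗ x ∷ xs × (∀ z → z ∈ₗ x ∷ xs → f z ≼ f m))
greatest {_≼_ = _≼_} total trans f x [] = x , here refl , λ
  { _ (here refl) → [ (λ p → p) , (λ p → p) ]′ (total (f x) (f x)) }
greatest total trans f x (y ∷ ys) with greatest total trans f y ys
... | m , m∈ , max with total (f x) (f m)
...   | inj₁ x≼m = m , there m∈ , λ { _ (here refl) → x≼m ; z (there z∈) → max z z∈ }
...   | inj₂ m≼x = x , here refl , λ { _ (here refl) → [ (λ p → p) , (λ p → p) ]′ (total (f x) (f x))
                                     ; z (there z∈) → trans (max z z∈) m≼x }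

-- The greatest lower bound is such a point; without lower bounds, the least upper bound is.
cut : ∀ {P N : Set} (lower : P → Fraction) (upper : N → Fraction) (ps : List P) (ns : List N) →
  (∀ p n → p ∈ₗ ps → n ∈ₗ ns → lower p ≤ᶠ upper n) →
  Σ[ x ∈ Fraction ] ((∀ p → p ∈ₗ ps → lower p ≤ᶠ x) × (∀ n → n ∈ₗ ns → x ≤ᶠ upper n))
cut lower upper (p ∷ ps) ns le with greatest ≤ᶠ-total (λ {x} {y} {z} → ≤ᶠ-trans {x} {y} {z}) lower p ps
... | m , m∈ , max = lower m , max , λ n n∈ → le m n m∈ n∈
cut lower upper [] (n ∷ ns) le
  with greatest (flip ≤ᶠ-total) (λ {x} {y} {z} p q → ≤ᶠ-trans {z} {y} {x} q p) upper n ns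
... | m , m∈ , min = upper m , (λ _ ()) , min
cut lower upper [] [] le = record { num = 0ℤ ; den = 1ℤ ; den>0 = ℤ.+<+ (ℕ.s≤s ℕ.z≤n) } , (λ _ ()) , (λ _ ())

infix 7 _·_
_·_ : ∀ {d} → Vec ℤ d → Vec ℤ d → ℤ
[] · [] = 0ℤ
(a ∷ as) · (x ∷ xs) = a ℤ.* x ℤ.+ as · xs

combine : ∀ {d} → ℤ → ℤ → Vec ℤ d → Vec ℤ d → Vec ℤ d
combine p q = Vec.zipWith (λ x y → p ℤ.* x ℤ.+ q ℤ.* y)

combine-· : ∀ {d} p q (a b x : Vec ℤ d) → combine p q a b · x ≡ p ℤ.* (a · x) ℤ.+ q ℤ.* (b · x)
combine-· p q [] [] [] = base p q
  where base : ∀ p q → 0ℤ ≡ p ℤ.* 0ℤ ℤ.+ q ℤ.* 0ℤ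
        base = solve-ℤ
combine-· p q (a ∷ as) (b ∷ bs) (x ∷ xs) =
  trans (cong (ℤ._+_ ((p ℤ.* a ℤ.+ q ℤ.* b) ℤ.* x)) (combine-· p q as bs xs)) (step p q a b x (as · xs) (bs · xs))
  where step : ∀ p q a b x s t → (p ℤ.* a ℤ.+ q ℤ.* b) ℤ.* x ℤ.+ (p ℤ.* s ℤ.+ q ℤ.* t) ≡
                 p ℤ.* (a ℤ.* x ℤ.+ s) ℤ.+ q ℤ.* (b ℤ.* x ℤ.+ t)
        step = solve-ℤ

·-scale : ∀ {d} w (a x : Vec ℤ d) → a · Vec.map (w ℤ.*_) x ≡ w ℤ.* (a · x)
·-scale w [] [] = sym (ℤP.*-zeroʳ w)
·-scale w (a ∷ as) (x ∷ xs) = trans (cong (ℤ._+_ (a ℤ.* (w ℤ.* x))) (·-scale w as xs)) (step w a x (as · xs))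
  where step : ∀ w a x s → a ℤ.* (w ℤ.* x) ℤ.+ w ℤ.* s ≡ w ℤ.* (a ℤ.* x ℤ.+ s)
        step = solve-ℤ

-- The inequality a · x ≥ b.
Constraint : ℕ → Set
Constraint d = Vec ℤ d × ℤ

-- x / t solves the constraint.
Solves : ∀ {d} → Vec ℤ d → ℤ → Constraint d → Set
Solves x t (a , b) = t ℤ.* b ℤ.≤ a · x

-- Elimination only ever forms positive combinations of two constraints. Keeping D abstract spares
-- it the multipliers; these reappear when D is taken to be the nonnegative combinations of a given
-- system.
Closed : ∀ {d} → (Constraint d → Set) → Set
Closed D = ∀ {a b a′ b′} p q → 0ℤ ℤ.< p → 0ℤ ℤ.< q → D (a , b) → D (a′ , b′) →
  D (combine p q a a′ , p ℤ.* b ℤ.+ q ℤ.* b′)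

module Eliminate {d} (D : Constraint (suc d) → Set) (closed : Closed D) where

  D₀ : Constraint d → Set
  D₀ (a , b) = D (0ℤ ∷ a , b)

  closed₀ : Closed D₀
  closed₀ {a} {b} {a′} {b′} p q p>0 q>0 x y =
    subst (λ z → D (z ∷ combine p q a a′ , p ℤ.* b ℤ.+ q ℤ.* b′)) (zeroes p q) (closed p q p>0 q>0 x y)
    where zeroes : ∀ p q → p ℤ.* 0ℤ ℤ.+ q ℤ.* 0ℤ ≡ 0ℤ
          zeroes = solve-ℤ

  record Lower : Set where
    field
      {coeff}  : ℤ
      coeff>0  : 0ℤ ℤ.< coeff
      {rest}   : Vec ℤ d
      {bound}  : ℤ
      derived  : D (coeff ∷ rest , bound)

  record Upper : Set where
    field
      {coeff}  : ℤ
      coeff>0  : 0ℤ ℤ.< coeff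
      {rest}   : Vec ℤ d
      {bound}  : ℤ
      derived  : D (ℤ.- coeff ∷ rest , bound)

  resolve : Lower → Upper → Σ[ c ∈ Constraint d ] D₀ c
  resolve l u = (combine U.coeff L.coeff L.rest U.rest , U.coeff ℤ.* L.bound ℤ.+ L.coeff ℤ.* U.bound) ,
    subst (λ z → D (z ∷ combine U.coeff L.coeff L.rest U.rest , U.coeff ℤ.* L.bound ℤ.+ L.coeff ℤ.* U.bound))
      (cancel U.coeff L.coeff)
      (closed U.coeff L.coeff U.coeff>0 L.coeff>0 L.derived U.derived)
    where
    module L = Lower l
    module U = Upper u
    cancel : ∀ p q → p ℤ.* q ℤ.+ q ℤ.* (ℤ.- p) ≡ 0ℤ
    cancel = solve-ℤ

  record Sorted (S : List (Σ[ c ∈ Constraint (suc d) ] D c)) : Set where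
    field
      free   : List (Σ[ c ∈ Constraint d ] D₀ c)
      lowers : List Lower
      uppers : List Upper
      complete : ∀ z x t →
        (∀ c → c ∈ₗ free → Solves x t (proj₁ c)) →
        (∀ l → l ∈ₗ lowers → Solves (z ∷ x) t (Lower.coeff l ∷ Lower.rest l , Lower.bound l)) →
        (∀ u → u ∈ₗ uppers → Solves (z ∷ x) t (ℤ.- Upper.coeff u ∷ Upper.rest u , Upper.bound u)) →
        ∀ c → c ∈ₗ S → Solves (z ∷ x) t (proj₁ c)

  sort : ∀ S → Sorted S
  sort [] = record { free = [] ; lowers = [] ; uppers = [] ; complete = λ _ _ _ _ _ _ _ () }
  sort (((p ∷ a , b) , d) ∷ S) with ℤP.<-cmp 0ℤ p | sort S
  ... | tri< p>0 _ _ | s = record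
    { free = free ; lowers = record { coeff>0 = p>0 ; derived = d } ∷ lowers ; uppers = uppers
    ; complete = λ { z x t f l u _ (here refl) → l _ (here refl)
                   ; z x t f l u c (there c∈) → complete z x t f (λ k → l k ∘ there) u c c∈ } }
    where open Sorted s
  ... | tri≈ _ refl _ | s = record
    { free = ((a , b) , d) ∷ free ; lowers = lowers ; uppers = uppers
    ; complete = λ { z x t f l u _ (here refl) → subst (t ℤ.* b ℤ.≤_) (sym (ℤP.+-identityˡ (a · x)))
      (f _ (here refl))
                   ; z x t f l u c (there c∈) → complete z x t (λ k → f k ∘ there) l u c c∈ } }
    where open Sorted s
  ... | tri> _ _ p<0 | s = record
    { free = free ; lowers = lowers
    ; uppers = record { coeff = ℤ.- p ; coeff>0 = ℤP.neg-mono-< p<0 ; rest = a ; bound = b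
                      ; derived = subst (λ z → D (z ∷ a , b)) (sym (ℤP.neg-involutive p)) d } ∷ uppers
    ; complete = λ { z x t f l u _ (here refl) → subst (λ q → t ℤ.* b ℤ.≤ q ℤ.* z ℤ.+ a · x) (ℤP.neg-involutive p)
      (u _ (here refl))
                   ; z x t f l u c (there c∈) → complete z x t f l (λ k → u k ∘ there) c c∈ } }
    where open Sorted s

  module _ {S} (s : Sorted S) where
    open Sorted s

    eliminated : List (Σ[ c ∈ Constraint d ] D₀ c)
    eliminated = free List.++ cartesianProductWith resolve lowers uppers

    -- Over x / t, the resolved pairs say that each lower bound for t times the new coordinate is at
    -- most each upper bound. A point u / w in between gives the numerators u and w x over the
    -- common denominator w t.
    lift : ∀ x t → 0ℤ ℤ.< t → (∀ c → c ∈ₗ eliminated → Solves x t (proj₁ c)) →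
      Σ[ x′ ∈ Vec ℤ (suc d) ] Σ[ t′ ∈ ℤ ] (0ℤ ℤ.< t′ × (∀ c → c ∈ₗ S → Solves x′ t′ (proj₁ c)))
    lift x t t>0 sol = (u ∷ wx) , w ℤ.* t , 0<* w>0 t>0 ,
      complete u wx (w ℤ.* t)
        (λ c c∈ → subst₂ ℤ._≤_ (sym (ℤP.*-assoc w t _)) (sym (·-scale w (proj₁ (proj₁ c)) x))
          (ℤP.*-monoˡ-≤-nonNeg w {{ℤ.nonNegative (ℤP.<⇒≤ w>0)}} (sol c (∈-++⁺ˡ c∈))))
        (λ l l∈ → from-lower l (cross (proj₁ (proj₂ found) l l∈)))
        (λ k k∈ → from-upper k (cross (proj₂ (proj₂ found) k k∈)))
      where
      open Lower using () renaming (coeff to lcoeff; coeff>0 to lcoeff>0; rest to lrest; bound to lbound)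
      open Upper using () renaming (coeff to ucoeff; coeff>0 to ucoeff>0; rest to urest; bound to ubound)
      lower : Lower → Fraction
      lower l = record { num = t ℤ.* lbound l ℤ.- lrest l · x ; den = lcoeff l ; den>0 = lcoeff>0 l }
      upper : Upper → Fraction
      upper k = record { num = urest k · x ℤ.- t ℤ.* ubound k ; den = ucoeff k ; den>0 = ucoeff>0 k }
      separated : ∀ l k → l ∈ₗ lowers → k ∈ₗ uppers → lower l ≤ᶠ upper k
      separated l k l∈ k∈ = mk≤ᶠ (move t (lbound l) (ubound k) (lcoeff l) (ucoeff k) (lrest l · x) (urest k · x)
        (subst (t ℤ.* (ucoeff k ℤ.* lbound l ℤ.+ lcoeff l ℤ.* ubound k) ℤ.≤_)
          (combine-· (ucoeff k) (lcoeff l) (lrest l) (urest k) x)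
          (sol (resolve l k) (∈-++⁺ʳ free (∈-cartesianProductWith⁺ resolve l∈ k∈)))))
        where
        difference : ∀ t b b′ p q s s′ →
          (q ℤ.* s ℤ.+ p ℤ.* s′) ℤ.- t ℤ.* (q ℤ.* b ℤ.+ p ℤ.* b′) ≡ (s′ ℤ.- t ℤ.* b′) ℤ.* p ℤ.- (t ℤ.* b ℤ.- s) ℤ.*
            q
        difference = solve-ℤ
        move : ∀ t b b′ p q s s′ → t ℤ.* (q ℤ.* b ℤ.+ p ℤ.* b′) ℤ.≤ q ℤ.* s ℤ.+ p ℤ.* s′ →
          (t ℤ.* b ℤ.- s) ℤ.* q ℤ.≤ (s′ ℤ.- t ℤ.* b′) ℤ.* p
        move t b b′ p q s s′ le = ℤP.0≤i-j⇒j≤i (subst (0ℤ ℤ.≤_) (difference t b b′ p q s s′) (ℤP.i≤j⇒0≤j-i le))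
      found = cut lower upper lowers uppers separated
      u = num (proj₁ found)
      w = den (proj₁ found)
      w>0 = den>0 (proj₁ found)
      wx = Vec.map (w ℤ.*_) x
      from-lower : ∀ l → (t ℤ.* lbound l ℤ.- lrest l · x) ℤ.* w ℤ.≤ u ℤ.* lcoeff l →
        Solves (u ∷ wx) (w ℤ.* t) (lcoeff l ∷ lrest l , lbound l)
      from-lower l le = subst ((w ℤ.* t) ℤ.* lbound l ℤ.≤_)
        (cong (ℤ._+_ (lcoeff l ℤ.* u)) (sym (·-scale w (lrest l) x)))
        (ℤP.0≤i-j⇒j≤i (subst (0ℤ ℤ.≤_) (difference t (lbound l) (lrest l · x) w u (lcoeff l)) (ℤP.i≤j⇒0≤j-i le)))
        where
        difference : ∀ t b s w u p → u ℤ.* p ℤ.- (t ℤ.* b ℤ.- s) ℤ.* w ≡ (p ℤ.* u ℤ.+ w ℤ.* s) ℤ.- (w ℤ.* t) ℤ.* b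
        difference = solve-ℤ
      from-upper : ∀ k → u ℤ.* ucoeff k ℤ.≤ (urest k · x ℤ.- t ℤ.* ubound k) ℤ.* w →
        Solves (u ∷ wx) (w ℤ.* t) (ℤ.- ucoeff k ∷ urest k , ubound k)
      from-upper k le = subst ((w ℤ.* t) ℤ.* ubound k ℤ.≤_)
        (cong (ℤ._+_ (ℤ.- ucoeff k ℤ.* u)) (sym (·-scale w (urest k) x)))
        (ℤP.0≤i-j⇒j≤i (subst (0ℤ ℤ.≤_) (difference t (ubound k) (urest k · x) w u (ucoeff k)) (ℤP.i≤j⇒0≤j-i le)))
        where
        difference : ∀ t b s w u p → (s ℤ.- t ℤ.* b) ℤ.* w ℤ.- u ℤ.* p ≡ (ℤ.- p ℤ.* u ℤ.+ w ℤ.* s) ℤ.- (w ℤ.* t) ℤ.*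
          b
        difference = solve-ℤ

opaque
  -- When all variables are eliminated, each constraint reads 0 ≥ b: either none has b > 0, and the
  -- solution lifts back, or such a contradiction has been derived.
  farkas : ∀ {d} (D : Constraint d → Set) → Closed D → (S : List (Σ[ c ∈ Constraint d ] D c)) →
    (Σ[ x ∈ Vec ℤ d ] Σ[ t ∈ ℤ ] (0ℤ ℤ.< t × (∀ c → c ∈ₗ S → Solves x t (proj₁ c)))) ⊎
    (Σ[ b ∈ ℤ ] (0ℤ ℤ.< b × D (replicate d 0ℤ , b)))
  farkas {zero} D closed [] = inj₁ ([] , 1ℤ , ℤ.+<+ (ℕ.s≤s ℕ.z≤n) , λ _ ())
  farkas {zero} D closed ((([] , b) , d) ∷ S) with 0ℤ ℤ.<? b | farkas D closed S
  ... | yes b>0 | _ = inj₂ (b , b>0 , d)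
  ... | no _ | inj₂ r = inj₂ r
  ... | no b≯0 | inj₁ ([] , t , t>0 , sol) = inj₁ ([] , t , t>0 , λ
    { _ (here refl) → subst (t ℤ.* b ℤ.≤_) (ℤP.*-zeroʳ t)
      (ℤP.*-monoˡ-≤-nonNeg t {{ℤ.nonNegative (ℤP.<⇒≤ t>0)}} (ℤP.≮⇒≥ b≯0))
    ; c (there c∈) → sol c c∈ })
  farkas {suc d} D closed S with farkas D₀ closed₀ (eliminated (sort S))
    where open Eliminate D closed
  ... | inj₂ r = inj₂ r
  ... | inj₁ (x , t , t>0 , sol) = inj₁ (Eliminate.lift D closed (Eliminate.sort D closed S) x t t>0 sol)

-- Dickson’s lemma, under double negation

return : {A : Set} → A → ¬ ¬ A
return a k = k a

infixl 1 _>>=_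
_>>=_ : {A B : Set} → ¬ ¬ A → (A → ¬ ¬ B) → ¬ ¬ B
(m >>= f) k = m λ a → f a k

excluded-middle : {A : Set} → ¬ ¬ (A ⊎ ¬ A)
excluded-middle k = k (inj₂ (k ∘ inj₁))

¬¬-Fin : ∀ {n} {P : Fin n → Set} → (∀ i → ¬ ¬ P i) → ¬ ¬ (∀ i → P i)
¬¬-Fin {zero} f k = k λ ()
¬¬-Fin {suc n} f = f zero >>= λ p → ¬¬-Fin (f ∘ suc) >>= λ ps → return λ { zero → p ; (suc i) → ps i }

least : (P : ℕ → Set) → ∃[ n ] P n → ¬ ¬ (∃[ n ] (P n × (∀ m → m ℕ.< n → ¬ P m)))
least P (n , p) = go n p (ℕI.<-wellFounded n)
  where
  go : ∀ n → P n → Acc ℕ._<_ n → ¬ ¬ (∃[ n ] (P n × (∀ m → m ℕ.< n → ¬ P m)))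
  go n p (acc rec) k = k (n , p , λ m m<n q → go m q (rec m<n) k)

Basis : ∀ {X : Set} {n} → (X → Fin n → ℕ) → Set
Basis {X} g = Σ[ B ∈ List X ] (∀ x → Σ[ b ∈ X ] (b ∈ₗ B × (∀ j → g b j ℕ.≤ g x j)))

-- Let B be a basis for the coordinates after the first and M the largest first coordinate in B.
-- Then B handles every x with first coordinate at least M, and each of the finitely many smaller
-- values leaves a slice with one coordinate fewer. Excluded middle enters at n = 0, to decide
-- whether X has an element.
dickson : ∀ n {X : Set} (g : X → Fin n → ℕ) → ¬ ¬ Basis g
dickson zero {X} g = excluded-middle {X} >>= λ
  { (inj₁ x) → return (x ∷ [] , λ _ → x , here refl , λ ())
  ; (inj₂ ¬x) → return ([] , λ x → contradiction x ¬x) }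
dickson (suc n) {X} g = dickson n (λ x → g x ∘ suc) >>= λ (B , dominated) →
  let M = bound B in
  ¬¬-Fin (λ (m : Fin M) → dickson n {Σ[ x ∈ X ] g x zero ≡ Fin.toℕ m} (λ x → g (proj₁ x) ∘ suc)) >>= λ slices →
  return (B List.++ List.concat (List.tabulate λ m → List.map proj₁ (proj₁ (slices m))) , λ x → cover B dominated
    slices x (g x zero ℕ.<? M))
  where
  bound : List X → ℕ
  bound [] = 0
  bound (b ∷ bs) = g b zero ℕ.⊔ bound bs
  bounded : ∀ {b} bs → b ∈ₗ bs → g b zero ℕ.≤ bound bs
  bounded (b ∷ bs) (here refl) = ℕP.m≤m⊔n (g b zero) (bound bs)
  bounded (b ∷ bs) (there b∈) = ℕP.≤-trans (bounded bs b∈) (ℕP.m≤n⊔m (g b zero) (bound bs))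
  cover : ∀ B → (∀ x → Σ[ b ∈ X ] (b ∈ₗ B × (∀ j → g b (suc j) ℕ.≤ g x (suc j)))) →
    (slices : ∀ (m : Fin (bound B)) → Basis {Σ[ x ∈ X ] g x zero ≡ Fin.toℕ m} (λ x → g (proj₁ x) ∘ suc)) →
    ∀ x → Dec (g x zero ℕ.< bound B) →
    Σ[ b ∈ X ] (b ∈ₗ B List.++ List.concat (List.tabulate λ m → List.map proj₁ (proj₁ (slices m))) ×
      (∀ j → g b j ℕ.≤ g x j))
  cover B dominated slices x (no ≮M) with dominated x
  ... | b , b∈ , le = b , ∈-++⁺ˡ b∈ , λ { zero → ℕP.≤-trans (bounded B b∈) (ℕP.≮⇒≥ ≮M) ; (suc j) → le j }
  cover B dominated slices x (yes <M) with proj₂ (slices (Fin.fromℕ< <M)) (x , sym (FinP.toℕ-fromℕ< <M))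
  ... | (b , gb≡) , b∈ , le = b , ∈-++⁺ʳ B (∈-concat⁺′ (∈-map⁺ proj₁ b∈) (∈-tabulate⁺ (Fin.fromℕ< <M))) ,
    λ { zero → ℕP.≤-reflexive (trans gb≡ (FinP.toℕ-fromℕ< <M)) ; (suc j) → le j }

-- Duality for Fine adjoints

∙-comm₃ : ∀ {n k} (m : Vector ℤ n) (A : Fin n → Vector ℤ k) (v : Vector ℤ k) →
  m ∙ (λ i → A i ∙ v) ≡ (λ j → m ∙ (λ i → A i j)) ∙ v
∙-comm₃ m A v = begin
  ∑ (λ i → m i ℤ.* ∑ (λ j → A i j ℤ.* v j)) ≡⟨ ∑-cong (λ i → sym (∑-* (m i) (λ j → A i j ℤ.* v j))) ⟩
  ∑ (λ i → ∑ (λ j → m i ℤ.* (A i j ℤ.* v j))) ≡⟨ ∑-comm _ ⟩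
  ∑ (λ j → ∑ (λ i → m i ℤ.* (A i j ℤ.* v j)))
    ≡⟨ ∑-cong (λ j → trans (∑-cong λ i → shuffle (m i) (A i j) (v j))
    (trans (∑-* (v j) (λ i → m i ℤ.* A i j)) (ℤP.*-comm (v j) _))) ⟩
  ∑ (λ j → ∑ (λ i → m i ℤ.* A i j) ℤ.* v j) ∎
  where
  open ≡-Reasoning
  shuffle : ∀ m a v → m ℤ.* (a ℤ.* v) ≡ v ℤ.* (m ℤ.* a)
  shuffle = solve-ℤ

∙-linʳ : ∀ {n} (w x : Vector ℤ n) p q → w ∙ (λ i → p ℤ.* x i ℤ.+ q) ≡ p ℤ.* (w ∙ x) ℤ.+ q ℤ.* ∑ w
∙-linʳ w x p q = begin
  w ∙ (λ i → p ℤ.* x i ℤ.+ q) ≡⟨ ∑-cong (λ i → shape (w i) (x i) p q) ⟩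
  ∑ (λ i → p ℤ.* (w i ℤ.* x i) ℤ.- (ℤ.- q) ℤ.* w i) ≡⟨ ∑-lin p (ℤ.- q) (λ i → w i ℤ.* x i) w ⟩
  p ℤ.* (w ∙ x) ℤ.- (ℤ.- q) ℤ.* ∑ w ≡⟨ sign (p ℤ.* (w ∙ x)) q (∑ w) ⟩
  p ℤ.* (w ∙ x) ℤ.+ q ℤ.* ∑ w ∎
  where
  open ≡-Reasoning
  shape : ∀ w x p q → w ℤ.* (p ℤ.* x ℤ.+ q) ≡ p ℤ.* (w ℤ.* x) ℤ.- (ℤ.- q) ℤ.* w
  shape = solve-ℤ
  sign : ∀ a q s → a ℤ.- (ℤ.- q) ℤ.* s ≡ a ℤ.+ q ℤ.* s
  sign = solve-ℤ

∙-mono : ∀ {n} {w x y : Vector ℤ n} → (∀ i → 0ℤ ℤ.≤ w i) → (∀ i → x i ℤ.≤ y i) → w ∙ x ℤ.≤ w ∙ y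
∙-mono {w = w} w≥0 le = ∑-mono λ i → ℤP.*-monoˡ-≤-nonNeg (w i) {{ℤ.nonNegative (w≥0 i)}} (le i)

argmin : ∀ {m} (f : Fin (suc m) → ℤ) → ∃[ i ] (∀ j → f i ℤ.≤ f j)
argmin {zero} f = zero , λ { zero → ℤP.≤-refl }
argmin {suc m} f with argmin (f ∘ suc)
... | i , min with ℤP.≤-total (f zero) (f (suc i))
...   | inj₁ le = zero , λ { zero → ℤP.≤-refl ; (suc j) → ℤP.≤-trans le (min j) }
...   | inj₂ ge = suc i , λ { zero → ge ; (suc j) → min j }

e₁ : Covector 3
e₁ = 1ℤ ∷ᵛ const 0ℤ

e₁≢0 : Nonzero e₁
e₁≢0 z = contradiction (z 0F) λ ()

tabulate-· : ∀ {d} (a : Vector ℤ d) x → Vec.tabulate a · x ≡ a ∙ Vec.lookup x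
tabulate-· a [] = sym (∑-nil _)
tabulate-· a (x ∷ xs) = trans (cong (ℤ._+_ (a zero ℤ.* x)) (tabulate-· (tail a) xs))
  (sym (∑-suc (λ j → a j ℤ.* Vec.lookup (x ∷ xs) j)))

-- Four copies of `e₁` with weight 0 guarantee that there are at least four vectors to reduce.
cert-4 : ∀ {φ n} → Cert φ n → Cert φ 4
cert-4 {n = n} C = caratheodory n (add-vector (add-vector (add-vector (add-vector C e₁≢0) e₁≢0) e₁≢0) e₁≢0)

module Support {m} (G : Fin (suc m) → Vector ℤ 3) where

  vertex : Covector 3 → Fin (suc m)
  vertex a = proj₁ (argmin (λ i → a ∙ G i))

  h : Covector 3 → ℤ
  h a = a ∙ G (vertex a)

  h≤ : ∀ a i → h a ℤ.≤ a ∙ G i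
  h≤ a = proj₂ (argmin (λ i → a ∙ G i))

  h-unique : ∀ a i → (∀ j → a ∙ G i ℤ.≤ a ∙ G j) → h a ≡ a ∙ G i
  h-unique a i min = ℤP.≤-antisym (h≤ a i) (min (vertex a))

  -- t = T / Q satisfies ⟨ a , x ⟩ ≥ h a + t iff Q ⟨ a , x ⟩ ≥ φ a.
  module _ (Q T : ℤ) where

    φ : Covector 3 → ℤ
    φ a = Q ℤ.* h a ℤ.+ T

    -- All covectors are evaluated at one vertex that minimizes b. This is linear, bounds each h aᵢ
    -- from above and is exact at b.
    φ-concave : 0ℤ ℤ.< Q → Concave φ
    φ-concave Q>0 m A b m≥0 _ bal = begin
      m ∙ (φ ∘ A) ≤⟨ ∙-mono m≥0 (λ i → ℤP.+-monoˡ-≤ T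
        (ℤP.*-monoˡ-≤-nonNeg Q {{ℤ.nonNegative (ℤP.<⇒≤ Q>0)}} (h≤ (A i) (vertex b)))) ⟩
      m ∙ (λ i → Q ℤ.* (A i ∙ v) ℤ.+ T) ≡⟨ ∙-linʳ m (λ i → A i ∙ v) Q T ⟩
      Q ℤ.* (m ∙ (λ i → A i ∙ v)) ℤ.+ T ℤ.* ∑ m ≡⟨ cong (λ x → Q ℤ.* x ℤ.+ T ℤ.* ∑ m) (begin-equality
        m ∙ (λ i → A i ∙ v) ≡⟨ ∙-comm₃ m A v ⟩
        (λ j → m ∙ (λ i → A i j)) ∙ v ≡⟨ ∙-cong v (λ j → sym (bal j)) ⟩
        (λ j → ∑ m ℤ.* b j) ∙ v ≡⟨ ∙-*ˡ (∑ m) b v ⟩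
        ∑ m ℤ.* (b ∙ v) ∎) ⟩
      Q ℤ.* (∑ m ℤ.* (b ∙ v)) ℤ.+ T ℤ.* ∑ m ≡⟨ collect Q (∑ m) (b ∙ v) T ⟩
      ∑ m ℤ.* φ b ∎
      where
      open ℤP.≤-Reasoning
      v = G (vertex b)
      collect : ∀ q s x t → q ℤ.* (s ℤ.* x) ℤ.+ t ℤ.* s ≡ s ℤ.* (q ℤ.* x ℤ.+ t)
      collect = solve-ℤ

    -- y / (Q s) lies in the Fine adjoint for T / Q.
    Feasible : Vector ℤ 3 → ℤ → Set
    Feasible y s = ∀ a → Nonzero a → s ℤ.* φ a ℤ.≤ a ∙ y

    TerminalCert : Set
    TerminalCert = Σ[ C ∈ Cert φ 4 ] ∃[ q ] (q ∈ₗ numerators × ∑ (Cert.weight C) ≡ + q)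

  Cone : Fin (suc m) → Set
  Cone i = Σ[ a ∈ Covector 3 ] (Nonzero a × h a ≡ a ∙ G i)

  gap : Fin (suc m) → Covector 3 → Fin (suc m) → ℤ
  gap i a j = a ∙ G j ℤ.- a ∙ G i

  gap≥0 : ∀ {i} ((a , _) : Cone i) j → 0ℤ ℤ.≤ gap i a j
  gap≥0 {i} (a , _ , e) j = ℤP.i≤j⇒0≤j-i (subst (ℤ._≤ a ∙ G j) e (h≤ a j))

  -- These coordinates suit Dickson's lemma: if the gaps of b are at most those of a, then a - b
  -- also attains its minimum at G i, so it lies in the cone unless it is 0.
  gaps : ∀ i → Cone i → Fin (suc m) → ℕ
  gaps i (a , _) j = ℤ.∣ gap i a j ∣

  gap-difference : ∀ i a b j → gap i (λ k → 1ℤ ℤ.* a k ℤ.- 1ℤ ℤ.* b k) j ≡ gap i a j ℤ.- gap i b j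
  gap-difference i a b j = trans (cong₂ ℤ._-_ (∙-lin 1ℤ 1ℤ a b (G j)) (∙-lin 1ℤ 1ℤ a b (G i)))
    (regroup (a ∙ G j) (b ∙ G j) (a ∙ G i) (b ∙ G i))
    where
    regroup : ∀ p q r s → (1ℤ ℤ.* p ℤ.- 1ℤ ℤ.* q) ℤ.- (1ℤ ℤ.* r ℤ.- 1ℤ ℤ.* s) ≡ (p ℤ.- r) ℤ.- (q ℤ.- s)
    regroup = solve-ℤ

  -- It gives every covector of a cone a positive gap, so that splitting off basis elements
  -- terminates.
  FullWidth : Set
  FullWidth = ∀ a → Nonzero a → ¬ (∀ i → a ∙ G i ≡ h a)

  module _ (fullWidth : FullWidth) (Q T : ℤ) (Q>0 : 0ℤ ℤ.< Q) (T≥0 : 0ℤ ℤ.≤ T) where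

    -- A covector of the cone splits off a basis element, and on the cone h is additive.
    basis-suffices : ∀ i → ((B , _) : Basis (gaps i)) → ∀ y s → 0ℤ ℤ.< s →
      (∀ b → b ∈ₗ B → s ℤ.* φ Q T (proj₁ b) ℤ.≤ proj₁ b ∙ y) →
      ∀ (a : Cone i) → s ℤ.* φ Q T (proj₁ a) ℤ.≤ proj₁ a ∙ y
    basis-suffices i (B , dominated) y s s>0 solves a = go a (ℕI.<-wellFounded _)
      where
      measure : Covector 3 → ℤ
      measure a = ∑ (gap i a)
      φ-cone : ((a , _) : Cone i) → φ Q T a ≡ Q ℤ.* (a ∙ G i) ℤ.+ T
      φ-cone (a , _ , e) = cong (λ x → Q ℤ.* x ℤ.+ T) e
      go : (a : Cone i) → Acc ℕ._<_ ℤ.∣ measure (proj₁ a) ∣ → s ℤ.* φ Q T (proj₁ a) ℤ.≤ proj₁ a ∙ y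
      go a∈@(a , a≢0 , ha) (acc rec) = step (dominated a∈)
        where
        step : Σ[ b ∈ Cone i ] (b ∈ₗ B × (∀ j → gaps i b j ℕ.≤ gaps i a∈ j)) → s ℤ.* φ Q T a ℤ.≤ a ∙ y
        step (b∈@(b , b≢0 , hb) , b∈B , le) = finish (FinP.all? (λ j → c j ℤ.≟ 0ℤ))
          where
          c : Covector 3
          c j = 1ℤ ℤ.* a j ℤ.- 1ℤ ℤ.* b j
          c∙ : ∀ x → c ∙ x ≡ a ∙ x ℤ.- b ∙ x
          c∙ x = trans (∙-lin 1ℤ 1ℤ a b x) (cong₂ ℤ._-_ (ℤP.*-identityˡ (a ∙ x)) (ℤP.*-identityˡ (b ∙ x)))
          gap-le : ∀ j → gap i b j ℤ.≤ gap i a j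
          gap-le j = subst₂ ℤ._≤_ (ℤP.0≤i⇒+∣i∣≡i (gap≥0 b∈ j)) (ℤP.0≤i⇒+∣i∣≡i (gap≥0 a∈ j)) (ℤ.+≤+ (le j))
          gap-c≥0 : ∀ j → 0ℤ ℤ.≤ gap i c j
          gap-c≥0 j = subst (0ℤ ℤ.≤_) (sym (gap-difference i a b j)) (ℤP.i≤j⇒0≤j-i (gap-le j))
          hc : h c ≡ c ∙ G i
          hc = h-unique c i (λ j → ℤP.0≤i-j⇒j≤i (gap-c≥0 j))
          measure-c : measure c ≡ measure a ℤ.- measure b
          measure-c = trans (∑-cong (λ j → trans (gap-difference i a b j) (unit (gap i a j) (gap i b j))))
            (trans (∑-lin 1ℤ 1ℤ (gap i a) (gap i b)) (sym (unit (measure a) (measure b))))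
            where unit : ∀ x y → x ℤ.- y ≡ 1ℤ ℤ.* x ℤ.- 1ℤ ℤ.* y
                  unit = solve-ℤ
          measure-b>0 : 0ℤ ℤ.< measure b
          measure-b>0 = ℤP.≤∧≢⇒< (∑-nonneg (gap≥0 b∈)) λ 0≡ → fullWidth b b≢0 λ j →
            trans (ℤP.i-j≡0⇒i≡j (b ∙ G j) (b ∙ G i) (ℤP.≤-antisym
              (ℤP.≤-trans (≤-∑ (gap≥0 b∈) j) (ℤP.≤-reflexive (sym 0≡))) (gap≥0 b∈ j))) (sym hb)
          decreases : ℤ.∣ measure c ∣ ℕ.< ℤ.∣ measure a ∣
          decreases = below (∑-nonneg gap-c≥0) (subst (ℤ._< measure a) (sym measure-c)
            (subst (measure a ℤ.- measure b ℤ.<_) (ℤP.+-identityʳ (measure a))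
              (ℤP.+-monoʳ-< (measure a) (ℤP.neg-mono-< measure-b>0))))
            where below : ∀ {x y} → 0ℤ ℤ.≤ x → x ℤ.< y → ℤ.∣ x ∣ ℕ.< ℤ.∣ y ∣
                  below (ℤ.+≤+ _) (ℤ.+<+ p) = p
          finish : Dec (∀ j → c j ≡ 0ℤ) → s ℤ.* φ Q T a ℤ.≤ a ∙ y
          finish (yes c≡0) = subst₂ ℤ._≤_
            (cong (s ℤ.*_) (trans (φ-cone b∈)
            (trans (cong (λ x → Q ℤ.* x ℤ.+ T) (sym (a≗b (G i)))) (sym (φ-cone a∈)))))
            (sym (a≗b y)) (solves b∈ b∈B)
            where
            a≗b : ∀ x → a ∙ x ≡ b ∙ x
            a≗b x = ℤP.i-j≡0⇒i≡j (a ∙ x) (b ∙ x) (trans (sym (c∙ x)) (∑-zero (λ j → cong (ℤ._* x j) (c≡0 j))))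
          -- For a = b + c in the cone, φ a + T = φ b + φ c, as the constant T is counted once on
          -- each summand. With T ≥ 0 the inequalities for b and c imply the one for a.
          finish (no c≢0) = begin
            s ℤ.* φ Q T a ≡⟨ cong (s ℤ.*_) (φ-cone a∈) ⟩
            s ℤ.* (Q ℤ.* (a ∙ G i) ℤ.+ T) ≡⟨ ℤP.+-identityʳ (s ℤ.* (Q ℤ.* (a ∙ G i) ℤ.+ T)) ⟨
            s ℤ.* (Q ℤ.* (a ∙ G i) ℤ.+ T) ℤ.+ 0ℤ
              ≤⟨ ℤP.+-monoʳ-≤ (s ℤ.* (Q ℤ.* (a ∙ G i) ℤ.+ T)) (0≤* (ℤP.<⇒≤ s>0) T≥0) ⟩
            s ℤ.* (Q ℤ.* (a ∙ G i) ℤ.+ T) ℤ.+ s ℤ.* T ≡⟨ regroup s Q (a ∙ G i) (b ∙ G i) T ⟩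
            s ℤ.* (Q ℤ.* (b ∙ G i) ℤ.+ T) ℤ.+ s ℤ.* (Q ℤ.* (a ∙ G i ℤ.- b ∙ G i) ℤ.+ T)
              ≡⟨ cong₂ (λ x z → s ℤ.* x ℤ.+ s ℤ.* z) (sym (φ-cone b∈))
                (trans (cong (λ z → Q ℤ.* z ℤ.+ T) (sym (c∙ (G i)))) (sym (φ-cone c∈))) ⟩
            s ℤ.* φ Q T b ℤ.+ s ℤ.* φ Q T c ≤⟨ ℤP.+-mono-≤ (solves b∈ b∈B) (go c∈ (rec decreases)) ⟩
            b ∙ y ℤ.+ c ∙ y ≡⟨ cong (ℤ._+_ (b ∙ y)) (c∙ y) ⟩
            b ∙ y ℤ.+ (a ∙ y ℤ.- b ∙ y) ≡⟨ restore (b ∙ y) (a ∙ y) ⟩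
            a ∙ y ∎
            where
            open ℤP.≤-Reasoning
            c∈ : Cone i
            c∈ = c , c≢0 , hc
            regroup : ∀ s q a b t → s ℤ.* (q ℤ.* a ℤ.+ t) ℤ.+ s ℤ.* t ≡ s ℤ.* (q ℤ.* b ℤ.+ t) ℤ.+ s ℤ.*
              (q ℤ.* (a ℤ.- b) ℤ.+ t)
            regroup = solve-ℤ
            restore : ∀ b a → b ℤ.+ (a ℤ.- b) ≡ a
            restore = solve-ℤ

    Entry : Set
    Entry = Σ[ a ∈ Covector 3 ] Nonzero a

    module _ (entries : List Entry) where

      private
        n = List.length entries
        A : Fin n → Covector 3
        A k = proj₁ (List.lookup entries k)

        -- The multipliers w turn into the weights of a certificate once the left side has become 0.
        Derived : Constraint 3 → Set
        Derived (a , b) = Σ[ w ∈ Vector ℤ n ] ((∀ k → 0ℤ ℤ.≤ w k) ×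
          (∀ j → Vec.lookup a j ≡ w ∙ (λ k → A k j)) × b ≡ w ∙ (φ Q T ∘ A))

        derived-closed : Closed Derived
        derived-closed {a} {b} {a′} {b′} p q p>0 q>0 (w , w≥0 , wa , wb) (w′ , w′≥0 , wa′ , wb′) =
          v , (λ k → subst (0ℤ ℤ.≤_) (sym (v≡ k))
            (ℤP.+-mono-≤ (0≤* (ℤP.<⇒≤ p>0) (w≥0 k)) (0≤* (ℤP.<⇒≤ q>0) (w′≥0 k))))
          , (λ j → trans (VecP.lookup-zipWith (λ x y → p ℤ.* x ℤ.+ q ℤ.* y) j a a′)
              (trans (cong₂ (λ x y → p ℤ.* x ℤ.+ q ℤ.* y) (wa j) (wa′ j)) (sym (v∙ (λ k → A k j)))))
          , trans (cong₂ (λ x y → p ℤ.* x ℤ.+ q ℤ.* y) wb wb′) (sym (v∙ (φ Q T ∘ A)))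
          where
          v : Vector ℤ n
          v k = p ℤ.* w k ℤ.- (ℤ.- q) ℤ.* w′ k
          plus : ∀ p x q y → p ℤ.* x ℤ.- (ℤ.- q) ℤ.* y ≡ p ℤ.* x ℤ.+ q ℤ.* y
          plus = solve-ℤ
          v≡ : ∀ k → v k ≡ p ℤ.* w k ℤ.+ q ℤ.* w′ k
          v≡ k = plus p (w k) q (w′ k)
          v∙ : ∀ x → v ∙ x ≡ p ℤ.* (w ∙ x) ℤ.+ q ℤ.* (w′ ∙ x)
          v∙ x = trans (∙-lin p (ℤ.- q) w w′ x) (plus p (w ∙ x) q (w′ ∙ x))

        δ : Fin n → Vector ℤ n
        δ k = updateAt (const 0ℤ) k (const 1ℤ)

        δ∙ : ∀ k x → δ k ∙ x ≡ x k
        δ∙ k x = trans (∑-change {u = const 0ℤ} k (λ l l≢k → cong (ℤ._* x l) (updateAt-minimal l k (const 0ℤ) l≢k)))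
          (trans (cong₂ (λ s y → (s ℤ.- 0ℤ) ℤ.+ y ℤ.* x k) (∑-zero {n} {const 0ℤ} (λ _ → refl))
            (updateAt-updates k (const 0ℤ)))
            (simplify (x k)))
          where simplify : ∀ x → (0ℤ ℤ.- 0ℤ) ℤ.+ 1ℤ ℤ.* x ≡ x
                simplify = solve-ℤ

        δ≥0 : ∀ k l → 0ℤ ℤ.≤ δ k l
        δ≥0 k l with l Fin.≟ k
        ... | yes refl = subst (0ℤ ℤ.≤_) (sym (updateAt-updates l (const 0ℤ))) (ℤ.+≤+ ℕ.z≤n)
        ... | no l≢k = ℤP.≤-reflexive (sym (updateAt-minimal l k (const 0ℤ) l≢k))

        constraint : Fin n → Σ[ c ∈ Constraint 3 ] Derived c
        constraint k = (Vec.tabulate (A k) , φ Q T (A k)) ,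
          δ k , δ≥0 k , (λ j → trans (VecP.lookup∘tabulate (A k) j) (sym (δ∙ k (λ l → A l j)))) , sym
            (δ∙ k (φ Q T ∘ A))

      alternative : (Σ[ y ∈ Vector ℤ 3 ] Σ[ s ∈ ℤ ]
        (0ℤ ℤ.< s × (∀ a → a ∈ₗ entries → s ℤ.* φ Q T (proj₁ a) ℤ.≤ proj₁ a ∙ y)))
        ⊎ TerminalCert Q T
      alternative = [ inj₁ ∘ solution , inj₂ ∘ certificate ]′
        (farkas Derived (λ {a} {b} {a′} {b′} → derived-closed {a} {b} {a′} {b′}) (List.tabulate constraint))
        where
        solution : (Σ[ x ∈ Vec ℤ 3 ] Σ[ s ∈ ℤ ]
          (0ℤ ℤ.< s × (∀ c → c ∈ₗ List.tabulate constraint → Solves x s (proj₁ c)))) →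
          Σ[ y ∈ Vector ℤ 3 ] Σ[ s ∈ ℤ ] (0ℤ ℤ.< s × (∀ a → a ∈ₗ entries → s ℤ.* φ Q T (proj₁ a) ℤ.≤ proj₁ a ∙ y))
        solution (x , s , s>0 , sol) = Vec.lookup x , s , s>0 , λ a a∈ →
          subst (λ e → s ℤ.* φ Q T (proj₁ e) ℤ.≤ proj₁ e ∙ Vec.lookup x) (sym (lookup-index a∈))
            (subst (s ℤ.* φ Q T (A (Any.index a∈)) ℤ.≤_) (tabulate-· (A (Any.index a∈)) x)
              (sol (constraint (Any.index a∈)) (∈-tabulate⁺ (Any.index a∈))))
        certificate : Σ[ b ∈ ℤ ] (0ℤ ℤ.< b × Derived (Vec.replicate 3 0ℤ , b)) → TerminalCert Q T
        certificate (b , b>0 , w , w≥0 , bal , eq) = terminal (φ-concave Q T Q>0) (cert-4 record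
          { vectors = A ; weight = w ; nonzero = λ k → proj₂ (List.lookup entries k) ; weight≥0 = w≥0
          ; balanced = λ j → trans (sym (bal j)) (VecP.lookup-replicate j 0ℤ)
          ; positive = subst (0ℤ ℤ.<_) eq b>0 })

    duality : ¬ ¬ ((Σ[ y ∈ Vector ℤ 3 ] Σ[ s ∈ ℤ ] (0ℤ ℤ.< s × Feasible Q T y s)) ⊎ TerminalCert Q T)
    duality = ¬¬-Fin (λ i → dickson (suc m) (gaps i)) >>= λ bases →
      return ([ (λ (y , s , s>0 , sol) → inj₁ (y , s , s>0 , λ a a≢0 →
                  basis-suffices (vertex a) (bases (vertex a)) y s s>0
                    (λ b b∈ → sol (entry b) (entry∈ bases (vertex a) b b∈)) (a , a≢0 , refl)))
              , inj₂ ]′ (alternative (entries bases)))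
      where
      entry : ∀ {i} → Cone i → Entry
      entry (a , a≢0 , _) = a , a≢0
      entries : (∀ i → Basis (gaps i)) → List Entry
      entries bases = List.concat (List.tabulate λ i → List.map entry (proj₁ (bases i)))
      entry∈ : ∀ bases i (b : Cone i) → b ∈ₗ proj₁ (bases i) → entry b ∈ₗ entries bases
      entry∈ bases i b b∈ = ∈-concat⁺′ (∈-map⁺ entry b∈)
        (∈-tabulate⁺ {f = λ i → List.map entry (proj₁ (bases i))} i)

-- Rational and real numbers

ℚ-ring : ACR.AlmostCommutativeRing _ _
ℚ-ring = ACR.fromCommutativeRing ℚP.+-*-commutativeRing (λ x → dec⇒maybe (0ℚ ℚ.≟ x))

-- Turns an estimate into a ring identity with a visibly nonnegative slack d, which the solver can
-- check.
≤-by : ∀ {a b d} → 0ℚ ℚ.≤ d → b ≡ a ℚ.+ d → a ℚ.≤ b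
≤-by {a} {b} {d} d≥0 e = subst₂ ℚ._≤_ (ℚP.+-identityʳ a) (sym e) (ℚP.+-monoʳ-≤ a d≥0)

0≤-by : ∀ {a b} → a ℚ.≤ b → 0ℚ ℚ.≤ b ℚ.- a
0≤-by {a} {b} le = subst (ℚ._≤ b ℚ.- a) (ℚP.+-inverseʳ a) (ℚP.+-monoˡ-≤ (ℚ.- a) le)

0≤-* : ∀ {a b} → 0ℚ ℚ.≤ a → 0ℚ ℚ.≤ b → 0ℚ ℚ.≤ a ℚ.* b
0≤-* {a} {b} p q = subst (ℚ._≤ a ℚ.* b) (ℚP.*-zeroʳ a) (ℚP.*-monoˡ-≤-nonNeg a {{ℚ.nonNegative p}} q)

0<-* : ∀ {a b} → 0ℚ ℚ.< a → 0ℚ ℚ.< b → 0ℚ ℚ.< a ℚ.* b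
0<-* {a} {b} p q = subst (ℚ._< a ℚ.* b) (ℚP.*-zeroʳ a) (ℚP.*-monoʳ-<-pos a {{ℚ.positive p}} q)

0≤-+ : ∀ {a b} → 0ℚ ℚ.≤ a → 0ℚ ℚ.≤ b → 0ℚ ℚ.≤ a ℚ.+ b
0≤-+ {a} {b} p q = subst (ℚ._≤ a ℚ.+ b) (ℚP.+-identityˡ 0ℚ) (ℚP.+-mono-≤ p q)

<⇒≱ℚ : ∀ {a b} → a ℚ.< b → ¬ b ℚ.≤ a
<⇒≱ℚ lt le = ℚP.<-irrefl refl (ℚP.<-≤-trans lt le)

0<½ : 0ℚ ℚ.< ½
0<½ = ℚP.positive⁻¹ ½

0<1 : 0ℚ ℚ.< 1ℚ
0<1 = ℚP.positive⁻¹ 1ℚ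

opaque
  reciprocal : ∀ c → 0ℚ ℚ.< c → ∃[ r ] (0ℚ ℚ.< r × c ℚ.* r ≡ 1ℚ)
  reciprocal c c>0 = ℚ.1/ c , ℚP.positive⁻¹ (ℚ.1/ c) {{ℚP.1/pos⇒pos c}} , ℚP.*-inverseʳ c
    where instance
      c⁺ : ℚ.Positive c
      c⁺ = ℚ.positive c>0
      c≢0 : ℚ.NonZero c
      c≢0 = ℚP.pos⇒nonZero c

  -- Takes δ = ε / (1 + K), where the 1 allows K = 0.
  shrink-ε : ∀ {K ε} → 0ℚ ℚ.≤ K → 0ℚ ℚ.< ε → ∃[ δ ] (0ℚ ℚ.< δ × K ℚ.* δ ℚ.≤ ε)
  shrink-ε {K} {ε} K≥0 ε>0 with reciprocal (1ℚ ℚ.+ K) (ℚP.<-≤-trans 0<1 (≤-by {1ℚ} {1ℚ ℚ.+ K} {K} K≥0 refl))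
  ... | r , r>0 , e = r ℚ.* ε , δ>0 , ≤-by {K ℚ.* (r ℚ.* ε)} {ε} {r ℚ.* ε} (ℚP.<⇒≤ δ>0) (begin
    ε ≡⟨ ℚP.*-identityˡ ε ⟨
    1ℚ ℚ.* ε ≡⟨ cong (ℚ._* ε) e ⟨
    ((1ℚ ℚ.+ K) ℚ.* r) ℚ.* ε ≡⟨ shape K r ε ⟩
    K ℚ.* (r ℚ.* ε) ℚ.+ r ℚ.* ε ∎)
    where
    open ≡-Reasoning
    δ>0 : 0ℚ ℚ.< r ℚ.* ε
    δ>0 = 0<-* r>0 ε>0
    shape : ∀ K r ε → ((1ℚ ℚ.+ K) ℚ.* r) ℚ.* ε ≡ K ℚ.* (r ℚ.* ε) ℚ.+ r ℚ.* ε
    shape = solve-∀ ℚ-ring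

p≤∣p∣ : ∀ p → p ℚ.≤ ℚ.∣ p ∣
p≤∣p∣ p with ℚP.∣p∣≡p∨∣p∣≡-p p
... | inj₁ e = ℚP.≤-reflexive (sym e)
... | inj₂ e = ℚP.≤-trans p≤0 (ℚP.0≤∣p∣ p)
  where
  p≤0 : p ℚ.≤ 0ℚ
  p≤0 = ≤-by (ℚP.0≤∣p∣ p) (trans (sym (ℚP.+-inverseʳ p)) (cong (p ℚ.+_) (sym e)))

∣-∣≤⇒≤ : ∀ {a b ε} → ℚ.∣ a ℚ.- b ∣ ℚ.≤ ε → a ℚ.≤ b ℚ.+ ε
∣-∣≤⇒≤ {a} {b} {ε} le = ≤-by (0≤-by (ℚP.≤-trans (p≤∣p∣ (a ℚ.- b)) le)) (shape a b ε)
  where shape : ∀ a b ε → b ℚ.+ ε ≡ a ℚ.+ (ε ℚ.- (a ℚ.- b))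
        shape = solve-∀ ℚ-ring

∣-∣-sym : ∀ a b → ℚ.∣ a ℚ.- b ∣ ≡ ℚ.∣ b ℚ.- a ∣
∣-∣-sym a b = trans (sym (ℚP.∣-p∣≡∣p∣ (a ℚ.- b))) (cong ℚ.∣_∣ (shape a b))
  where shape : ∀ a b → ℚ.- (a ℚ.- b) ≡ b ℚ.- a
        shape = solve-∀ ℚ-ring

∣-∣≤⇒≥ : ∀ {a b ε} → ℚ.∣ a ℚ.- b ∣ ℚ.≤ ε → b ℚ.≤ a ℚ.+ ε
∣-∣≤⇒≥ {a} {b} {ε} le = ∣-∣≤⇒≤ (subst (ℚ._≤ ε) (∣-∣-sym a b) le)

≤⇒∣-∣≤ : ∀ {a b ε} → a ℚ.≤ b ℚ.+ ε → b ℚ.≤ a ℚ.+ ε → ℚ.∣ a ℚ.- b ∣ ℚ.≤ ε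
≤⇒∣-∣≤ {a} {b} {ε} p q with ℚP.∣p∣≡p∨∣p∣≡-p (a ℚ.- b)
... | inj₁ e = subst (ℚ._≤ ε) (sym e) (≤-by (0≤-by p) (shape a b ε))
  where shape : ∀ a b ε → ε ≡ (a ℚ.- b) ℚ.+ ((b ℚ.+ ε) ℚ.- a)
        shape = solve-∀ ℚ-ring
... | inj₂ e = subst (ℚ._≤ ε) (sym e) (≤-by (0≤-by q) (shape a b ε))
  where shape : ∀ a b ε → ε ≡ ℚ.- (a ℚ.- b) ℚ.+ ((a ℚ.+ ε) ℚ.- b)
        shape = solve-∀ ℚ-ring

*-cancel-≤ : ∀ {c a b} → 0ℚ ℚ.< c → c ℚ.* a ℚ.≤ c ℚ.* b → a ℚ.≤ b
*-cancel-≤ {c} c>0 = ℚP.*-cancelˡ-≤-pos c {{ℚ.positive c>0}}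

*-cancel-≡ : ∀ {c a b} → 0ℚ ℚ.< c → c ℚ.* a ≡ c ℚ.* b → a ≡ b
*-cancel-≡ c>0 e = ℚP.≤-antisym (*-cancel-≤ c>0 (ℚP.≤-reflexive e)) (*-cancel-≤ c>0 (ℚP.≤-reflexive (sym e)))

ι : ℤ → ℚ
ι i = i ℚ./ 1

private
  ιᵘ : ∀ i → ℚ.toℚᵘ (ι i) ℚᵘ.≃ ℚᵘ.mkℚᵘ i 0
  ιᵘ i = ℚP.toℚᵘ-fromℚᵘ (ℚᵘ.mkℚᵘ i 0)

ι-+ : ∀ i j → ι (i ℤ.+ j) ≡ ι i ℚ.+ ι j
ι-+ i j = ℚP.toℚᵘ-injective (begin
  ℚ.toℚᵘ (ι (i ℤ.+ j)) ≈⟨ ιᵘ (i ℤ.+ j) ⟩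
  ℚᵘ.mkℚᵘ (i ℤ.+ j) 0 ≈⟨ ℚᵘ.*≡* (cong (ℤ._* + 1) (cong₂ ℤ._+_ (sym (ℤP.*-identityʳ i)) (sym (ℤP.*-identityʳ j)))) ⟩
  ℚᵘ.mkℚᵘ i 0 ℚᵘ.+ ℚᵘ.mkℚᵘ j 0 ≈⟨ ℚᵘP.+-cong (ℚᵘP.≃-sym (ιᵘ i)) (ℚᵘP.≃-sym (ιᵘ j)) ⟩
  ℚ.toℚᵘ (ι i) ℚᵘ.+ ℚ.toℚᵘ (ι j) ≈⟨ ℚᵘP.≃-sym (ℚP.toℚᵘ-homo-+ (ι i) (ι j)) ⟩
  ℚ.toℚᵘ (ι i ℚ.+ ι j) ∎)
  where open ℚᵘP.≃-Reasoning

ι-* : ∀ i j → ι (i ℤ.* j) ≡ ι i ℚ.* ι j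
ι-* i j = ℚP.toℚᵘ-injective (begin
  ℚ.toℚᵘ (ι (i ℤ.* j)) ≈⟨ ιᵘ (i ℤ.* j) ⟩
  ℚᵘ.mkℚᵘ (i ℤ.* j) 0 ≈⟨ ℚᵘ.*≡* refl ⟩
  ℚᵘ.mkℚᵘ i 0 ℚᵘ.* ℚᵘ.mkℚᵘ j 0 ≈⟨ ℚᵘP.*-cong (ℚᵘP.≃-sym (ιᵘ i)) (ℚᵘP.≃-sym (ιᵘ j)) ⟩
  ℚ.toℚᵘ (ι i) ℚᵘ.* ℚ.toℚᵘ (ι j) ≈⟨ ℚᵘP.≃-sym (ℚP.toℚᵘ-homo-* (ι i) (ι j)) ⟩
  ℚ.toℚᵘ (ι i ℚ.* ι j) ∎)
  where open ℚᵘP.≃-Reasoning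

ι-neg : ∀ i → ι (ℤ.- i) ≡ ℚ.- ι i
ι-neg i = trans (trans (cong ι (sym (ℤP.-1*i≡-i i))) (ι-* (ℤ.- 1ℤ) i)) (shape (ι i))
  where shape : ∀ x → ℚ.- 1ℚ ℚ.* x ≡ ℚ.- x
        shape = solve-∀ ℚ-ring

ι-mono-≤ : ∀ i j → i ℤ.≤ j → ι i ℚ.≤ ι j
ι-mono-≤ i j le = ℚP.toℚᵘ-cancel-≤ (ℚᵘP.≤-respʳ-≃ (ℚᵘP.≃-sym (ιᵘ j)) (ℚᵘP.≤-respˡ-≃ (ℚᵘP.≃-sym (ιᵘ i))
  (ℚᵘ.*≤* (subst₂ ℤ._≤_ (sym (ℤP.*-identityʳ i)) (sym (ℤP.*-identityʳ j)) le))))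

ι-mono-< : ∀ i j → i ℤ.< j → ι i ℚ.< ι j
ι-mono-< i j le = ℚP.toℚᵘ-cancel-< (ℚᵘP.<-respʳ-≃ (ℚᵘP.≃-sym (ιᵘ j)) (ℚᵘP.<-respˡ-≃ (ℚᵘP.≃-sym (ιᵘ i))
  (ℚᵘ.*<* (subst₂ ℤ._<_ (sym (ℤP.*-identityʳ i)) (sym (ℤP.*-identityʳ j)) le))))

ι-cancel-≤ : ∀ i j → ι i ℚ.≤ ι j → i ℤ.≤ j
ι-cancel-≤ i j le = ℤP.≮⇒≥ (λ lt → <⇒≱ℚ (ι-mono-< j i lt) le)

/-spec : ∀ i n .{{_ : ℕ.NonZero n}} → ι (+ n) ℚ.* (i ℚ./ n) ≡ ι i
/-spec i n@(suc n-1) = ℚP.toℚᵘ-injective (begin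
  ℚ.toℚᵘ (ι (+ n) ℚ.* (i ℚ./ n)) ≈⟨ ℚP.toℚᵘ-homo-* (ι (+ n)) (i ℚ./ n) ⟩
  ℚ.toℚᵘ (ι (+ n)) ℚᵘ.* ℚ.toℚᵘ (i ℚ./ n) ≈⟨ ℚᵘP.*-cong (ιᵘ (+ n)) (ℚP.toℚᵘ-fromℚᵘ (ℚᵘ.mkℚᵘ i n-1)) ⟩
  ℚᵘ.mkℚᵘ (+ n) 0 ℚᵘ.* ℚᵘ.mkℚᵘ i n-1
    ≈⟨ ℚᵘ.*≡* (trans (ℤP.*-identityʳ (+ n ℤ.* i))
    (trans (ℤP.*-comm (+ n) i) (cong (i ℤ.*_) (cong +_ (sym (ℕP.*-identityˡ n)))))) ⟩
  ℚᵘ.mkℚᵘ i 0 ≈⟨ ℚᵘP.≃-sym (ιᵘ i) ⟩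
  ℚ.toℚᵘ (ι i) ∎)
  where open ℚᵘP.≃-Reasoning

archimedean : ∀ p → ∃[ n ] p ℚ.≤ ι (+ n)
archimedean p = ℤ.∣ ℚ.↥ p ∣ , *-cancel-≤ {ι (+ d)} d>0 (begin
  ι (+ d) ℚ.* p ≡⟨ cong (ι (+ d) ℚ.*_) (sym (ℚP.↥p/↧p≡p p)) ⟩
  ι (+ d) ℚ.* (ℚ.↥ p ℚ./ d) ≡⟨ /-spec (ℚ.↥ p) d ⟩
  ι (ℚ.↥ p) ≤⟨ ι-mono-≤ (ℚ.↥ p) (+ d ℤ.* + ℤ.∣ ℚ.↥ p ∣) (bound (ℚ.↥ p) d) ⟩
  ι (+ d ℤ.* + ℤ.∣ ℚ.↥ p ∣) ≡⟨ ι-* (+ d) (+ ℤ.∣ ℚ.↥ p ∣) ⟩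
  ι (+ d) ℚ.* ι (+ ℤ.∣ ℚ.↥ p ∣) ∎)
  where
  open ℚP.≤-Reasoning
  d = ℚ.↧ₙ p
  d>0 : 0ℚ ℚ.< ι (+ d)
  d>0 = ι-mono-< 0ℤ (+ d) (ℤ.+<+ (ℕ.s≤s ℕ.z≤n))
  bound : ∀ i d .{{_ : ℕ.NonZero d}} → i ℤ.≤ + d ℤ.* + ℤ.∣ i ∣
  bound (+ n) d = ℤP.≤-trans (ℤ.+≤+ (ℕP.m≤n*m n d)) (ℤP.≤-reflexive (ℤP.pos-* d n))
  bound ℤ.-[1+ n ] d = ℤP.≤-trans ℤ.-≤+ (ℤP.≤-reflexive (ℤP.pos-* d (suc n)))

module ℚΣ = SemiringSum (CommutativeRing.semiring ℚP.+-*-commutativeRing)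

Σℚ : ∀ {n} → Vector ℚ n → ℚ
Σℚ = ℚΣ.sum

ι-∑ : ∀ {n} (u : Vector ℤ n) → ι (∑ u) ≡ Σℚ (ι ∘ u)
ι-∑ {zero} u = cong ι (∑-nil u)
ι-∑ {suc n} u = trans (cong ι (∑-suc u)) (trans (ι-+ (u zero) (∑ (tail u))) (cong (ι (u zero) ℚ.+_) (ι-∑ (tail u))))

ι-∙ : ∀ {n} (u v : Vector ℤ n) → ι (u ∙ v) ≡ Σℚ (λ i → ι (u i) ℚ.* ι (v i))
ι-∙ u v = trans (ι-∑ (λ i → u i ℤ.* v i)) (ℚΣ.sum-cong-≗ (λ i → ι-* (u i) (v i)))

-- Order and arithmetic of Cauchy reals

Eventually : (ℕ → Set) → Set
Eventually P = ∃[ N ] (∀ n → N ℕ.≤ n → P n)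

ev-map : ∀ {P Q : ℕ → Set} → (∀ n → P n → Q n) → Eventually P → Eventually Q
ev-map f (N , p) = N , λ n le → f n (p n le)

ev-zip : ∀ {P Q : ℕ → Set} → Eventually P → Eventually Q → Eventually (λ n → P n × Q n)
ev-zip (M , p) (N , q) = M ℕ.⊔ N , λ n le → p n (ℕP.m⊔n≤o⇒m≤o M N le) , q n (ℕP.m⊔n≤o⇒n≤o M N le)

ev-witness : ∀ {P : ℕ → Set} → Eventually P → ∃[ n ] P n
ev-witness (N , p) = N , p N ℕP.≤-refl

pointwise-≤ : ∀ {x y} → (∀ n → seq x n ℚ.≤ seq y n) → x ≤ y
pointwise-≤ {x} {y} le ε ε>0 = 0 , λ n _ → ℚP.≤-trans (le n) (≤-by (ℚP.<⇒≤ ε>0) refl)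

pointwise : ∀ {x y} → (∀ n → seq x n ≡ seq y n) → x ≃ y
pointwise {x} {y} e ε ε>0 = 0 , λ n _ → subst (ℚ._≤ ε)
  (sym (trans (cong (λ z → ℚ.∣ z ℚ.- seq y n ∣) (e n)) (cong ℚ.∣_∣ (ℚP.+-inverseʳ (seq y n))))) (ℚP.<⇒≤ ε>0)

≤-scaled : ∀ {x y} K → 0ℚ ℚ.≤ K → (∀ ε → 0ℚ ℚ.< ε → Eventually (λ n → seq x n ℚ.≤ seq y n ℚ.+ K ℚ.* ε)) → x ≤ y
≤-scaled {x} {y} K K≥0 f ε ε>0 =
  let δ , δ>0 , le = shrink-ε K≥0 ε>0 in
  ev-map (λ n p → ℚP.≤-trans p (ℚP.+-monoʳ-≤ (seq y n) le)) (f δ δ>0)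

≃⇒≤ : ∀ {x y} → x ≃ y → x ≤ y
≃⇒≤ e ε ε>0 = ev-map (λ n → ∣-∣≤⇒≤) (e ε ε>0)

≃-sym : ∀ {x y} → x ≃ y → y ≃ x
≃-sym {x} {y} e ε ε>0 = ev-map (λ n → subst (ℚ._≤ ε) (∣-∣-sym (seq x n) (seq y n))) (e ε ε>0)

≃⇒≥ : ∀ {x y} → x ≃ y → y ≤ x
≃⇒≥ {x} {y} e = ≃⇒≤ {y} {x} (≃-sym {x} {y} e)

≤-antisym : ∀ {x y} → x ≤ y → y ≤ x → x ≃ y
≤-antisym p q ε ε>0 = ev-map (λ n (a , b) → ≤⇒∣-∣≤ a b) (ev-zip (p ε ε>0) (q ε ε>0))

≤-trans : ∀ {x y z} → x ≤ y → y ≤ z → x ≤ z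
≤-trans {x} {y} {z} p q = ≤-scaled {x} {z} (1ℚ ℚ.+ 1ℚ) (ℚP.<⇒≤ (ℚP.positive⁻¹ (1ℚ ℚ.+ 1ℚ))) λ ε ε>0 →
  ev-map (λ n (a , b) → ≤-by (0≤-+ (0≤-by a) (0≤-by b)) (shape (seq x n) (seq y n) (seq z n) ε))
    (ev-zip (p ε ε>0) (q ε ε>0))
  where shape : ∀ x y z ε → z ℚ.+ (1ℚ ℚ.+ 1ℚ) ℚ.* ε ≡ x ℚ.+ (((y ℚ.+ ε) ℚ.- x) ℚ.+ ((z ℚ.+ ε) ℚ.- y))
        shape = solve-∀ ℚ-ring

≃-trans : ∀ {x y z} → x ≃ y → y ≃ z → x ≃ z
≃-trans {x} {y} {z} p q = ≤-antisym {x} {z} (≤-trans {x} {y} {z} (≃⇒≤ {x} {y} p) (≃⇒≤ {y} {z} q))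
  (≤-trans {z} {y} {x} (≃⇒≥ {y} {z} q) (≃⇒≥ {x} {y} p))

≤-preorder : Preorder _ _ _
≤-preorder = record
  { Carrier = ℝ ; _≈_ = _≃_ ; _≲_ = _≤_
  ; isPreorder = record
    { isEquivalence = record
      { refl = λ {x} → pointwise {x} {x} λ _ → refl
      ; sym = λ {x} {y} → ≃-sym {x} {y}
      ; trans = λ {x} {y} {z} → ≃-trans {x} {y} {z} }
    ; reflexive = λ {x} {y} → ≃⇒≤ {x} {y}
    ; trans = λ {x} {y} {z} → ≤-trans {x} {y} {z} } }

module ℝ-Reasoning = PreorderReasoning ≤-preorder

+-mono-≤ : ∀ {x x′ y y′} → x ≤ x′ → y ≤ y′ → x + y ≤ x′ + y′
+-mono-≤ {x} {x′} {y} {y′} p q = ≤-scaled {x + y} {x′ + y′} (1ℚ ℚ.+ 1ℚ) (ℚP.<⇒≤ (ℚP.positive⁻¹ (1ℚ ℚ.+ 1ℚ))) λ ε ε>0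
  →
  ev-map (λ n (a , b) → ≤-by (0≤-+ (0≤-by a) (0≤-by b)) (shape (seq x n) (seq x′ n) (seq y n) (seq y′ n) ε))
    (ev-zip (p ε ε>0) (q ε ε>0))
  where shape : ∀ x x′ y y′ ε → (x′ ℚ.+ y′) ℚ.+ (1ℚ ℚ.+ 1ℚ) ℚ.* ε ≡ (x ℚ.+ y) ℚ.+ (((x′ ℚ.+ ε) ℚ.- x) ℚ.+ ((y′ ℚ.+ ε) ℚ.- y))
        shape = solve-∀ ℚ-ring

scale-≤ : ∀ {c x y} → 0ℚ ℚ.≤ c → x ≤ y → fromℚ c * x ≤ fromℚ c * y
scale-≤ {c} {x} {y} c≥0 p = ≤-scaled {fromℚ c * x} {fromℚ c * y} c c≥0 λ ε ε>0 →
  ev-map (λ n a → ≤-by (0≤-* c≥0 (0≤-by a)) (shape c (seq x n) (seq y n) ε)) (p ε ε>0)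
  where shape : ∀ c x y ε → c ℚ.* y ℚ.+ c ℚ.* ε ≡ c ℚ.* x ℚ.+ c ℚ.* ((y ℚ.+ ε) ℚ.- x)
        shape = solve-∀ ℚ-ring

scale-cancel-≤ : ∀ {c x y} → 0ℚ ℚ.< c → fromℚ c * x ≤ fromℚ c * y → x ≤ y
scale-cancel-≤ {c} {x} {y} c>0 p with reciprocal c c>0
... | r , r>0 , e = ≤-scaled {x} {y} r (ℚP.<⇒≤ r>0) λ ε ε>0 →
  ev-map (λ n a → subst₂ ℚ._≤_ (restore (seq x n))
    (trans (ℚP.*-distribˡ-+ r _ ε) (cong (ℚ._+ r ℚ.* ε) (restore (seq y n))))
    (ℚP.*-monoˡ-≤-nonNeg r {{ℚ.nonNegative (ℚP.<⇒≤ r>0)}} a)) (p ε ε>0)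
  where
  shape : ∀ r c z → r ℚ.* (c ℚ.* z) ≡ (c ℚ.* r) ℚ.* z
  shape = solve-∀ ℚ-ring
  restore : ∀ z → r ℚ.* (c ℚ.* z) ≡ z
  restore z = trans (shape r c z) (trans (cong (ℚ._* z) e) (ℚP.*-identityˡ z))

*-congʳ : ∀ {x y} z → x ≃ y → x * z ≃ y * z
*-congʳ {x} {y} z e with cauchy z 1ℚ 0<1
... | M , close = λ ε ε>0 → let δ , δ>0 , Bδ≤ε = shrink-ε B≥0 ε>0 in
  ev-map (λ n (p , q) → ℚP.≤-trans
    (ℚP.≤-reflexive (trans (cong ℚ.∣_∣ (factor (seq x n) (seq y n) (seq z n)))
    (ℚP.∣p*q∣≡∣p∣*∣q∣ (seq z n) (seq x n ℚ.- seq y n))))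
    (ℚP.≤-trans (ℚP.*-monoʳ-≤-nonNeg ℚ.∣ seq x n ℚ.- seq y n ∣ {{ℚ.nonNegative (ℚP.0≤∣p∣ (seq x n ℚ.- seq y n))}} q)
      (ℚP.≤-trans (ℚP.*-monoˡ-≤-nonNeg B {{ℚ.nonNegative B≥0}} p) Bδ≤ε)))
    (ev-zip (e δ δ>0) (M , bounded))
  where
  B = 1ℚ ℚ.+ ℚ.∣ seq z M ∣
  B≥0 : 0ℚ ℚ.≤ B
  B≥0 = 0≤-+ (ℚP.<⇒≤ 0<1) (ℚP.0≤∣p∣ (seq z M))
  factor : ∀ x y z → x ℚ.* z ℚ.- y ℚ.* z ≡ z ℚ.* (x ℚ.- y)
  factor = solve-∀ ℚ-ring
  recentre′ : ∀ a b → a ≡ (a ℚ.- b) ℚ.+ b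
  recentre′ = solve-∀ ℚ-ring
  bounded : ∀ n → M ℕ.≤ n → ℚ.∣ seq z n ∣ ℚ.≤ B
  bounded n M≤n = ℚP.≤-trans (ℚP.≤-reflexive (cong ℚ.∣_∣ (recentre′ (seq z n) (seq z M))))
    (ℚP.≤-trans (ℚP.∣p+q∣≤∣p∣+∣q∣ (seq z n ℚ.- seq z M) (seq z M))
      (ℚP.+-monoˡ-≤ ℚ.∣ seq z M ∣ (close n M M≤n ℕP.≤-refl)))

*-comm-≃ : ∀ x y → x * y ≃ y * x
*-comm-≃ x y = pointwise {x * y} {y * x} (λ n → ℚP.*-comm (seq x n) (seq y n))

*-congˡ : ∀ {x y} z → x ≃ y → z * x ≃ z * y
*-congˡ {x} {y} z e = ≃-trans {z * x} {x * z} {z * y} (*-comm-≃ z x)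
  (≃-trans {x * z} {y * z} {z * y} (*-congʳ {x} {y} z e) (*-comm-≃ y z))

weight-≤ : ∀ {w p q} → 0ℝ ≤ w → p ℚ.≤ q → w * fromℚ p ≤ w * fromℚ q
weight-≤ {w} {p} {q} w≥0 le = ≤-scaled {w * fromℚ p} {w * fromℚ q} (q ℚ.- p) (0≤-by le) λ ε ε>0 →
  ev-map (λ n a → ≤-by (0≤-* (0≤-by le) a) (shape (seq w n) p q ε)) (w≥0 ε ε>0)
  where shape : ∀ w p q ε → w ℚ.* q ℚ.+ (q ℚ.- p) ℚ.* ε ≡ w ℚ.* p ℚ.+ (q ℚ.- p) ℚ.* (w ℚ.+ ε)
        shape = solve-∀ ℚ-ring

seq-sum : ∀ {n} (x : Vector ℝ n) k → seq (sum x) k ≡ Σℚ (λ i → seq (x i) k)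
seq-sum {zero} x k = refl
seq-sum {suc n} x k = cong (seq (x zero) k ℚ.+_) (seq-sum (tail x) k)

sum-≤ : ∀ {n} {x y : Vector ℝ n} → (∀ i → x i ≤ y i) → sum x ≤ sum y
sum-≤ {zero} p = pointwise-≤ {sum {zero} (λ ())} {sum {zero} (λ ())} (λ n → ℚP.≤-refl)
sum-≤ {suc n} {x} {y} p = +-mono-≤ {x zero} {y zero} {sum (tail x)} {sum (tail y)} (p zero) (sum-≤ (p ∘ suc))

sum-≃ : ∀ {n} {x y : Vector ℝ n} → (∀ i → x i ≃ y i) → sum x ≃ sum y
sum-≃ {x = x} {y} e = ≤-antisym {sum x} {sum y} (sum-≤ (λ i → ≃⇒≤ {x i} {y i} (e i)))
  (sum-≤ (λ i → ≃⇒≥ {x i} {y i} (e i)))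

fromℚ-≤ : ∀ {p q} → p ℚ.≤ q → fromℚ p ≤ fromℚ q
fromℚ-≤ {p} {q} le = pointwise-≤ {fromℚ p} {fromℚ q} (λ _ → le)

<⇒≱ : ∀ {x y} → x < y → ¬ y ≤ x
<⇒≱ {x} {y} (ε , ε>0 , ev) y≤x with ev-witness (ev-zip ev (y≤x (½ ℚ.* ε) (0<-* 0<½ ε>0)))
... | n , p , q = <⇒≱ℚ (0<-* 0<½ ε>0) (≤-by (0≤-+ (0≤-by p) (0≤-by q)) (shape (seq x n) (seq y n) ε))
  where shape : ∀ x y ε → 0ℚ ≡ ½ ℚ.* ε ℚ.+ ((y ℚ.- (x ℚ.+ ε)) ℚ.+ ((x ℚ.+ ½ ℚ.* ε) ℚ.- y))
        shape = solve-∀ ℚ-ring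

-- Beyond some K both sequences stay within ε of their K-th terms, and x_K ≤ y_K + 4 ε is decidable.
-- If it holds, then x ≤ y + 6 ε from K on; if it fails, then y + ε ≤ x from K on, which refutes x ≤
-- y.
stable-≤ : ∀ {x y} → ¬ ¬ (x ≤ y) → x ≤ y
stable-≤ {x} {y} ¬¬le = ≤-scaled {x} {y} six (ℚP.<⇒≤ (ℚP.positive⁻¹ six)) λ ε ε>0 →
  let M , p = cauchy x ε ε>0 ; N , q = cauchy y ε ε>0 in
  go ε ε>0 (M ℕ.⊔ N) (λ n le → p n (M ℕ.⊔ N) (ℕP.m⊔n≤o⇒m≤o M N le) (ℕP.m≤m⊔n M N))
    (λ n le → q n (M ℕ.⊔ N) (ℕP.m⊔n≤o⇒n≤o M N le) (ℕP.m≤n⊔m M N))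
  where
  three six : ℚ
  three = 1ℚ ℚ.+ 1ℚ ℚ.+ 1ℚ
  six = three ℚ.+ three
  go : ∀ ε → 0ℚ ℚ.< ε → ∀ K → (∀ n → K ℕ.≤ n → ℚ.∣ seq x n ℚ.- seq x K ∣ ℚ.≤ ε) →
    (∀ n → K ℕ.≤ n → ℚ.∣ seq y n ℚ.- seq y K ∣ ℚ.≤ ε) → Eventually (λ n → seq x n ℚ.≤ seq y n ℚ.+ six ℚ.* ε)
  go ε ε>0 K p q with seq x K ℚ.≤? seq y K ℚ.+ (three ℚ.+ 1ℚ) ℚ.* ε
  ... | yes le = K , λ n K≤n → ≤-by
    (0≤-+ (0≤-+ (0≤-by (∣-∣≤⇒≤ {seq x n} {seq x K} (p n K≤n))) (0≤-by le))
    (0≤-by (∣-∣≤⇒≥ {seq y n} {seq y K} (q n K≤n)))) (shape (seq x n) (seq x K) (seq y n) (seq y K) ε)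
    where shape : ∀ x x′ y y′ ε → y ℚ.+ (1ℚ ℚ.+ 1ℚ ℚ.+ 1ℚ ℚ.+ (1ℚ ℚ.+ 1ℚ ℚ.+ 1ℚ)) ℚ.* ε ≡ x ℚ.+ (((x′ ℚ.+ ε) ℚ.- x) ℚ.+ ((y′ ℚ.+ (1ℚ ℚ.+ 1ℚ ℚ.+ 1ℚ ℚ.+ 1ℚ) ℚ.* ε) ℚ.- x′) ℚ.+ ((y ℚ.+ ε) ℚ.- y′))
          shape = solve-∀ ℚ-ring
  ... | no gt = contradiction (λ x≤y → <⇒≱ {y} {x} (ε , ε>0 , K , λ n K≤n →
      ≤-by (0≤-+ (ℚP.<⇒≤ ε>0) (0≤-+
        (0≤-+ (0≤-by (∣-∣≤⇒≥ {seq x n} {seq x K} (p n K≤n))) (0≤-by (ℚP.<⇒≤ (ℚP.≰⇒> gt))))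
        (0≤-by (∣-∣≤⇒≤ {seq y n} {seq y K} (q n K≤n))))) (shape (seq x n) (seq x K) (seq y n) (seq y K) ε)) x≤y)
        ¬¬le
    where shape : ∀ x x′ y y′ ε → x ≡ (y ℚ.+ ε) ℚ.+ (ε ℚ.+ (((x ℚ.+ ε) ℚ.- x′) ℚ.+ (x′ ℚ.- (y′ ℚ.+ (1ℚ ℚ.+ 1ℚ ℚ.+ 1ℚ ℚ.+ 1ℚ) ℚ.* ε)) ℚ.+ ((y′ ℚ.+ ε) ℚ.- y)))
          shape = solve-∀ ℚ-ring

stable-≃ : ∀ {x y} → ¬ ¬ (x ≃ y) → x ≃ y
stable-≃ {x} {y} ¬¬e = ≤-antisym {x} {y} (stable-≤ {x} {y} (λ k → ¬¬e (k ∘ ≃⇒≤ {x} {y})))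
  (stable-≤ {y} {x} (λ k → ¬¬e (k ∘ ≃⇒≥ {x} {y})))

∣-∣-triangle : ∀ a b c {δ ε} → ℚ.∣ a ℚ.- b ∣ ℚ.≤ δ → ℚ.∣ b ℚ.- c ∣ ℚ.≤ ε → ℚ.∣ a ℚ.- c ∣ ℚ.≤ δ ℚ.+ ε
∣-∣-triangle a b c p q = ℚP.≤-trans (ℚP.≤-reflexive (cong ℚ.∣_∣ (telescope a b c)))
  (ℚP.≤-trans (ℚP.∣p+q∣≤∣p∣+∣q∣ (a ℚ.- b) (b ℚ.- c)) (ℚP.+-mono-≤ p q))
  where telescope : ∀ a b c → a ℚ.- c ≡ (a ℚ.- b) ℚ.+ (b ℚ.- c)
        telescope = solve-∀ ℚ-ring

ι-gap : ∀ m m′ → ℚ.∣ ι (+ m) ℚ.- ι (+ m′) ∣ ℚ.≤ ½ → m ℕ.≤ m′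
ι-gap m m′ le = ℕP.≮⇒≥ λ m′<m → contradict (ι (+ m)) (ι (+ m′)) le
    (subst (ℚ._≤ ι (+ m)) (ι-+ 1ℤ (+ m′)) (ι-mono-≤ (1ℤ ℤ.+ + m′) (+ m) (ℤ.+≤+ m′<m)))
  where
  shape : ∀ p q → 0ℚ ≡ ½ ℚ.+ (((q ℚ.+ ½) ℚ.- p) ℚ.+ (p ℚ.- (1ℚ ℚ.+ q)))
  shape = solve-∀ ℚ-ring
  contradict : ∀ p q → ℚ.∣ p ℚ.- q ∣ ℚ.≤ ½ → ¬ 1ℚ ℚ.+ q ℚ.≤ p
  contradict p q le lt = <⇒≱ℚ 0<½ (≤-by (0≤-+ (0≤-by (∣-∣≤⇒≤ {p} {q} le)) (0≤-by lt)) (shape p q))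

-- Reading off a natural number from an approximation

module Decode (x : ℝ) (R : ℕ → Set) (¬¬m : ¬ ¬ (∃[ m ] (x ≃ fromℤ (+ m) × R m)))
  (δ : ℚ) (δ>0 : 0ℚ ℚ.< δ) (4δ≤½ : (δ ℚ.+ δ) ℚ.+ (δ ℚ.+ δ) ℚ.≤ ½) where

  private
    K : ℕ
    K = proj₁ (cauchy x δ δ>0)

    r : ℚ
    r = seq x K

    Near : ℕ → Set
    Near m = ℚ.∣ r ℚ.- ι (+ m) ∣ ℚ.≤ δ ℚ.+ δ

    near : ∀ m → x ≃ fromℤ (+ m) → Near m
    near m e = via (e δ δ>0)
      where
      via : Eventually (λ n → ℚ.∣ seq x n ℚ.- ι (+ m) ∣ ℚ.≤ δ) → Near m
      via (N , p) = ∣-∣-triangle r (seq x (K ℕ.⊔ N)) (ι (+ m))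
        (proj₂ (cauchy x δ δ>0) K (K ℕ.⊔ N) ℕP.≤-refl (ℕP.m≤m⊔n K N)) (p (K ℕ.⊔ N) (ℕP.m≤n⊔m K N))

    near-unique : ∀ m m′ → Near m → Near m′ → m ℕ.≤ m′
    near-unique m m′ p q = ι-gap m m′ (ℚP.≤-trans
      (∣-∣-triangle (ι (+ m)) r (ι (+ m′)) (subst (ℚ._≤ δ ℚ.+ δ) (∣-∣-sym r (ι (+ m))) p) q) 4δ≤½)

    bound : ∃[ n ] r ℚ.+ (δ ℚ.+ δ) ℚ.≤ ι (+ n)
    bound = archimedean (r ℚ.+ (δ ℚ.+ δ))

    near< : ∀ m → Near m → m ℕ.< suc (proj₁ bound)
    near< m p = ℕ.s≤s (ℤP.drop‿+≤+
      (ι-cancel-≤ (+ m) (+ proj₁ bound) (ℚP.≤-trans (∣-∣≤⇒≥ {r} {ι (+ m)} p) (proj₂ bound))))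

    search : Dec (∃[ m ] (m ℕ.< suc (proj₁ bound) × Near m)) → ∃[ m ] Near m
    search (yes (m , _ , p)) = m , p
    search (no none) = contradiction (λ (m , e , _) → none (m , near< m (near m e) , near m e)) ¬¬m

    found : ∃[ m ] Near m
    found = search (ℕP.anyUpTo? (λ m → ℚ.∣ r ℚ.- ι (+ m) ∣ ℚ.≤? δ ℚ.+ δ) (suc (proj₁ bound)))

    same : ∀ m → x ≃ fromℤ (+ m) → m ≡ proj₁ found
    same m e = ℕP.≤-antisym (near-unique m (proj₁ found) (near m e) (proj₂ found))
      (near-unique (proj₁ found) m (proj₂ found) (near m e))

  decoded : ∃[ m ] (x ≃ fromℤ (+ m) × ¬ ¬ R m)
  decoded = proj₁ found
    , stable-≃ {x} {fromℤ (+ proj₁ found)}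
      (λ k → ¬¬m λ (m , e , _) → k (subst (λ m → x ≃ fromℤ (+ m)) (same m e) e))
    , λ k → ¬¬m λ (m , e , Rm) → k (subst R (same m e) Rm)

-- With δ = 1 / 8, one term of x lies within 2 δ of the unknown m, and being that near is decidable,
-- so a bounded search finds a candidate. Two candidates differ by at most 4 δ = 1 / 2 and therefore
-- agree. Only R stays under double negation.
decode : ∀ x (R : ℕ → Set) → ¬ ¬ (∃[ m ] (x ≃ fromℤ (+ m) × R m)) → ∃[ m ] (x ≃ fromℤ (+ m) × ¬ ¬ R m)
decode x R ¬¬m = Decode.decoded x R ¬¬m (½ ℚ.* (½ ℚ.* ½)) (ℚP.positive⁻¹ (½ ℚ.* (½ ℚ.* ½))) ℚP.≤-refl

-- Fine adjoints of hulls

module ℚΣ′ = MonoidSum ℚP.+-0-commutativeMonoid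

Σℚ-cong : ∀ {n} {u v : Vector ℚ n} → u ≗ v → Σℚ u ≡ Σℚ v
Σℚ-cong = ℚΣ.sum-cong-≗

Σℚ-+ : ∀ {n} (u v : Vector ℚ n) → Σℚ (λ i → u i ℚ.+ v i) ≡ Σℚ u ℚ.+ Σℚ v
Σℚ-+ = ℚΣ′.∑-distrib-+

Σℚ-*ˡ : ∀ {n} c (u : Vector ℚ n) → Σℚ (λ i → c ℚ.* u i) ≡ c ℚ.* Σℚ u
Σℚ-*ˡ c u = sym (ℚΣ.*-distribˡ-sum c u)

Σℚ-*ʳ : ∀ {n} c (u : Vector ℚ n) → Σℚ (λ i → u i ℚ.* c) ≡ Σℚ u ℚ.* c
Σℚ-*ʳ c u = sym (ℚΣ.*-distribʳ-sum c u)

Σℚ-swap : ∀ {n k} (u : Vector ℚ n) (M : Fin n → Fin k → ℚ) (v : Vector ℚ k) →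
  Σℚ (λ i → u i ℚ.* Σℚ (λ j → M i j ℚ.* v j)) ≡ Σℚ (λ j → Σℚ (λ i → u i ℚ.* M i j) ℚ.* v j)
Σℚ-swap u M v = begin
  Σℚ (λ i → u i ℚ.* Σℚ (λ j → M i j ℚ.* v j)) ≡⟨ Σℚ-cong (λ i → sym (Σℚ-*ˡ (u i) (λ j → M i j ℚ.* v j))) ⟩
  Σℚ (λ i → Σℚ (λ j → u i ℚ.* (M i j ℚ.* v j))) ≡⟨ ℚΣ′.∑-comm (λ i j → u i ℚ.* (M i j ℚ.* v j)) ⟩
  Σℚ (λ j → Σℚ (λ i → u i ℚ.* (M i j ℚ.* v j)))
    ≡⟨ Σℚ-cong (λ j → trans (Σℚ-cong (λ i → sym (ℚP.*-assoc (u i) (M i j) (v j))))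
    (Σℚ-*ʳ (v j) (λ i → u i ℚ.* M i j))) ⟩
  Σℚ (λ j → Σℚ (λ i → u i ℚ.* M i j) ℚ.* v j) ∎
  where open ≡-Reasoning

seq-⟨⟩ : ∀ {d} (a : Covector d) (x : Point d) n → seq ⟨ a , x ⟩ n ≡ Σℚ (λ j → ι (a j) ℚ.* seq (x j) n)
seq-⟨⟩ a x n = seq-sum (λ j → fromℤ (a j) * x j) n

⟨⟩-cong : ∀ {d} (a : Covector d) {x y : Point d} → (∀ j → x j ≃ y j) → ⟨ a , x ⟩ ≃ ⟨ a , y ⟩
⟨⟩-cong a {x} {y} e = sum-≃ (λ j → *-congˡ {x j} {y j} (fromℤ (a j)) (e j))

module _ {d n : ℕ} (G : Fin n → Vector ℤ d) where

  hull : Pred (Point d) _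
  hull = conv (λ i j → fromℤ (G i j))

  private
    e : Fin n → Vector ℝ n
    e i = updateAt (const 0ℝ) i (const 1ℝ)

  seq-unit : ∀ {n} (i : Fin n) (f : Vector ℚ n) k → Σℚ (λ l → seq (updateAt (const 0ℝ) i (const 1ℝ) l) k ℚ.* f l) ≡
    f i
  seq-unit {suc n} zero f k = trans (cong₂ ℚ._+_ (ℚP.*-identityˡ (f zero))
    (trans (Σℚ-*ˡ 0ℚ (f ∘ suc)) (ℚP.*-zeroˡ (Σℚ (f ∘ suc))))) (ℚP.+-identityʳ (f zero))
  seq-unit {suc n} (suc i) f k = trans (cong₂ ℚ._+_ (ℚP.*-zeroˡ (f zero)) (seq-unit i (f ∘ suc) k))
    (ℚP.+-identityˡ (f (suc i)))

  unit≥0 : ∀ {n} (i l : Fin n) → 0ℝ ≤ updateAt (const 0ℝ) i (const 1ℝ) l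
  unit≥0 zero zero = fromℚ-≤ (ℚP.<⇒≤ 0<1)
  unit≥0 zero (suc l) = fromℚ-≤ ℚP.≤-refl
  unit≥0 (suc i) zero = fromℚ-≤ ℚP.≤-refl
  unit≥0 (suc i) (suc l) = unit≥0 i l

  vertex-∈ : ∀ i → (λ j → fromℤ (G i j)) ∈ hull
  vertex-∈ i = e i , unit≥0 i
    , pointwise {sum (e i)} {1ℝ} (λ k → trans (seq-sum (e i) k)
        (trans (Σℚ-cong (λ l → sym (ℚP.*-identityʳ (seq (e i l) k)))) (seq-unit i (const 1ℚ) k)))
    , λ j → pointwise {fromℤ (G i j)} {sum (λ l → e i l * fromℤ (G l j))} (λ k →
        sym (trans (seq-sum (λ l → e i l * fromℤ (G l j)) k) (seq-unit i (λ l → ι (G l j)) k)))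

module _ {m} (G : Fin (suc m) → Vector ℤ 3) where

  open Support G

  support-lower : ∀ a x → x ∈ hull G → fromℤ (h a) ≤ ⟨ a , x ⟩
  support-lower a x (w , w≥0 , Σw≃1 , x≃) = let open ℝ-Reasoning in begin
    fromℤ (h a) ≈⟨ pointwise {fromℤ (h a)} {fromℤ (h a) * 1ℝ} (λ n → sym (ℚP.*-identityʳ (ι (h a)))) ⟩
    fromℤ (h a) * 1ℝ ≈⟨ *-congˡ {1ℝ} {sum w} (fromℤ (h a)) (≃-sym {sum w} {1ℝ} Σw≃1) ⟩
    fromℤ (h a) * sum w ≈⟨ pointwise {fromℤ (h a) * sum w} {sum (λ i → w i * fromℤ (h a))} expand ⟩
    sum (λ i → w i * fromℤ (h a))       ≲⟨ sum-≤ {x = λ i → w i * fromℤ (h a)} {y = λ i → w i * fromℤ (a ∙ G i)}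
                                             (λ i → weight-≤ {w i} (w≥0 i) (ι-mono-≤ (h a) (a ∙ G i) (h≤ a i))) ⟩
    sum (λ i → w i * fromℤ (a ∙ G i)) ≈⟨ pointwise {sum (λ i → w i * fromℤ (a ∙ G i))} {⟨ a , y ⟩} regroup ⟩
    ⟨ a , y ⟩ ≈⟨ ⟨⟩-cong a {y} {x} (λ j → ≃-sym {x j} {y j} (x≃ j)) ⟩
    ⟨ a , x ⟩ ∎
    where
    y : Point 3
    y j = sum (λ i → w i * fromℤ (G i j))
    expand : ∀ n → ι (h a) ℚ.* seq (sum w) n ≡ seq (sum (λ i → w i * fromℤ (h a))) n
    expand n = begin
      ι (h a) ℚ.* seq (sum w) n ≡⟨ cong (ι (h a) ℚ.*_) (seq-sum w n) ⟩
      ι (h a) ℚ.* Σℚ (λ i → seq (w i) n) ≡⟨ ℚP.*-comm (ι (h a)) (Σℚ (λ i → seq (w i) n)) ⟩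
      Σℚ (λ i → seq (w i) n) ℚ.* ι (h a) ≡⟨ Σℚ-*ʳ (ι (h a)) (λ i → seq (w i) n) ⟨
      Σℚ (λ i → seq (w i) n ℚ.* ι (h a)) ≡⟨ seq-sum (λ i → w i * fromℤ (h a)) n ⟨
      seq (sum (λ i → w i * fromℤ (h a))) n ∎
      where open ≡-Reasoning
    regroup : ∀ n → seq (sum (λ i → w i * fromℤ (a ∙ G i))) n ≡ seq ⟨ a , y ⟩ n
    regroup n = begin
      seq (sum (λ i → w i * fromℤ (a ∙ G i))) n
        ≡⟨ seq-sum (λ i → w i * fromℤ (a ∙ G i)) n ⟩
      Σℚ (λ i → seq (w i) n ℚ.* ι (a ∙ G i))
        ≡⟨ Σℚ-cong (λ i → cong (seq (w i) n ℚ.*_)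
          (trans (ι-∙ a (G i)) (Σℚ-cong (λ j → ℚP.*-comm (ι (a j)) (ι (G i j)))))) ⟩
      Σℚ (λ i → seq (w i) n ℚ.* Σℚ (λ j → ι (G i j) ℚ.* ι (a j)))
        ≡⟨ Σℚ-swap (λ i → seq (w i) n) (λ i j → ι (G i j)) (λ j → ι (a j)) ⟩
      Σℚ (λ j → Σℚ (λ i → seq (w i) n ℚ.* ι (G i j)) ℚ.* ι (a j))
        ≡⟨ Σℚ-cong (λ j → trans (ℚP.*-comm (Σℚ (λ i → seq (w i) n ℚ.* ι (G i j))) (ι (a j)))
          (cong (ι (a j) ℚ.*_) (sym (seq-sum (λ i → w i * fromℤ (G i j)) n)))) ⟩
      Σℚ (λ j → ι (a j) ℚ.* seq (y j) n)
        ≡⟨ seq-⟨⟩ a y n ⟨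
      seq ⟨ a , y ⟩ n ∎
      where open ≡-Reasoning

  isSupportValue : ∀ a → IsSupportValue (hull G) a (fromℤ (h a))
  isSupportValue a = ((λ j → fromℤ (v j)) , vertex-∈ G (vertex a)
      , pointwise {fromℤ (h a)} {⟨ a , (λ j → fromℤ (v j)) ⟩}
        (λ n → trans (ι-∙ a v) (sym (seq-⟨⟩ a (λ j → fromℤ (v j)) n))))
    , λ t (x , x∈ , t≃) → ≤-trans {fromℤ (h a)} {⟨ a , x ⟩} {t} (support-lower a x x∈) (≃⇒≥ {t} {⟨ a , x ⟩} t≃)
    where v = G (vertex a)

  AdjointInequalities : ℝ → Point 3 → Set
  AdjointInequalities s x = ∀ a → Nonzero a → fromℤ (h a) + s ≤ ⟨ a , x ⟩

  adjoint⇒inequalities : ∀ s x → x ∈ FineAdjoint (hull G) s → AdjointInequalities s x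
  adjoint⇒inequalities s x adj a a≢0 with adj a a≢0
  ... | h′ , ((x′ , x′∈ , h′≃) , _) , le = ≤-trans {fromℤ (h a) + s} {h′ + s} {⟨ a , x ⟩}
    (+-mono-≤ {fromℤ (h a)} {h′} {s} {s}
      (≤-trans {fromℤ (h a)} {⟨ a , x′ ⟩} {h′} (support-lower a x′ x′∈) (≃⇒≥ {h′} {⟨ a , x′ ⟩} h′≃))
      (pointwise-≤ {s} {s} (λ n → ℚP.≤-refl))) le

  inequalities⇒adjoint : ∀ s x → AdjointInequalities s x → x ∈ FineAdjoint (hull G) s
  inequalities⇒adjoint s x ineq a a≢0 = fromℤ (h a) , isSupportValue a , ineq a a≢0

  Attained : Pred ℝ _
  Attained s = 0ℝ < s × ∃[ x ] (x ∈ FineAdjoint (hull G) s)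

  -- Adding the inequalities h (Aᵢ) + s ≤ ⟨ Aᵢ , x ⟩ with weights wᵢ cancels x and leaves Σ wᵢ h
  -- (Aᵢ) + s Σ wᵢ ≤ 0.
  weak-duality : ∀ {n} (A : Fin n → Covector 3) (w : Vector ℤ n) → (∀ i → Nonzero (A i)) → (∀ i → 0ℤ ℤ.≤ w i) →
    (∀ j → w ∙ (λ i → A i j) ≡ 0ℤ) → ∀ r → 0ℤ ℤ.< ∑ w → ι (∑ w) ℚ.* r ≡ ι (ℤ.- (w ∙ (h ∘ A))) →
    UpperBound Attained (fromℚ r)
  weak-duality A w A≢0 w≥0 bal r W>0 r-spec s (_ , x , adj) =
    scale-cancel-≤ {ι (∑ w)} {s} {fromℚ r} (ι-mono-< 0ℤ (∑ w) W>0) λ ε ε>0 →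
      ev-map (λ n le → ≤-by (0≤-by le) (shape₁ n ε)) (below ε ε>0)
    where
    open ≡-Reasoning
    lhs : Vector ℝ _
    lhs i = fromℤ (w i) * (fromℤ (h (A i)) + s)
    rhs : Vector ℝ _
    rhs i = fromℤ (w i) * ⟨ A i , x ⟩
    seq-lhs : ∀ n → seq (sum lhs) n ≡ ι (w ∙ (h ∘ A)) ℚ.+ ι (∑ w) ℚ.* seq s n
    seq-lhs n = begin
      seq (sum lhs) n ≡⟨ seq-sum lhs n ⟩
      Σℚ (λ i → ι (w i) ℚ.* (ι (h (A i)) ℚ.+ seq s n))
        ≡⟨ Σℚ-cong (λ i → ℚP.*-distribˡ-+ (ι (w i)) (ι (h (A i))) (seq s n)) ⟩
      Σℚ (λ i → ι (w i) ℚ.* ι (h (A i)) ℚ.+ ι (w i) ℚ.* seq s n)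
        ≡⟨ Σℚ-+ (λ i → ι (w i) ℚ.* ι (h (A i))) (λ i → ι (w i) ℚ.* seq s n) ⟩
      Σℚ (λ i → ι (w i) ℚ.* ι (h (A i))) ℚ.+ Σℚ (λ i → ι (w i) ℚ.* seq s n)
        ≡⟨ cong₂ ℚ._+_ (sym (ι-∙ w (h ∘ A))) (trans (Σℚ-*ʳ (seq s n) (ι ∘ w)) (cong (ℚ._* seq s n) (sym (ι-∑ w)))) ⟩
      ι (w ∙ (h ∘ A)) ℚ.+ ι (∑ w) ℚ.* seq s n ∎
    seq-rhs : ∀ n → seq (sum rhs) n ≡ 0ℚ
    seq-rhs n = begin
      seq (sum rhs) n ≡⟨ seq-sum rhs n ⟩
      Σℚ (λ i → ι (w i) ℚ.* seq ⟨ A i , x ⟩ n) ≡⟨ Σℚ-cong (λ i → cong (ι (w i) ℚ.*_) (seq-⟨⟩ (A i) x n)) ⟩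
      Σℚ (λ i → ι (w i) ℚ.* Σℚ (λ j → ι (A i j) ℚ.* seq (x j) n))
        ≡⟨ Σℚ-swap (ι ∘ w) (λ i j → ι (A i j)) (λ j → seq (x j) n) ⟩
      Σℚ (λ j → Σℚ (λ i → ι (w i) ℚ.* ι (A i j)) ℚ.* seq (x j) n)
        ≡⟨ Σℚ-cong (λ j → cong (ℚ._* seq (x j) n) (trans (sym (ι-∙ w (λ i → A i j))) (cong ι (bal j)))) ⟩
      Σℚ (λ j → 0ℚ ℚ.* seq (x j) n) ≡⟨ Σℚ-*ˡ 0ℚ (λ j → seq (x j) n) ⟩
      0ℚ ℚ.* Σℚ (λ j → seq (x j) n) ≡⟨ ℚP.*-zeroˡ (Σℚ (λ j → seq (x j) n)) ⟩
      0ℚ ∎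
    summed : sum lhs ≤ sum rhs
    summed = sum-≤ (λ i → scale-≤ {ι (w i)} {fromℤ (h (A i)) + s} {⟨ A i , x ⟩} (ι-mono-≤ 0ℤ (w i) (w≥0 i))
      (adjoint⇒inequalities s x adj (A i) (A≢0 i)))
    below : ∀ ε → 0ℚ ℚ.< ε → Eventually (λ n → ι (w ∙ (h ∘ A)) ℚ.+ ι (∑ w) ℚ.* seq s n ℚ.≤ 0ℚ ℚ.+ ε)
    below ε ε>0 = ev-map (λ n → subst₂ ℚ._≤_ (seq-lhs n) (cong (ℚ._+ ε) (seq-rhs n))) (summed ε ε>0)
    shape : ∀ c y ε → ℚ.- c ℚ.+ ε ≡ y ℚ.+ ((0ℚ ℚ.+ ε) ℚ.- (c ℚ.+ y))
    shape = solve-∀ ℚ-ring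
    shape₁ : ∀ n ε → ι (∑ w) ℚ.* r ℚ.+ ε ≡ ι (∑ w) ℚ.* seq s n ℚ.+
      ((0ℚ ℚ.+ ε) ℚ.- (ι (w ∙ (h ∘ A)) ℚ.+ ι (∑ w) ℚ.* seq s n))
    shape₁ n ε = trans (cong (ℚ._+ ε) (trans r-spec (ι-neg (w ∙ (h ∘ A)))))
      (shape (ι (w ∙ (h ∘ A))) (ι (∑ w) ℚ.* seq s n) ε)

  feasible-attained : ∀ Q T → 0ℤ ℤ.< Q → ∀ y t → 0ℤ ℤ.< t → Feasible Q T y t →
    ∀ r → 0ℚ ℚ.< r → ι Q ℚ.* r ≡ ι T → Attained (fromℚ r)
  feasible-attained Q T Q>0 y t t>0 feas r r>0 r-spec = (r , r>0 , 0 , λ n _ → ℚP.≤-reflexive (ℚP.+-identityˡ r))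
    , x , inequalities⇒adjoint (fromℚ r) x λ a a≢0 → pointwise-≤ {fromℤ (h a) + fromℚ r} {⟨ a , x ⟩} λ n →
      *-cancel-≤ {c} c>0 (subst₂ ℚ._≤_ (sym (lhs a)) (sym (rhs a n))
        (ι-mono-≤ (t ℤ.* φ Q T a) (a ∙ y) (feas a a≢0)))
    where
    open ≡-Reasoning
    c = ι (Q ℤ.* t)
    c>0 : 0ℚ ℚ.< c
    c>0 = ι-mono-< 0ℤ (Q ℤ.* t) (0<* Q>0 t>0)
    inverse = reciprocal c c>0
    ρ = proj₁ inverse
    x : Point 3
    x j = fromℚ (ι (y j) ℚ.* ρ)
    lhs : ∀ a → c ℚ.* (ι (h a) ℚ.+ r) ≡ ι (t ℤ.* φ Q T a)
    lhs a = begin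
      c ℚ.* (ι (h a) ℚ.+ r) ≡⟨ cong (ℚ._* (ι (h a) ℚ.+ r)) (ι-* Q t) ⟩
      (ι Q ℚ.* ι t) ℚ.* (ι (h a) ℚ.+ r) ≡⟨ shape (ι Q) (ι t) (ι (h a)) r ⟩
      ι t ℚ.* (ι Q ℚ.* ι (h a) ℚ.+ ι Q ℚ.* r) ≡⟨ cong₂ (λ u v → ι t ℚ.* (u ℚ.+ v)) (sym (ι-* Q (h a))) r-spec ⟩
      ι t ℚ.* (ι (Q ℤ.* h a) ℚ.+ ι T) ≡⟨ cong (ι t ℚ.*_) (sym (ι-+ (Q ℤ.* h a) T)) ⟩
      ι t ℚ.* ι (φ Q T a) ≡⟨ ι-* t (φ Q T a) ⟨
      ι (t ℤ.* φ Q T a) ∎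
      where
      shape : ∀ q t h r → (q ℚ.* t) ℚ.* (h ℚ.+ r) ≡ t ℚ.* (q ℚ.* h ℚ.+ q ℚ.* r)
      shape = solve-∀ ℚ-ring
    rhs : ∀ a n → c ℚ.* seq ⟨ a , x ⟩ n ≡ ι (a ∙ y)
    rhs a n = begin
      c ℚ.* seq ⟨ a , x ⟩ n ≡⟨ cong (c ℚ.*_) (seq-⟨⟩ a x n) ⟩
      c ℚ.* Σℚ (λ j → ι (a j) ℚ.* (ι (y j) ℚ.* ρ))
        ≡⟨ cong (c ℚ.*_) (trans (Σℚ-cong (λ j → sym (ℚP.*-assoc (ι (a j)) (ι (y j)) ρ)))
        (Σℚ-*ʳ ρ (λ j → ι (a j) ℚ.* ι (y j)))) ⟩
      c ℚ.* (Σℚ (λ j → ι (a j) ℚ.* ι (y j)) ℚ.* ρ) ≡⟨ cong (λ z → c ℚ.* (z ℚ.* ρ)) (sym (ι-∙ a y)) ⟩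
      c ℚ.* (ι (a ∙ y) ℚ.* ρ) ≡⟨ shape c (ι (a ∙ y)) ρ ⟩
      (c ℚ.* ρ) ℚ.* ι (a ∙ y) ≡⟨ cong (ℚ._* ι (a ∙ y)) (proj₂ (proj₂ inverse)) ⟩
      1ℚ ℚ.* ι (a ∙ y) ≡⟨ ℚP.*-identityˡ (ι (a ∙ y)) ⟩
      ι (a ∙ y) ∎
      where
      shape : ∀ c z ρ → c ℚ.* (z ℚ.* ρ) ≡ (c ℚ.* ρ) ℚ.* z
      shape = solve-∀ ℚ-ring

-- The weights whose value is half the width of the polytope in direction a.
module OppositePair (a : Covector 3) (a≢0 : Nonzero a) where

  -a : Covector 3
  -a j = ℤ.- a j

  A : Fin 2 → Covector 3
  A 0F = a
  A 1F = -a

  w : Vector ℤ 2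
  w _ = 1ℤ

  A≢0 : ∀ i → Nonzero (A i)
  A≢0 0F = a≢0
  A≢0 1F z = a≢0 (λ j → ℤP.neg-injective (z j))

  w≥0 : ∀ i → 0ℤ ℤ.≤ w i
  w≥0 _ = ℤ.+≤+ ℕ.z≤n

  pair : ∀ u → w ∙ u ≡ u 0F ℤ.+ u 1F
  pair u = trans (∑-suc (λ i → w i ℤ.* u i)) (cong₂ ℤ._+_ (ℤP.*-identityˡ (u 0F))
    (trans (∑-suc (λ i → w (suc i) ℤ.* u (suc i)))
      (trans (cong₂ ℤ._+_ (ℤP.*-identityˡ (u 1F)) (∑-nil _)) (ℤP.+-identityʳ (u 1F)))))

  balanced : ∀ j → w ∙ (λ i → A i j) ≡ 0ℤ
  balanced j = trans (pair (λ i → A i j)) (ℤP.+-inverseʳ (a j))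

  ∑w≡2 : ∑ w ≡ + 2
  ∑w≡2 = trans (sym (∙-1 w)) (pair (const 1ℤ))

  ∑w>0 : 0ℤ ℤ.< ∑ w
  ∑w>0 = subst (0ℤ ℤ.<_) (sym ∑w≡2) (ℤ.+<+ (ℕ.s≤s ℕ.z≤n))

  -a∙ : ∀ x → -a ∙ x ≡ ℤ.- (a ∙ x)
  -a∙ x = trans (∙-cong x (λ j → sym (ℤP.-1*i≡-i (a j)))) (trans (∙-*ˡ (ℤ.- 1ℤ) a x) (ℤP.-1*i≡-i (a ∙ x)))

numerators-nonZero : ∀ {q} → q ∈ₗ numerators → ℕ.NonZero q
numerators-nonZero = All.lookup {P = ℕ.NonZero} (_ ∷ _ ∷ _ ∷ _ ∷ _ ∷ _ ∷ _ ∷ _ ∷ _ ∷ [])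

ratio : ∀ {q} → ℕ → q ∈ₗ numerators → ℚ
ratio {q} N q∈ = (+ N ℚ./ q) {{numerators-nonZero q∈}}

ratio-spec : ∀ {q} N (q∈ : q ∈ₗ numerators) → ι (+ q) ℚ.* ratio N q∈ ≡ ι (+ N)
ratio-spec {q} N q∈ = /-spec (+ N) q {{numerators-nonZero q∈}}

q>0 : ∀ {q} → q ∈ₗ numerators → 0ℤ ℤ.< + q
q>0 {q} q∈ = ℤ.+<+ (ℕ.>-nonZero⁻¹ q {{numerators-nonZero q∈}})

-- Rationality of the supremum

module _ {m} (G : Fin (suc m) → Vector ℤ 3) (σ : ℝ) (isSup : IsSup (Attained G) σ) where

  open Support G

  -- Otherwise every real would be an upper bound, and σ ≤ σ - 1 would follow.
  attained-nonempty : ¬ (∀ s → ¬ s ∈ Attained G)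
  attained-nonempty none = <⇒≱ {σ + fromℚ (ℚ.- 1ℚ)} {σ}
    (1ℚ , 0<1 , 0 , λ n _ → ℚP.≤-reflexive (shape (seq σ n)))
    (proj₂ isSup (σ + fromℚ (ℚ.- 1ℚ)) (λ s s∈ → contradiction s∈ (none s)))
    where shape : ∀ x → (x ℚ.+ (ℚ.- 1ℚ)) ℚ.+ 1ℚ ≡ x
          shape = solve-∀ ℚ-ring

  upperBound-positive : ∀ {r} → UpperBound (Attained G) (fromℚ r) → 0ℚ ℚ.< r
  upperBound-positive {r} ub = ℚP.≰⇒> λ r≤0 → attained-nonempty λ s s∈@(s>0 , _) →
    <⇒≱ {0ℝ} {s} s>0 (≤-trans {s} {fromℚ r} {0ℝ} (ub s s∈) (fromℚ-≤ r≤0))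

  -- In a direction of width 0 the opposite pair gives the upper bound 0, although all attained
  -- values are positive and there are some.
  fullWidth : FullWidth
  fullWidth a a≢0 flat = ℚP.<-irrefl refl (upperBound-positive {0ℚ} (weak-duality G A w A≢0 w≥0 balanced 0ℚ ∑w>0
    (trans (ℚP.*-zeroʳ (ι (∑ w))) (cong (λ z → ι (ℤ.- z)) (sym (trans (pair (h ∘ A)) cancel))))))
    where
    open OppositePair a a≢0
    cancel : h a ℤ.+ h -a ≡ 0ℤ
    cancel = trans (cong (ℤ._+_ (h a)) (trans (-a∙ (G (vertex -a))) (cong ℤ.-_ (flat (vertex -a)))))
      (ℤP.+-inverseʳ (h a))

  Value : ℕ → ℕ → Set
  Value N q = N ≢ 0 × Σ[ q∈ ∈ q ∈ₗ numerators ] UpperBound (Attained G) (fromℚ (ratio N q∈))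

  -- A positive sum of φ-values means exactly that the value V / q of the weights is below T / Q.
  -- The strictness is what contradicts the minimality of a least value.
  certified-value : ∀ Q T → TerminalCert Q T → ∃[ N ] ∃[ q ] (Value N q × Q ℤ.* + N ℤ.< T ℤ.* + q)
  certified-value Q T (C , q , q∈ , Σ≡q) = N , q , (N≢0 , q∈ , ub) , bound
    where
    open Cert C
    V : ℤ
    V = ℤ.- (weight ∙ (h ∘ vectors))
    r : ℚ
    r = (V ℚ./ q) {{numerators-nonZero q∈}}
    r-spec : ι (+ q) ℚ.* r ≡ ι V
    r-spec = /-spec V q {{numerators-nonZero q∈}}
    ub-r : UpperBound (Attained G) (fromℚ r)
    ub-r = weak-duality G vectors weight nonzero weight≥0 balanced r (subst (0ℤ ℤ.<_) (sym Σ≡q) (q>0 q∈))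
      (trans (cong (λ z → ι z ℚ.* r) Σ≡q) r-spec)
    V>0 : 0ℤ ℤ.< V
    V>0 = ℤP.≰⇒> λ V≤0 → <⇒≱ℚ (0<-* (ι-mono-< 0ℤ (+ q) (q>0 q∈)) (upperBound-positive ub-r))
      (ℚP.≤-trans (ℚP.≤-reflexive r-spec) (ι-mono-≤ V 0ℤ V≤0))
    N : ℕ
    N = ℤ.∣ V ∣
    V≡N : V ≡ + N
    V≡N = sym (ℤP.0≤i⇒+∣i∣≡i (ℤP.<⇒≤ V>0))
    N≢0 : N ≢ 0
    N≢0 z = <⇒≢0 V>0 (trans V≡N (cong +_ z))
    ub : UpperBound (Attained G) (fromℚ (ratio N q∈))
    ub = subst (λ v → UpperBound (Attained G) (fromℚ ((v ℚ./ q) {{numerators-nonZero q∈}}))) V≡N ub-r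
    expanded : weight ∙ (φ Q T ∘ vectors) ≡ T ℤ.* + q ℤ.- Q ℤ.* V
    expanded = trans (∙-linʳ weight (h ∘ vectors) Q T)
      (trans (cong (λ s → Q ℤ.* (weight ∙ (h ∘ vectors)) ℤ.+ T ℤ.* s) Σ≡q)
      (shape Q T (weight ∙ (h ∘ vectors)) (+ q)))
      where shape : ∀ Q T v q → Q ℤ.* v ℤ.+ T ℤ.* q ≡ T ℤ.* q ℤ.- Q ℤ.* (ℤ.- v)
            shape = solve-ℤ
    bound : Q ℤ.* + N ℤ.< T ℤ.* + q
    bound = subst (λ v → Q ℤ.* v ℤ.< T ℤ.* + q) V≡N (ℤP.≰⇒> λ le →
      ℤP.<⇒≱ (subst (0ℤ ℤ.<_) expanded positive) (ℤP.i≤j⇒i-j≤0 le))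

  initial-value : ∃[ N ] ∃[ q ] Value N q
  initial-value = let N , q , val , _ = certified-value 1ℤ τ (terminal (φ-concave 1ℤ τ (ℤ.+<+ (ℕ.s≤s ℕ.z≤n))) (cert-4 C)) in N , q , val
    where
    open OppositePair e₁ e₁≢0
    -- Chosen so that h e₁ + h (- e₁) + 2 τ > 0, which makes the opposite pair a certificate at
    -- threshold τ.
    τ : ℤ
    τ = ℤ.+ 1 ℤ.+ (+ ℤ.∣ h e₁ ∣ ℤ.+ + ℤ.∣ h -a ∣)
    0≤i+∣i∣ : ∀ i → 0ℤ ℤ.≤ i ℤ.+ + ℤ.∣ i ∣
    0≤i+∣i∣ (+ n) = ℤ.+≤+ ℕ.z≤n
    0≤i+∣i∣ ℤ.-[1+ n ] = ℤP.≤-reflexive (sym (ℤP.+-inverseˡ (+ suc n)))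
    shape : ∀ a b c d → (a ℤ.+ c) ℤ.+ (b ℤ.+ d) ℤ.+ (ℤ.+ 2 ℤ.+ (c ℤ.+ d)) ≡
      (1ℤ ℤ.* a ℤ.+ (ℤ.+ 1 ℤ.+ (c ℤ.+ d))) ℤ.+ (1ℤ ℤ.* b ℤ.+ (ℤ.+ 1 ℤ.+ (c ℤ.+ d)))
    shape = solve-ℤ
    C : Cert (φ 1ℤ τ) 2
    C = record
      { vectors = A ; weight = w ; nonzero = A≢0 ; weight≥0 = w≥0 ; balanced = balanced
      ; positive = subst (0ℤ ℤ.<_) (trans (shape (h e₁) (h -a) (+ ℤ.∣ h e₁ ∣) (+ ℤ.∣ h -a ∣))
        (sym (pair (φ 1ℤ τ ∘ A))))
          (ℤP.+-mono-≤-< (ℤP.+-mono-≤ (0≤i+∣i∣ (h e₁)) (0≤i+∣i∣ (h -a))) (ℤ.+<+ (ℕ.s≤s ℕ.z≤n))) }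

  -- M is a common multiple of the numerators; n / M is the least value.
  module _ (M : ℕ) (M≢0 : M ≢ 0) (common : ∀ {q} → q ∈ₗ numerators → q ∣ M) where

    Scaled : ℕ → Set
    Scaled n = ∃[ N ] ∃[ q ] (Value N q × n ℕ.* q ≡ M ℕ.* N)

    scaled : ∀ {N q} → Value N q → ∃[ n ] (n ℕ.* q ≡ M ℕ.* N)
    scaled {N} {q} (_ , q∈ , _) with common q∈
    ... | divides c eq = c ℕ.* N , trans (ℕP.*-assoc c N q)
      (trans (cong (c ℕ.*_) (ℕP.*-comm N q)) (trans (sym (ℕP.*-assoc c q N)) (cong (ℕ._* N) (sym eq))))

    smaller : ∀ {n N q n′ N′ q′} → q ≢ 0 → q′ ≢ 0 → n ℕ.* q ≡ M ℕ.* N → n′ ℕ.* q′ ≡ M ℕ.* N′ →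
      + q ℤ.* + N′ ℤ.< + N ℤ.* + q′ → n′ ℕ.< n
    smaller {n} {N} {q} {n′} {N′} {q′} q≢0 q′≢0 e e′ lt = ℕP.*-cancelʳ-< (q ℕ.* q′) n′ n (begin-strict
      n′ ℕ.* (q ℕ.* q′) ≡⟨ shape₁ n′ q q′ ⟩
      (n′ ℕ.* q′) ℕ.* q ≡⟨ cong (ℕ._* q) e′ ⟩
      (M ℕ.* N′) ℕ.* q ≡⟨ shape₂ M N′ q ⟩
      M ℕ.* (q ℕ.* N′) <⟨ ℕP.*-monoʳ-< M {{ℕ.≢-nonZero M≢0}}
        (ℤP.drop‿+<+ (subst₂ ℤ._<_ (sym (ℤP.pos-* q N′)) (sym (ℤP.pos-* N q′)) lt)) ⟩
      M ℕ.* (N ℕ.* q′) ≡⟨ sym (ℕP.*-assoc M N q′) ⟩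
      (M ℕ.* N) ℕ.* q′ ≡⟨ cong (ℕ._* q′) (sym e) ⟩
      (n ℕ.* q) ℕ.* q′ ≡⟨ ℕP.*-assoc n q q′ ⟩
      n ℕ.* (q ℕ.* q′) ∎)
      where
      open ℕP.≤-Reasoning
      shape₁ : ∀ n q q′ → n ℕ.* (q ℕ.* q′) ≡ (n ℕ.* q′) ℕ.* q
      shape₁ = solve-ℕ
      shape₂ : ∀ m n q → (m ℕ.* n) ℕ.* q ≡ m ℕ.* (q ℕ.* n)
      shape₂ = solve-ℕ

    q≢0 : ∀ {q} → q ∈ₗ numerators → q ≢ 0
    q≢0 q∈ refl = ℤP.<-irrefl refl (q>0 q∈)

    -- Duality at the threshold N / q: a certificate would yield a value with smaller n, so N / q is
    -- attained and not only an upper bound. The double negation in duality is harmless because ≤ is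
    -- stable.
    least-value : ∀ {n N q} ((_ , q∈ , _) : Value N q) → n ℕ.* q ≡ M ℕ.* N → (∀ k → k ℕ.< n → ¬ Scaled k) → σ ≃
      fromℚ (ratio N q∈)
    least-value {n} {N} {q} val@(N≢0 , q∈ , ub) eq minimal = ≤-antisym {σ} {fromℚ r} (proj₂ isSup (fromℚ r) ub)
      (stable-≤ {fromℚ r} {σ} λ k → duality fullWidth (+ q) (+ N) (q>0 q∈) (ℤ.+≤+ ℕ.z≤n)
        [ (λ (y , t , t>0 , feas) → k
          (proj₁ isSup (fromℚ r) (feasible-attained G (+ q) (+ N) (q>0 q∈) y t t>0 feas r (upperBound-positive ub)
          (ratio-spec N q∈))))
        , (λ cert → let N′ , q′ , val′@(_ , q′∈ , _) , lt = certified-value (+ q) (+ N) cert ; n′ , eq′ = scaled val′ in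
            minimal n′ (smaller (q≢0 q∈) (q≢0 q′∈) eq eq′ lt) (N′ , q′ , val′ , eq′)) ]′)
      where r = ratio N q∈

    -- A decidable consequence of minimality: it can be freed from the double negation, and it
    -- suffices to recover N and q from n.
    Admissible : ℕ → Set
    Admissible n = n ≢ 0 × Any (λ q → M ∣ n ℕ.* q) numerators

    scale-M : ∀ n {N q} (q∈ : q ∈ₗ numerators) → n ℕ.* q ≡ M ℕ.* N → ι (+ M) ℚ.* ratio N q∈ ≡ ι (+ n)
    scale-M n {N} {q} q∈ eq = *-cancel-≡ {ι (+ q)} (ι-mono-< 0ℤ (+ q) (q>0 q∈)) (begin
      ι (+ q) ℚ.* (ι (+ M) ℚ.* r) ≡⟨ shape (ι (+ q)) (ι (+ M)) r ⟩
      ι (+ M) ℚ.* (ι (+ q) ℚ.* r) ≡⟨ cong (ι (+ M) ℚ.*_) (ratio-spec N q∈) ⟩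
      ι (+ M) ℚ.* ι (+ N) ≡⟨ ι-*ℕ M N ⟩
      ι (+ (M ℕ.* N)) ≡⟨ cong (ι ∘ +_) (trans (sym eq) (ℕP.*-comm n q)) ⟩
      ι (+ (q ℕ.* n)) ≡⟨ ι-*ℕ q n ⟨
      ι (+ q) ℚ.* ι (+ n) ∎)
      where
      open ≡-Reasoning
      r = ratio N q∈
      shape : ∀ a b c → a ℚ.* (b ℚ.* c) ≡ b ℚ.* (a ℚ.* c)
      shape = solve-∀ ℚ-ring
      ι-*ℕ : ∀ a b → ι (+ a) ℚ.* ι (+ b) ≡ ι (+ (a ℕ.* b))
      ι-*ℕ a b = trans (sym (ι-* (+ a) (+ b))) (cong ι (sym (ℤP.pos-* a b)))

    M*ratio : ∀ n {N q} (q∈ : q ∈ₗ numerators) → n ℕ.* q ≡ M ℕ.* N → fromℤ (+ M) * fromℚ (ratio N q∈) ≃ fromℤ (+ n)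
    M*ratio n {N} q∈ eq = pointwise {fromℤ (+ M) * fromℚ (ratio N q∈)} {fromℤ (+ n)} (λ _ → scale-M n q∈ eq)

    scaled-sup : ¬ ¬ (∃[ n ] (fromℤ (+ M) * σ ≃ fromℤ (+ n) × Admissible n))
    scaled-sup = least Scaled (let N , q , val = initial-value ; n , eq = scaled val in n , N , q , val , eq) >>=
      λ (n , (N , q , val@(N≢0 , q∈ , ub) , eq) , minimal) → return (n
        , ≃-trans {fromℤ (+ M) * σ} {fromℤ (+ M) * fromℚ (ratio N q∈)} {fromℤ (+ n)}
            (*-congˡ {σ} {fromℚ (ratio N q∈)} (fromℤ (+ M)) (least-value val eq minimal)) (M*ratio n q∈ eq)
        , (λ n≡0 → [ M≢0 , N≢0 ]′ (ℕP.m*n≡0⇒m≡0∨n≡0 M (trans (sym eq) (cong (ℕ._* q) n≡0))))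
        , Any.map (λ { refl → divides N (trans eq (ℕP.*-comm M N)) }) q∈)

    admissible? : ∀ n → Dec (Admissible n)
    admissible? n = ¬? (n ℕ.≟ 0) ×-dec Any.any? (λ q → M ∣? n ℕ.* q) numerators

    rational-sup′ : ∃[ q ] Σ[ q∈ ∈ q ∈ₗ numerators ] ∃[ N ] (N ≢ 0 × σ ≃ fromℚ (ratio N q∈))
    rational-sup′ = extract (decode (fromℤ (+ M) * σ) Admissible scaled-sup)
      where
      extract : ∃[ n ] (fromℤ (+ M) * σ ≃ fromℤ (+ n) × ¬ ¬ Admissible n) →
        ∃[ q ] Σ[ q∈ ∈ q ∈ₗ numerators ] ∃[ N ] (N ≢ 0 × σ ≃ fromℚ (ratio N q∈))
      extract (n , Mσ≃n , ¬¬adm) = q , q∈ , N , N≢0 , ≤-antisym {σ} {fromℚ r}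
          (scale-cancel-≤ {ι (+ M)} {σ} {fromℚ r} M>0 (≃⇒≤ {fromℤ (+ M) * σ} {fromℤ (+ M) * fromℚ r} same))
          (scale-cancel-≤ {ι (+ M)} {fromℚ r} {σ} M>0 (≃⇒≥ {fromℤ (+ M) * σ} {fromℤ (+ M) * fromℚ r} same))
        where
        adm : Admissible n
        adm = decidable-stable (admissible? n) ¬¬adm
        picked = find (proj₂ adm)
        q = proj₁ picked
        q∈ = proj₁ (proj₂ picked)
        M∣nq = proj₂ (proj₂ picked)
        N = _∣_.quotient M∣nq
        eq : n ℕ.* q ≡ M ℕ.* N
        eq = trans (_∣_.equality M∣nq) (ℕP.*-comm N M)
        N≢0 : N ≢ 0
        N≢0 z = [ proj₁ adm , q≢0 q∈ ]′ (ℕP.m*n≡0⇒m≡0∨n≡0 n (trans eq (trans (cong (M ℕ.*_) z) (ℕP.*-zeroʳ M))))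
        r = ratio N q∈
        M>0 : 0ℚ ℚ.< ι (+ M)
        M>0 = ι-mono-< 0ℤ (+ M) (ℤ.+<+ (ℕP.n≢0⇒n>0 M≢0))
        same : fromℤ (+ M) * σ ≃ fromℤ (+ M) * fromℚ r
        same = ≃-trans {fromℤ (+ M) * σ} {fromℤ (+ n)} {fromℤ (+ M) * fromℚ r} Mσ≃n
          (≃-sym {fromℤ (+ M) * fromℚ r} {fromℤ (+ n)} (M*ratio n q∈ eq))

  rational-sup : ∃[ q ] Σ[ q∈ ∈ q ∈ₗ numerators ] ∃[ N ] (N ≢ 0 × σ ≃ fromℚ (ratio N q∈))
  rational-sup = rational-sup′ (product numerators) (λ ()) ∈⇒∣product

-- Dilation

undo : ∀ c r x → c ℚ.* r ≡ 1ℚ → fromℚ c * (fromℚ r * x) ≃ x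
undo c r x e = pointwise {fromℚ c * (fromℚ r * x)} {x} λ n →
  trans (sym (ℚP.*-assoc c r (seq x n))) (trans (cong (ℚ._* seq x n) e) (ℚP.*-identityˡ (seq x n)))

IsSup-resp-≃ : ∀ {A : Pred ℝ 0ℓ} {σ τ} → σ ≃ τ → IsSup A σ → IsSup A τ
IsSup-resp-≃ {A} {σ} {τ} e (ub , lub) =
  (λ t t∈ → ≤-trans {t} {σ} {τ} (ub t t∈) (≃⇒≤ {σ} {τ} e)) ,
  (λ u u-ub → ≤-trans {τ} {σ} {u} (≃⇒≥ {σ} {τ} e) (lub u u-ub))

module _ {m} (G G′ : Fin (suc m) → Vector ℤ 3) where

  open Support using (h)

  -- Stated for rational c and in terms of support values only, so that it applies to the dilation
  -- by k and, with 1 / k, to its inverse.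
  attained-scale : ∀ c → 0ℚ ℚ.< c → (∀ a → ι (h G′ a) ≡ c ℚ.* ι (h G a)) → ∀ s →
    s ∈ Attained G → fromℚ c * s ∈ Attained G′
  attained-scale c c>0 h≡ s ((ε , ε>0 , ev) , x , adj) =
    (c ℚ.* ε , 0<-* c>0 ε>0 , ev-map (λ n → positive n) ev) , y , inequalities⇒adjoint G′ (fromℚ c * s) y ineq
    where
    y : Point 3
    y j = fromℚ c * x j
    positive : ∀ n → 0ℚ ℚ.+ ε ℚ.≤ seq s n → 0ℚ ℚ.+ c ℚ.* ε ℚ.≤ c ℚ.* seq s n
    positive n le = ≤-by (0≤-* (ℚP.<⇒≤ c>0) (0≤-by le)) (shape c ε (seq s n))
      where shape : ∀ c ε s → c ℚ.* s ≡ (0ℚ ℚ.+ c ℚ.* ε) ℚ.+ c ℚ.* (s ℚ.- (0ℚ ℚ.+ ε))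
            shape = solve-∀ ℚ-ring
    ineq : AdjointInequalities G′ (fromℚ c * s) y
    ineq a a≢0 = let open ℝ-Reasoning in begin
      fromℤ (h G′ a) + fromℚ c * s ≈⟨ pointwise {fromℤ (h G′ a) + fromℚ c * s} {fromℚ c * (fromℤ (h G a) + s)} push
        ⟩
      fromℚ c * (fromℤ (h G a) + s)
        ≲⟨ scale-≤ {c} {fromℤ (h G a) + s} {⟨ a , x ⟩} (ℚP.<⇒≤ c>0) (adjoint⇒inequalities G s x adj a a≢0) ⟩
      fromℚ c * ⟨ a , x ⟩ ≈⟨ pointwise {fromℚ c * ⟨ a , x ⟩} {⟨ a , y ⟩} pull ⟩
      ⟨ a , y ⟩ ∎
      where
      swap : ∀ a c x → c ℚ.* (a ℚ.* x) ≡ a ℚ.* (c ℚ.* x)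
      swap = solve-∀ ℚ-ring
      push : ∀ n → ι (h G′ a) ℚ.+ c ℚ.* seq s n ≡ c ℚ.* (ι (h G a) ℚ.+ seq s n)
      push n = trans (cong (ℚ._+ c ℚ.* seq s n) (h≡ a)) (sym (ℚP.*-distribˡ-+ c (ι (h G a)) (seq s n)))
      pull : ∀ n → c ℚ.* seq ⟨ a , x ⟩ n ≡ seq ⟨ a , y ⟩ n
      pull n = begin
        c ℚ.* seq ⟨ a , x ⟩ n ≡⟨ cong (c ℚ.*_) (seq-⟨⟩ a x n) ⟩
        c ℚ.* Σℚ (λ j → ι (a j) ℚ.* seq (x j) n) ≡⟨ Σℚ-*ˡ c (λ j → ι (a j) ℚ.* seq (x j) n) ⟨
        Σℚ (λ j → c ℚ.* (ι (a j) ℚ.* seq (x j) n)) ≡⟨ Σℚ-cong (λ j → swap (ι (a j)) c (seq (x j) n)) ⟩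
        Σℚ (λ j → ι (a j) ℚ.* (c ℚ.* seq (x j) n)) ≡⟨ seq-⟨⟩ a y n ⟨
        seq ⟨ a , y ⟩ n ∎
        where open ≡-Reasoning

module _ {m} (G : Fin (suc m) → Vector ℤ 3) (k : ℕ) (k≢0 : k ≢ 0) where

  open Support using (h; h≤; h-unique; vertex)

  private
    c : ℚ
    c = ι (+ k)

    c>0 : 0ℚ ℚ.< c
    c>0 = ι-mono-< 0ℤ (+ k) (ℤ.+<+ (ℕP.n≢0⇒n>0 k≢0))

    r : ℚ
    r = proj₁ (reciprocal c c>0)

    r>0 : 0ℚ ℚ.< r
    r>0 = proj₁ (proj₂ (reciprocal c c>0))

    cr≡1 : c ℚ.* r ≡ 1ℚ
    cr≡1 = proj₂ (proj₂ (reciprocal c c>0))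

    rc≡1 : r ℚ.* c ≡ 1ℚ
    rc≡1 = trans (ℚP.*-comm r c) cr≡1

  dilate : Fin (suc m) → Vector ℤ 3
  dilate i j = + k ℤ.* G i j

  dilate-∙ : ∀ a i → a ∙ dilate i ≡ + k ℤ.* (a ∙ G i)
  dilate-∙ a i = trans (∑-cong (λ j → shape (a j) (+ k) (G i j))) (∑-* (+ k) (λ j → a j ℤ.* G i j))
    where shape : ∀ a k g → a ℤ.* (k ℤ.* g) ≡ k ℤ.* (a ℤ.* g)
          shape = solve-ℤ

  h-dilate : ∀ a → h dilate a ≡ + k ℤ.* h G a
  h-dilate a = trans (h-unique dilate a v λ j → subst₂ ℤ._≤_ (sym (dilate-∙ a v)) (sym (dilate-∙ a j))
      (ℤP.*-monoˡ-≤-nonNeg (+ k) (h≤ G a j)))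
    (dilate-∙ a v)
    where v = vertex G a

  ι-h-dilate : ∀ a → ι (h dilate a) ≡ c ℚ.* ι (h G a)
  ι-h-dilate a = trans (cong ι (h-dilate a)) (ι-* (+ k) (h G a))

  ι-h-undilate : ∀ a → ι (h G a) ≡ r ℚ.* ι (h dilate a)
  ι-h-undilate a = sym (trans (cong (r ℚ.*_) (ι-h-dilate a)) (trans (sym (ℚP.*-assoc r c (ι (h G a))))
    (trans (cong (ℚ._* ι (h G a)) rc≡1) (ℚP.*-identityˡ (ι (h G a))))))

  dilate-sup : ∀ σ → IsSup (Attained G) σ → IsSup (Attained dilate) (fromℚ c * σ)
  dilate-sup σ (ub , lub) =
    (λ t t∈ → let open ℝ-Reasoning in begin
      t ≈⟨ ≃-sym {fromℚ c * (fromℚ r * t)} {t} (undo c r t cr≡1) ⟩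
      fromℚ c * (fromℚ r * t)    ≲⟨ scale-≤ {c} {fromℚ r * t} {σ} (ℚP.<⇒≤ c>0)
        (ub (fromℚ r * t) (attained-scale dilate G r r>0 ι-h-undilate t t∈)) ⟩
      fromℚ c * σ ∎) ,
    (λ u u-ub → let open ℝ-Reasoning in begin
      fromℚ c * σ                ≲⟨ scale-≤ {c} {σ} {fromℚ r * u} (ℚP.<⇒≤ c>0) (lub (fromℚ r * u) λ t t∈ → begin
        t ≈⟨ ≃-sym {fromℚ r * (fromℚ c * t)} {t} (undo r c t rc≡1) ⟩
        fromℚ r * (fromℚ c * t)    ≲⟨ scale-≤ {r} {fromℚ c * t} {u} (ℚP.<⇒≤ r>0)
          (u-ub (fromℚ c * t) (attained-scale G dilate c c>0 ι-h-dilate t t∈)) ⟩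
        fromℚ r * u ∎) ⟩
      fromℚ c * (fromℚ r * u) ≈⟨ undo c r u cr≡1 ⟩
      u ∎)

  pull-out : ∀ {n} (w p : Vector ℝ n) → sum (λ i → w i * (fromℚ c * p i)) ≃ fromℚ c * sum (λ i → w i * p i)
  pull-out w p = pointwise {sum (λ i → w i * (fromℚ c * p i))} {fromℚ c * sum (λ i → w i * p i)} λ n → begin
    seq (sum (λ i → w i * (fromℚ c * p i))) n ≡⟨ seq-sum (λ i → w i * (fromℚ c * p i)) n ⟩
    Σℚ (λ i → seq (w i) n ℚ.* (c ℚ.* seq (p i) n)) ≡⟨ Σℚ-cong (λ i → swap (seq (w i) n) c (seq (p i) n)) ⟩
    Σℚ (λ i → c ℚ.* (seq (w i) n ℚ.* seq (p i) n)) ≡⟨ Σℚ-*ˡ c (λ i → seq (w i) n ℚ.* seq (p i) n) ⟩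
    c ℚ.* Σℚ (λ i → seq (w i) n ℚ.* seq (p i) n) ≡⟨ cong (c ℚ.*_) (sym (seq-sum (λ i → w i * p i) n)) ⟩
    c ℚ.* seq (sum (λ i → w i * p i)) n ∎
    where
    open ≡-Reasoning
    swap : ∀ a c x → a ℚ.* (c ℚ.* x) ≡ c ℚ.* (a ℚ.* x)
    swap = solve-∀ ℚ-ring

  dilate-∈ : ∀ x → x ∈ hull G → (λ j → fromℚ c * x j) ∈ hull dilate
  dilate-∈ x (w , w≥0 , Σw , x≃) = w , w≥0 , Σw , λ j →
    ≃-trans {fromℚ c * x j} {fromℚ c * y j} {sum (λ i → w i * fromℤ (dilate i j))}
      (*-congˡ {x j} {y j} (fromℚ c) (x≃ j))
      (≃-trans {fromℚ c * y j} {sum (λ i → w i * (fromℚ c * fromℤ (G i j)))} {sum (λ i → w i * fromℤ (dilate i j))}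
        (≃-sym {sum (λ i → w i * (fromℚ c * fromℤ (G i j)))} {fromℚ c * y j} (pull-out w (λ i → fromℤ (G i j))))
        (sum-≃ {x = λ i → w i * (fromℚ c * fromℤ (G i j))} {y = λ i → w i * fromℤ (dilate i j)} λ i →
          *-congˡ {fromℚ c * fromℤ (G i j)} {fromℤ (dilate i j)} (w i)
            (pointwise {fromℚ c * fromℤ (G i j)} {fromℤ (dilate i j)} λ _ → sym (ι-* (+ k) (G i j)))))
    where
    y : Point 3
    y j = sum (λ i → w i * fromℤ (G i j))

  dilate-fullDimensional : FullDimensional (hull G) → FullDimensional (hull dilate)
  dilate-fullDimensional (p , p∈ , independent) = (λ i j → fromℚ c * p i j) , (λ i → dilate-∈ (p i) (p∈ i)) ,
    λ w Σw≃0 balanced → independent w Σw≃0 λ j → cancel w j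
      (≃-trans {fromℚ c * sum (λ i → w i * p i j)} {sum (λ i → w i * (fromℚ c * p i j))} {0ℝ}
        (≃-sym {sum (λ i → w i * (fromℚ c * p i j))} {fromℚ c * sum (λ i → w i * p i j)} (pull-out w (λ i → p i j)))
          (balanced j))
    where
    cancel : ∀ (w : Vector ℝ 4) j → fromℚ c * sum (λ i → w i * p i j) ≃ 0ℝ → sum (λ i → w i * p i j) ≃ 0ℝ
    cancel w j e = ≃-trans {z} {fromℚ r * (fromℚ c * z)} {0ℝ}
      (≃-sym {fromℚ r * (fromℚ c * z)} {z} (undo r c z rc≡1))
      (≃-trans {fromℚ r * (fromℚ c * z)} {fromℚ r * 0ℝ} {0ℝ} (*-congˡ {fromℚ c * z} {0ℝ} (fromℚ r) e)
        (pointwise {fromℚ r * 0ℝ} {0ℝ} λ _ → ℚP.*-zeroʳ r))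
      where z = sum (λ i → w i * p i j)

reciprocal-ratio : ∀ {q} (q∈ : q ∈ₗ numerators) k N .{{_ : ℕ.NonZero k}} .{{_ : ℕ.NonZero N}} →
  (ℚ._/_ (+ q) (k ℕ.* N) {{ℕP.m*n≢0 k N}}) ℚ.* (ι (+ k) ℚ.* ratio N q∈) ≡ 1ℚ
reciprocal-ratio {q} q∈ k N = *-cancel-≡ {ι (+ q)} (ι-mono-< 0ℤ (+ q) (q>0 q∈)) (begin
  ι (+ q) ℚ.* (u ℚ.* (ι (+ k) ℚ.* r)) ≡⟨ shape (ι (+ q)) u (ι (+ k)) r ⟩
  (ι (+ k) ℚ.* (ι (+ q) ℚ.* r)) ℚ.* u ≡⟨ cong (λ z → (ι (+ k) ℚ.* z) ℚ.* u) (ratio-spec N q∈) ⟩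
  (ι (+ k) ℚ.* ι (+ N)) ℚ.* u ≡⟨ cong (ℚ._* u) (trans (sym (ι-* (+ k) (+ N))) (cong ι (sym (ℤP.pos-* k N)))) ⟩
  ι (+ (k ℕ.* N)) ℚ.* u ≡⟨ /-spec (+ q) (k ℕ.* N) {{ℕP.m*n≢0 k N}} ⟩
  ι (+ q) ≡⟨ ℚP.*-identityʳ (ι (+ q)) ⟨
  ι (+ q) ℚ.* 1ℚ ∎)
  where
  open ≡-Reasoning
  u = ℚ._/_ (+ q) (k ℕ.* N) {{ℕP.m*n≢0 k N}}
  r = ratio N q∈
  shape : ∀ q u k r → q ℚ.* (u ℚ.* (k ℚ.* r)) ≡ (k ℚ.* (q ℚ.* r)) ℚ.* u
  shape = solve-∀ ℚ-ring

InfinitelyDivisible : ℕ → Pred ℕ⁺ 0ℓ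
InfinitelyDivisible q ℓ = ∀ k → q /[ k · ℓ ] ∈ FineSpectrum 3

dilates-in-spectrum : ∀ {m} (G : Fin (suc m) → Vector ℤ 3) → FullDimensional (hull G) →
  ∀ {q} (q∈ : q ∈ₗ numerators) N .{{_ : ℕ.NonZero N}} → IsSup (Attained G) (fromℚ (ratio N q∈)) →
  InfinitelyDivisible q (mkℕ⁺ N)
dilates-in-spectrum {m} G full {q} q∈ N sup (mkℕ⁺ k) =
  record { size = suc m ; generators = dilate G k k≢0 ; fullDimensional = dilate-fullDimensional G k k≢0 full } ,
  fromℚ (ι (+ k)) * fromℚ (ratio N q∈) , dilate-sup G k k≢0 (fromℚ (ratio N q∈)) sup ,
  pointwise {q /[ mkℕ⁺ k · mkℕ⁺ N ] * (fromℚ (ι (+ k)) * fromℚ (ratio N q∈))} {1ℝ} (λ _ → reciprocal-ratio q∈ k N)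
  where
  k≢0 : k ≢ 0
  k≢0 = ℕ.≢-nonZero⁻¹ k

spectrum-resp-≃ : ∀ {μ ν} → μ ≃ ν → ν ∈ FineSpectrum 3 → μ ∈ FineSpectrum 3
spectrum-resp-≃ {μ} {ν} e (P , σ , sup , νσ≃1) = P , σ , sup ,
  ≃-trans {μ * σ} {ν * σ} {1ℝ} (*-congʳ {μ} {ν} σ e) νσ≃1

-- A simplex with σ = 1

simplex : Fin 4 → Vector ℤ 3
simplex 0F = 1ℤ ∷ᵛ 0ℤ ∷ᵛ 0ℤ ∷ᵛ λ ()
simplex 1F = 0ℤ ∷ᵛ 1ℤ ∷ᵛ 0ℤ ∷ᵛ λ ()
simplex 2F = 0ℤ ∷ᵛ 0ℤ ∷ᵛ 1ℤ ∷ᵛ λ ()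
simplex 3F = ℤ.- 1ℤ ∷ᵛ ℤ.- 1ℤ ∷ᵛ ℤ.- 1ℤ ∷ᵛ λ ()

∙₃ : ∀ (u v : Vector ℤ 3) → u ∙ v ≡ u 0F ℤ.* v 0F ℤ.+ (u 1F ℤ.* v 1F ℤ.+ (u 2F ℤ.* v 2F ℤ.+ 0ℤ))
∙₃ u v = trans (∑-suc (λ i → u i ℤ.* v i)) (cong (ℤ._+_ (u 0F ℤ.* v 0F))
  (trans (∑-suc (λ i → u (suc i) ℤ.* v (suc i))) (cong (ℤ._+_ (u 1F ℤ.* v 1F))
  (trans (∑-suc (λ i → u (suc (suc i)) ℤ.* v (suc (suc i))))
    (cong (ℤ._+_ (u 2F ℤ.* v 2F)) (∑-nil (λ i → u (suc (suc (suc i))) ℤ.* v (suc (suc (suc i))))))))))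

simplex-fullDimensional : FullDimensional (hull simplex)
simplex-fullDimensional = (λ i j → fromℤ (simplex i j)) , vertex-∈ simplex , independent
  where
  independent : AffinelyIndependent (λ i j → fromℤ (simplex i j))
  independent c Σc≃0 balanced = λ { 0F → others 0F (λ n → e₀ (x 0F n) (x 1F n) (x 2F n) (x 3F n))
                                  ; 1F → others 1F (λ n → e₁′ (x 0F n) (x 1F n) (x 2F n) (x 3F n))
                                  ; 2F → others 2F (λ n → e₂ (x 0F n) (x 1F n) (x 2F n) (x 3F n))
                                  ; 3F → c₃≃0 }
    where
    x : Fin 4 → ℕ → ℚ
    x i n = seq (c i) n
    D : Fin 3 → ℝ
    D j = sum (λ i → c i * fromℤ (simplex i j))
    e₀ : ∀ a b c d → a ≡ (a ℚ.* 1ℚ ℚ.+ (b ℚ.* 0ℚ ℚ.+ (c ℚ.* 0ℚ ℚ.+ (d ℚ.* (ℚ.- 1ℚ) ℚ.+ 0ℚ)))) ℚ.+ d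
    e₀ = solve-∀ ℚ-ring
    e₁′ : ∀ a b c d → b ≡ (a ℚ.* 0ℚ ℚ.+ (b ℚ.* 1ℚ ℚ.+ (c ℚ.* 0ℚ ℚ.+ (d ℚ.* (ℚ.- 1ℚ) ℚ.+ 0ℚ)))) ℚ.+ d
    e₁′ = solve-∀ ℚ-ring
    e₂ : ∀ a b c d → c ≡ (a ℚ.* 0ℚ ℚ.+ (b ℚ.* 0ℚ ℚ.+ (c ℚ.* 1ℚ ℚ.+ (d ℚ.* (ℚ.- 1ℚ) ℚ.+ 0ℚ)))) ℚ.+ d
    e₂ = solve-∀ ℚ-ring
    e₃ : ∀ a b c d → d ≡ ½ ℚ.* (½ ℚ.* ((a ℚ.+ (b ℚ.+ (c ℚ.+ (d ℚ.+ 0ℚ)))) ℚ.+ ℚ.- 1ℚ ℚ.*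
      ((a ℚ.* 1ℚ ℚ.+ (b ℚ.* 0ℚ ℚ.+ (c ℚ.* 0ℚ ℚ.+ (d ℚ.* (ℚ.- 1ℚ) ℚ.+ 0ℚ)))) ℚ.+
      ((a ℚ.* 0ℚ ℚ.+ (b ℚ.* 1ℚ ℚ.+ (c ℚ.* 0ℚ ℚ.+ (d ℚ.* (ℚ.- 1ℚ) ℚ.+ 0ℚ)))) ℚ.+
       (a ℚ.* 0ℚ ℚ.+ (b ℚ.* 0ℚ ℚ.+ (c ℚ.* 1ℚ ℚ.+ (d ℚ.* (ℚ.- 1ℚ) ℚ.+ 0ℚ))))))))
    e₃ = solve-∀ ℚ-ring
    +-≃0 : ∀ {y z} → y ≃ 0ℝ → z ≃ 0ℝ → y + z ≃ 0ℝ
    +-≃0 {y} {z} p q = ≃-trans {y + z} {0ℝ + 0ℝ} {0ℝ} (≤-antisym {y + z} {0ℝ + 0ℝ}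
        (+-mono-≤ {y} {0ℝ} {z} {0ℝ} (≃⇒≤ {y} {0ℝ} p) (≃⇒≤ {z} {0ℝ} q))
          (+-mono-≤ {0ℝ} {y} {0ℝ} {z} (≃⇒≥ {y} {0ℝ} p) (≃⇒≥ {z} {0ℝ} q)))
      (pointwise {0ℝ + 0ℝ} {0ℝ} λ _ → refl)
    scale-≃0 : ∀ {y} r → y ≃ 0ℝ → fromℚ r * y ≃ 0ℝ
    scale-≃0 {y} r p = ≃-trans {fromℚ r * y} {fromℚ r * 0ℝ} {0ℝ} (*-congˡ {y} {0ℝ} (fromℚ r) p)
      (pointwise {fromℚ r * 0ℝ} {0ℝ} λ _ → ℚP.*-zeroʳ r)
    -- For j < 3 the sum D j is cⱼ - c₃, so Σ c - Σ D = 4 c₃.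
    combination : ℝ
    combination = fromℚ ½ * (fromℚ ½ * (sum c + fromℚ (ℚ.- 1ℚ) * (D 0F + (D 1F + D 2F))))
    combination≃0 : combination ≃ 0ℝ
    combination≃0 = scale-≃0 {fromℚ ½ * (sum c + fromℚ (ℚ.- 1ℚ) * (D 0F + (D 1F + D 2F)))} ½
      (scale-≃0 {sum c + fromℚ (ℚ.- 1ℚ) * (D 0F + (D 1F + D 2F))} ½
        (+-≃0 {sum c} {fromℚ (ℚ.- 1ℚ) * (D 0F + (D 1F + D 2F))} Σc≃0
          (scale-≃0 {D 0F + (D 1F + D 2F)} (ℚ.- 1ℚ)
            (+-≃0 {D 0F} {D 1F + D 2F} (balanced 0F) (+-≃0 {D 1F} {D 2F} (balanced 1F) (balanced 2F))))))
    c₃≃0 : c 3F ≃ 0ℝ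
    c₃≃0 = ≃-trans {c 3F} {combination} {0ℝ}
      (pointwise {c 3F} {combination} λ n → e₃ (x 0F n) (x 1F n) (x 2F n) (x 3F n)) combination≃0
    others : ∀ j → (∀ n → seq (c (Fin.inject₁ j)) n ≡ seq (D j + c 3F) n) → c (Fin.inject₁ j) ≃ 0ℝ
    others j e = ≃-trans {c (Fin.inject₁ j)} {D j + c 3F} {0ℝ} (pointwise {c (Fin.inject₁ j)} {D j + c 3F} e)
      (+-≃0 {D j} {c 3F} (balanced j) c₃≃0)

-- The origin is interior, so h a < 0 for a ≠ 0, and h a ≤ - 1 by integrality: the origin lies in
-- the adjoint for s = 1. The width 2 in direction `e₁` shows that no larger s is attained.
simplex-sup : IsSup (Attained simplex) 1ℝ
simplex-sup = weak-duality simplex A w A≢0 w≥0 balanced 1ℚ ∑w>0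
  (trans (cong (λ t → ι t ℚ.* 1ℚ) ∑w≡2)
  (cong (λ z → ι (ℤ.- z)) (sym (trans (pair (h ∘ A)) (cong₂ ℤ._+_ h-e₁ h--e₁))))) ,
  λ u ub → ub 1ℝ (feasible-attained simplex 1ℤ 1ℤ (ℤ.+<+ (ℕ.s≤s ℕ.z≤n)) (const 0ℤ) 1ℤ (ℤ.+<+ (ℕ.s≤s ℕ.z≤n)) feasible
    1ℚ 0<1 refl)
  where
  open Support simplex
  open OppositePair e₁ e₁≢0
  e₁∙ : ∀ v → e₁ ∙ v ≡ v 0F
  e₁∙ v = trans (∙₃ e₁ v) (shape (v 0F) (v 1F) (v 2F))
    where shape : ∀ a b c → 1ℤ ℤ.* a ℤ.+ (0ℤ ℤ.* b ℤ.+ (0ℤ ℤ.* c ℤ.+ 0ℤ)) ≡ a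
          shape = solve-ℤ
  -e₁∙ : ∀ v → -a ∙ v ≡ ℤ.- v 0F
  -e₁∙ v = trans (-a∙ v) (cong ℤ.-_ (e₁∙ v))
  least₃ : ∀ j → simplex 3F 0F ℤ.≤ simplex j 0F
  least₃ 0F = ℤ.-≤+
  least₃ 1F = ℤ.-≤+
  least₃ 2F = ℤ.-≤+
  least₃ 3F = ℤP.≤-refl
  greatest₀ : ∀ j → ℤ.- simplex 0F 0F ℤ.≤ ℤ.- simplex j 0F
  greatest₀ 0F = ℤP.≤-refl
  greatest₀ 1F = ℤ.-≤+
  greatest₀ 2F = ℤ.-≤+
  greatest₀ 3F = ℤ.-≤+
  h-e₁ : h e₁ ≡ ℤ.- 1ℤ
  h-e₁ = trans (h-unique e₁ 3F (λ j → subst₂ ℤ._≤_ (sym (e₁∙ (simplex 3F))) (sym (e₁∙ (simplex j))) (least₃ j)))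
    (e₁∙ (simplex 3F))
  h--e₁ : h -a ≡ ℤ.- 1ℤ
  h--e₁ = trans (h-unique -a 0F
    (λ j → subst₂ ℤ._≤_ (sym (-e₁∙ (simplex 0F))) (sym (-e₁∙ (simplex j))) (greatest₀ j))) (-e₁∙ (simplex 0F))
  h<0 : ∀ a → Nonzero a → h a ℤ.< 0ℤ
  h<0 a a≢0 = ℤP.≰⇒> λ 0≤h → a≢0 (vanish (λ i → ℤP.≤-trans 0≤h (h≤ a i)))
    where
    s₀ : ∀ a b c → a ℤ.* 1ℤ ℤ.+ (b ℤ.* 0ℤ ℤ.+ (c ℤ.* 0ℤ ℤ.+ 0ℤ)) ≡ a
    s₀ = solve-ℤ
    s₁ : ∀ a b c → a ℤ.* 0ℤ ℤ.+ (b ℤ.* 1ℤ ℤ.+ (c ℤ.* 0ℤ ℤ.+ 0ℤ)) ≡ b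
    s₁ = solve-ℤ
    s₂ : ∀ a b c → a ℤ.* 0ℤ ℤ.+ (b ℤ.* 0ℤ ℤ.+ (c ℤ.* 1ℤ ℤ.+ 0ℤ)) ≡ c
    s₂ = solve-ℤ
    s₃ : ∀ a b c → a ℤ.* (ℤ.- 1ℤ) ℤ.+ (b ℤ.* (ℤ.- 1ℤ) ℤ.+ (c ℤ.* (ℤ.- 1ℤ) ℤ.+ 0ℤ)) ≡ ℤ.- (a ℤ.+ (b ℤ.+ c))
    s₃ = solve-ℤ
    vanish : (∀ i → 0ℤ ℤ.≤ a ∙ simplex i) → ∀ j → a j ≡ 0ℤ
    vanish nonneg j = ℤP.≤-antisym (ℤP.≤-trans (≤-∑ a≥0 j) Σa≤0) (a≥0 j)
      where
      entry : ∀ {i z} → a 0F ℤ.* simplex i 0F ℤ.+ (a 1F ℤ.* simplex i 1F ℤ.+ (a 2F ℤ.* simplex i 2F ℤ.+ 0ℤ)) ≡ z →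
        0ℤ ℤ.≤ z
      entry {i} e = subst (0ℤ ℤ.≤_) (trans (∙₃ a (simplex i)) e) (nonneg i)
      a≥0 : ∀ j → 0ℤ ℤ.≤ a j
      a≥0 0F = entry {0F} (s₀ (a 0F) (a 1F) (a 2F))
      a≥0 1F = entry {1F} (s₁ (a 0F) (a 1F) (a 2F))
      a≥0 2F = entry {2F} (s₂ (a 0F) (a 1F) (a 2F))
      Σa : ∑ a ≡ a 0F ℤ.+ (a 1F ℤ.+ a 2F)
      Σa = trans (∑-suc a) (cong (ℤ._+_ (a 0F))
        (trans (∑-suc (tail a)) (cong (ℤ._+_ (a 1F))
        (trans (∑-suc (tail (tail a)))
        (trans (cong (ℤ._+_ (a 2F)) (∑-nil (tail (tail (tail a))))) (ℤP.+-identityʳ (a 2F)))))))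
      Σa≤0 : ∑ a ℤ.≤ 0ℤ
      Σa≤0 = ℤP.neg-cancel-≤ (subst (λ z → 0ℤ ℤ.≤ ℤ.- z) (sym Σa) (entry {3F} (s₃ (a 0F) (a 1F) (a 2F))))
  feasible : Feasible 1ℤ 1ℤ (const 0ℤ) 1ℤ
  feasible a a≢0 = subst₂ ℤ._≤_ (shape (h a)) (sym (∑-zero (λ j → ℤP.*-zeroʳ (a j)))) (ℤP.i<j⇒suc[i]≤j (h<0 a a≢0))
    where shape : ∀ x → 1ℤ ℤ.+ x ≡ 1ℤ ℤ.* (1ℤ ℤ.* x ℤ.+ 1ℤ)
          shape = solve-ℤ

-- Description of the spectrum

satisfiable : ∀ q → q ∈ₗ numerators → Satisfiable (InfinitelyDivisible q)
satisfiable q q∈ = mkℕ⁺ q {{numerators-nonZero q∈}} ,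
  dilates-in-spectrum simplex simplex-fullDimensional q∈ q {{numerators-nonZero q∈}}
    (IsSup-resp-≃ {Attained simplex} {1ℝ} {fromℚ (ratio q q∈)}
      (pointwise {1ℝ} {fromℚ (ratio q q∈)} λ _ → sym ratio≡1) simplex-sup)
  where
  ratio≡1 : ratio q q∈ ≡ 1ℚ
  ratio≡1 = *-cancel-≡ {ι (+ q)} (ι-mono-< 0ℤ (+ q) (q>0 q∈))
    (trans (ratio-spec q q∈) (sym (ℚP.*-identityʳ (ι (+ q)))))

-- The empty sum of weights is 0, not 1. This leaves polytopes with at least one generator, over
-- which minima can be taken.
empty-hull : ∀ {d} (G : Fin 0 → Vector ℤ d) x → ¬ x ∈ hull G
empty-hull G x (w , _ , Σw≃1 , _) = <⇒≱ {0ℝ} {1ℝ} (1ℚ , 0<1 , 0 , λ _ _ → ℚP.≤-refl)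
  (≤-trans {1ℝ} {sum w} {0ℝ} (≃⇒≥ {sum w} {1ℝ} Σw≃1) (pointwise-≤ {sum w} {0ℝ} λ _ → ℚP.≤-refl))

spectrum⊆ : ∀ μ → μ ∈ FineSpectrum 3 →
  ∃[ q ] ∃[ ℓ ] ∃[ k ] (q ∈ₗ numerators × ℓ ∈ InfinitelyDivisible q × μ ≃ q /[ k · ℓ ])
spectrum⊆ μ (record { size = zero ; generators = G ; fullDimensional = p , p∈ , _ } , _) =
  contradiction (p∈ zero) (empty-hull G (p zero))
spectrum⊆ μ (record { size = suc m ; generators = G ; fullDimensional = full } , σ , sup , μσ≃1)
  = result (rational-sup G σ sup)
  where
  result : ∃[ q ] Σ[ q∈ ∈ q ∈ₗ numerators ] ∃[ N ] (N ≢ 0 × σ ≃ fromℚ (ratio N q∈)) →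
    ∃[ q ] ∃[ ℓ ] ∃[ k ] (q ∈ₗ numerators × ℓ ∈ InfinitelyDivisible q × μ ≃ q /[ k · ℓ ])
  -- The dilates of the given polytope realize q / (k N) for all k, so N itself belongs to the set
  -- of q and k = 1 suffices.
  result (q , q∈ , N , N≢0 , σ≃r) = q , mkℕ⁺ N , mkℕ⁺ 1 , q∈ ,
      dilates-in-spectrum G full q∈ N (IsSup-resp-≃ {Attained G} {σ} {fromℚ (ratio N q∈)} σ≃r sup) , μ≃u
    where
    instance
      N-nonZero : ℕ.NonZero N
      N-nonZero = ℕ.≢-nonZero N≢0
    r u : ℝ
    r = fromℚ (ratio N q∈)
    u = q /[ mkℕ⁺ 1 · mkℕ⁺ N ]
    u′ : ℚ
    u′ = ℚ._/_ (+ q) (1 ℕ.* N) {{ℕP.m*n≢0 1 N}}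
    ru≡1 : ∀ x → (x ℚ.* ratio N q∈) ℚ.* u′ ≡ x
    ru≡1 x = trans (shape x (ratio N q∈) u′) (trans (cong (x ℚ.*_) (reciprocal-ratio q∈ 1 N)) (ℚP.*-identityʳ x))
      where shape : ∀ x r u → (x ℚ.* r) ℚ.* u ≡ x ℚ.* (u ℚ.* (1ℚ ℚ.* r))
            shape = solve-∀ ℚ-ring
    μ≃u : μ ≃ u
    μ≃u = ≃-trans {μ} {(μ * r) * u} {u} (≃-sym {(μ * r) * u} {μ} (pointwise {(μ * r) * u} {μ} λ n → ru≡1 (seq μ n)))
      (≃-trans {(μ * r) * u} {1ℝ * u} {u} (*-congʳ {μ * r} {1ℝ} u
          (≃-trans {μ * r} {μ * σ} {1ℝ} (*-congˡ {r} {σ} μ (≃-sym {σ} {r} σ≃r)) μσ≃1))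
        (pointwise {1ℝ * u} {u} λ _ → ℚP.*-identityˡ u′))

mainTheorem8 : Σ[ S ∈ (ℕ → Pred ℕ⁺ 0ℓ) ]
    ((∀ q → q ∈ₗ numerators → Satisfiable (S q)) ×
    FineSpectrum 3 ≐
    (λ μ → ∃[ q ] ∃[ ℓ ] ∃[ k ]
    (q ∈ₗ numerators × ℓ ∈ S q × μ ≃ q /[ k · ℓ ])))
mainTheorem8 = InfinitelyDivisible , satisfiable ,
  (λ {μ} → spectrum⊆ μ) , λ {μ} (q , ℓ , k , q∈ , ℓ∈ , μ≃) → spectrum-resp-≃ {μ} {q /[ k · ℓ ]} μ≃ (ℓ∈ k)
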